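{- Testing isomorphism of two finite groups $G$ and $H$ of order $n$ (given by their multiplication tables) is $n^{(1/2)\log_p n + O(1)}$ time Turing reducible to testing isomorphism of composition series for $G$ and $H$, where $p$ is the smallest prime dividing the order of the group. That is, there is an algorithm with access to an oracle deciding whether a given composition series for $G$ is isomorphic to a given composition series for $H$, which decides whether $G \cong H$ in time $n^{(1/2)\log_p n + O(1)}$.
   Context: Groups are given as multiplication tables on the element set $[n]=\{1,\dots,n\}$. A subnormal series of a group $G$ is a tower of subgroups $G_0 = 1 \triangleleft G_1 \triangleleft \cdots \triangleleft G_m = G$; a composition series is a maximal subnormal series. Two composition series $G_0 = 1 \triangleleft \cdots \triangleleft G_m = G$ and $H_0 = 1 \triangleleft \cdots \triangleleft H_{m'} = H$ are isomorphic if there is a group isomorphism $\phi : G \to H$ such that $\phi[G_i] = H_i$ for each $i$ (in particular $m=m'$). Constants hidden in $O(\cdot)$ are absolute. -}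

module Defs where

open import Algebra.Bundles using (Group)
open import Algebra.Morphism.Structures using (module GroupMorphisms)
open import Algebra.Structures using (IsGroup)
open import Data.Bool using (Bool; true; false; if_then_else_)
open import Data.Fin using (Fin; toℕ; fromℕ; fromℕ<; inject₁) renaming (zero to fzero; suc to fsuc)
open import Data.Fin.Subset using (Subset; _∈_; _⊂_; ⁅_⁆; ⊤)
open import Data.List using (List; []; _∷_; _++_; [_]; concat; tabulate)
open import Data.Nat using (ℕ; zero; suc; _+_; _*_; _∸_; _^_; _≤_; _≡ᵇ_; _<?_)
open import Data.Nat.Divisibility using (_∣_)
open import Data.Nat.Primality using (Prime)
open import Data.Product using (Σ; ∃; _×_; _,_)
open import Data.Vec using (lookup)
open import Function.Bundles using (_⇔_)
open import Level using (0ℓ)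
open import Relation.Binary.PropositionalEquality using (_≡_; _≢_)
open import Relation.Nullary using (yes; no)

record FinGroup (n : ℕ) : Set where
  field
    mul     : Fin n → Fin n → Fin n
    unit    : Fin n
    inv     : Fin n → Fin n
    isGroup : IsGroup _≡_ mul unit inv

  group : Group 0ℓ 0ℓ
  group = record { isGroup = isGroup }

module _ {n : ℕ} (G : FinGroup n) where
  open FinGroup G

  record IsSubgroup (K : Subset n) : Set where
    field
      unit-closed : unit ∈ K
      mul-closed  : ∀ {x y} → x ∈ K → y ∈ K → mul x y ∈ K
      inv-closed  : ∀ {x} → x ∈ K → inv x ∈ K

  NormalizedBy : Subset n → Subset n → Set
  NormalizedBy K L = ∀ {g x} → g ∈ L → x ∈ K → mul (mul g x) (inv g) ∈ K

  -- The inclusions are proper; otherwise any series could be lengthened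
  -- by repeating a term.
  record SubnormalSeries (m : ℕ) : Set where
    field
      term       : Fin (suc m) → Subset n
      isSubgroup : ∀ i → IsSubgroup (term i)
      bottom     : term fzero ≡ ⁅ unit ⁆
      top        : term (fromℕ m) ≡ ⊤
      proper     : ∀ (i : Fin m) → term (inject₁ i) ⊂ term (fsuc i)
      normal     : ∀ (i : Fin m) → NormalizedBy (term (inject₁ i)) (term (fsuc i))

  open SubnormalSeries

  _Refines_ : ∀ {k m} → SubnormalSeries k → SubnormalSeries m → Set
  T Refines S = ∀ i → ∃ λ j → term T j ≡ term S i

  IsMaximal : ∀ {m} → SubnormalSeries m → Set
  IsMaximal S = ∀ {k} (T : SubnormalSeries k) → T Refines S → S Refines T

  record CompositionSeries (m : ℕ) : Set where
    field
      series    : SubnormalSeries m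
      isMaximal : IsMaximal series

    open SubnormalSeries series public

module _ {n n′ : ℕ} (G : FinGroup n) (H : FinGroup n′) where
  open GroupMorphisms
    (Group.rawGroup (FinGroup.group G)) (Group.rawGroup (FinGroup.group H))

  IsIsomorphism : (Fin n → Fin n′) → Set
  IsIsomorphism = IsGroupIsomorphism

  Isomorphic : Set
  Isomorphic = ∃ λ φ → IsIsomorphism φ

  ImageEquals : (Fin n → Fin n′) → Subset n → Subset n′ → Set
  ImageEquals φ K L = ∀ y → (y ∈ L) ⇔ (∃ λ x → x ∈ K × φ x ≡ y)

  SeriesIsomorphic : ∀ {m m′} → CompositionSeries G m → CompositionSeries H m′ → Set
  SeriesIsomorphic {m} {m′} S T =
    m ≡ m′ ×
    ∃ λ φ → IsIsomorphism φ ×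
      (∀ i j → toℕ i ≡ toℕ j → ImageEquals φ (S .term i) (T .term j))
    where open CompositionSeries

-- An oracle random access machine: a program addresses finitely many two-dimensional arrays of natural
-- numbers, named by numerals.  Successor is the only operation that
-- increases a value, so after t steps every value is bounded by the
-- largest input or literal plus t, and unit cost agrees with logarithmic
-- cost up to a factor O(log (n + t)).

Store : Set
Store = ℕ → ℕ → ℕ → ℕ

_[_,_,_≔_] : Store → ℕ → ℕ → ℕ → ℕ → Store
(s [ a , i , j ≔ v ]) b k l =
  if a ≡ᵇ b then (if i ≡ᵇ k then (if j ≡ᵇ l then v else s b k l) else s b k l) else s b k l

data Expr : Set where
  lit     : ℕ → Expr
  _⟨_,_⟩  : ℕ → Expr → Expr → Expr
  succ    : Expr → Expr
  _⊖_     : Expr → Expr → Expr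
  _==_    : Expr → Expr → Expr

fromBool : Bool → ℕ
fromBool b = if b then 1 else 0

eval : Expr → Store → ℕ
eval (lit k)       s = k
eval (a ⟨ e , f ⟩) s = s a (eval e s) (eval f s)
eval (succ e)      s = suc (eval e s)
eval (e ⊖ f)       s = eval e s ∸ eval f s
eval (e == f)      s = fromBool (eval e s ≡ᵇ eval f s)

size : Expr → ℕ
size (lit k)       = 1
size (a ⟨ e , f ⟩) = 1 + size e + size f
size (succ e)      = 1 + size e
size (e ⊖ f)       = 1 + size e + size f
size (e == f)      = 1 + size e + size f

-- `emit` appends one number to the write-only query tape; `ask` submits
-- the tape to the oracle, stores the answer bit and erases the tape.
data Program : Set where
  skip          : Program
  _⟨_,_⟩:=_     : ℕ → Expr → Expr → Expr → Program
  _⨾_           : Program → Program → Program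
  if_then_else′_ : Expr → Program → Program → Program
  while_loop_   : Expr → Program → Program
  emit          : Expr → Program
  ask_⟨_,_⟩     : ℕ → Expr → Expr → Program

infixr 5 _⨾_

record Config : Set where
  constructor _∥_
  field
    store : Store
    tape  : List ℕ

open Config public

Oracle : Set
Oracle = List ℕ → Bool

-- Run O c κ κ′ t : with oracle O, program c started in configuration κ
-- halts in configuration κ′ after t steps.
data Run (O : Oracle) : Program → Config → Config → ℕ → Set where
  run-skip : ∀ {κ} → Run O skip κ κ 1

  run-assign : ∀ {a e f g s q} →
    Run O (a ⟨ e , f ⟩:= g) (s ∥ q)
      ((s [ a , eval e s , eval f s ≔ eval g s ]) ∥ q)
      (1 + size e + size f + size g)

  run-seq : ∀ {c d κ κ′ κ″ t u} →
    Run O c κ κ′ t → Run O d κ′ κ″ u → Run O (c ⨾ d) κ κ″ (t + u)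

  run-then : ∀ {e c d κ κ′ t} → eval e (store κ) ≢ 0 →
    Run O c κ κ′ t → Run O (if e then c else′ d) κ κ′ (1 + size e + t)

  run-else : ∀ {e c d κ κ′ t} → eval e (store κ) ≡ 0 →
    Run O d κ κ′ t → Run O (if e then c else′ d) κ κ′ (1 + size e + t)

  run-stop : ∀ {e c κ} → eval e (store κ) ≡ 0 →
    Run O (while e loop c) κ κ (1 + size e)

  run-loop : ∀ {e c κ κ′ κ″ t u} → eval e (store κ) ≢ 0 →
    Run O c κ κ′ t → Run O (while e loop c) κ′ κ″ u →
    Run O (while e loop c) κ κ″ (1 + size e + t + u)

  run-emit : ∀ {e s q} →
    Run O (emit e) (s ∥ q) (s ∥ (q ++ [ eval e s ])) (1 + size e)

  run-ask : ∀ {a e f s q} →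
    Run O (ask a ⟨ e , f ⟩) (s ∥ q)
      ((s [ a , eval e s , eval f s ≔ fromBool (O q) ]) ∥ [])
      (1 + size e + size f)

module _ {n : ℕ} where

  tableEntry : FinGroup n → ℕ → ℕ → ℕ
  tableEntry G i j with i <? n | j <? n
  ... | yes i<n | yes j<n = toℕ (FinGroup.mul G (fromℕ< i<n) (fromℕ< j<n))
  ... | _       | _       = 0

  -- Array 0 holds n at position (0,0), arrays 1 and 2 hold the two tables.
  input : FinGroup n → FinGroup n → Config
  input G H = s ∥ []
    where
    s : Store
    s 0 0 0 = n
    s 1 i j = tableEntry G i j
    s 2 i j = tableEntry H i j
    s _ _ _ = 0

  flatten : ∀ {k l} → (Fin k → Fin l → ℕ) → List ℕ
  flatten M = concat (tabulate λ i → tabulate λ j → M i j)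

  encodeTable : FinGroup n → List ℕ
  encodeTable G = flatten λ x y → toℕ (FinGroup.mul G x y)

  encodeSeries : ∀ {G : FinGroup n} {m} → CompositionSeries G m → List ℕ
  encodeSeries {m = m} S =
    m ∷ flatten λ i x → fromBool (lookup (CompositionSeries.term S i) x)

  encodeQuery : ∀ {G H : FinGroup n} {m m′} →
    CompositionSeries G m → CompositionSeries H m′ → List ℕ
  encodeQuery {G} {H} S T =
    n ∷ encodeTable G ++ encodeTable H ++ encodeSeries S ++ encodeSeries T

  -- Nothing is assumed about the answers to strings that do not encode a
  -- composition series for G followed by one for H.
  DecidesSeriesIsomorphism : Oracle → FinGroup n → FinGroup n → Set
  DecidesSeriesIsomorphism O G H =
    ∀ {m m′} (S : CompositionSeries G m) (T : CompositionSeries H m′) →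
    (O (encodeQuery S T) ≡ true) ⇔ SeriesIsomorphic G H S T

Accepting : Config → Set
Accepting κ = store κ 3 0 0 ≡ 1

IsSmallestPrimeDivisor : ℕ → ℕ → Set
IsSmallestPrimeDivisor p n =
  Prime p × p ∣ n × (∀ q → Prime q → q ∣ n → p ≤ q)

-- log_p n ≤ a / b, for b > 0
LogAtMost : (p n a b : ℕ) → Set
LogAtMost p n a b = n ^ b ≤ p ^ a

-- t ≤ n ^ ((1/2) log_p n + c) as real numbers: by continuity this says
-- t ≤ n ^ (a/(2b) + c) for every rational a/b ≥ log_p n, and the
-- inequality for a/b is raised to the power 2b.
WithinBound : (p n c t : ℕ) → Set
WithinBound p n c t =
  ∀ a b → b ≢ 0 → LogAtMost p n a b → t ^ (2 * b) ≤ n ^ (a + 2 * b * c)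

{-# OPTIONS --safe #-}
module Submission where

-- A composition series of H is built from the bottom.  If K is one of its
-- terms, then the next term L is the smallest subnormal subgroup of H that
-- contains K and x, for any x in L ∖ K; so only one x per coset of K has to be
-- tried, say the least one.  The i-th term has at least pⁱ elements, which
-- leaves at most n / pⁱ choices for the next one, and there are at most
-- nᵐ / p^(m(m-1)/2) ≤ n^((1/2) log_p n + 1/2) partial series of length m.  They
-- are listed level by level, once for G, where one complete series S is kept,
-- and once for H, where the oracle compares every complete series with S.

open import Defs
open import Algebra.Bundles using (Group)
open import Algebra.Morphism.Structures using (module GroupMorphisms)
import Algebra.Properties.Group as GroupProperties
import Algebra.Properties.Loop as LoopProperties
import Algebra.Properties.Quasigroup as QuasigroupProperties
open import Data.Bool using (Bool; true; false; _∨_; _∧_; not; if_then_else_; T)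
open import Data.Bool.Properties using (T-≡)
open import Data.Empty using (⊥; ⊥-elim)
open import Data.Fin using (Fin; toℕ; fromℕ; fromℕ<; inject₁) renaming (zero to fzero; suc to fsuc)
open import Data.Fin.Induction using (<-weakInduction; >-weakInduction)
open import Data.Fin.Properties using (toℕ<n; toℕ-fromℕ; toℕ-fromℕ<; fromℕ<-toℕ; toℕ-inject₁; toℕ-injective; any?; all?) renaming (_≟_ to _≟ᶠ_)
open import Data.Fin.Subset using (Subset; ⁅_⁆) renaming (_∈_ to _∈ˢ_; _⊆_ to _⊆ˢ_)
open import Data.Fin.Subset.Properties using (⊆-antisym; x∈⁅x⁆; x∈⁅y⁆⇒x≡y; ∈⊤; _∈?_)
open import Data.List using (List; []; _∷_; _++_; [_]; allFin; cartesianProduct; concat; filter; length; map; tabulate)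
open import Data.List.Membership.Propositional using (_∈_)
open import Data.List.Membership.Propositional.Properties using (∈-∃++; ∈-++⁺ˡ; ∈-++⁺ʳ; ∈-++⁻; ∈-filter⁺; ∈-filter⁻; ∈-allFin; ∈-map⁺; ∈-map⁻; ∈-cartesianProduct⁺; ∈-cartesianProduct⁻)
open import Data.List.Properties using (++-assoc; ++-identityʳ; length-++; length-map; length-tabulate; tabulate-cong)
open import Data.List.Relation.Unary.All as All using (All; []; _∷_)
import Data.List.Relation.Unary.All.Properties as AllP
open import Data.List.Relation.Unary.AllPairs using ([]; _∷_)
open import Data.List.Relation.Unary.Any using (here; there)
open import Data.List.Relation.Unary.Unique.Propositional using (Unique)
import Data.List.Relation.Unary.Unique.Propositional.Properties as UniqueP
open import Data.Nat
open import Data.Nat.Divisibility using (_∣_; divides; ∣-trans; ∣⇒≤)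
open import Data.Nat.ListAction using (product)
open import Data.Nat.Primality using (Prime; prime⇒nonZero; prime⇒nonTrivial)
open import Data.Nat.Primality.Factorisation using (factorise)
open import Data.Nat.Properties
open import Data.Nat.Solver using (module +-*-Solver)
open import Data.Product using (Σ; ∃; ∃₂; _×_; _,_; proj₁; proj₂; uncurry)
open import Data.Sum using (_⊎_; inj₁; inj₂)
import Data.Vec as Vec
open import Data.Vec.Properties using (lookup⇒[]=; []=⇒lookup; lookup∘tabulate)
open import Function using (_∘_; id; case_of_)
open import Function.Bundles using (_⇔_; mk⇔; Equivalence)
open import Relation.Binary.PropositionalEquality hiding ([_]; J)
open import Relation.Nullary using (¬_; yes; no; Dec; contradiction; ¬?)
open import Relation.Nullary.Decidable using (_×-dec_; _⊎-dec_; _→-dec_; decidable-stable)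
open import Relation.Unary using (Decidable)

-- Programs, frames and loops

-- The plain subgroup generated by K and x can be too small: if L / K is simple but not cyclic, it
-- may be a proper subgroup of L. A normal closure is therefore taken, but the group in which to
-- take it is unknown; it starts as the whole group and is replaced by each closure in turn.
-- Simplicity of L / K keeps L inside all these closures, and the terms of the series bound them
-- from above. As it is not known in advance whether x leads to a next term, the result is
-- afterwards tested for normality of K and simplicity of the factor, so every stored row is a
-- genuine chain; the count rests on this. Invariants are proved for all runs, whereas the time
-- bounds exhibit a run; both are combined on the run exhibited. Time is first measured by the
-- length of the queue, and only then is this length bounded by counting chains. The program never
-- computes p. A sum over levels is replaced by n + 1 times the largest level, and polynomial
-- factors and constants move into the exponent, which is possible because a prime divisor p forces
-- n ≥ 2.

≡ᵇ-refl : ∀ i → (i ≡ᵇ i) ≡ true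
≡ᵇ-refl zero    = refl
≡ᵇ-refl (suc i) = ≡ᵇ-refl i

≡ᵇ-false : ∀ {i j} → i ≢ j → (i ≡ᵇ j) ≡ false
≡ᵇ-false {i} {j} i≢j with i ≡ᵇ j in eq
... | false = refl
... | true  = contradiction (≡ᵇ⇒≡ i j (subst T (sym eq) _)) i≢j

update-hit : ∀ s a i j v → (s [ a , i , j ≔ v ]) a i j ≡ v
update-hit s a i j v rewrite ≡ᵇ-refl a | ≡ᵇ-refl i | ≡ᵇ-refl j = refl

update-array : ∀ s a i j v b → (a ≡ᵇ b) ≡ false → ∀ k l → (s [ a , i , j ≔ v ]) b k l ≡ s b k l
update-array s a i j v b a≢b k l rewrite a≢b = refl

update-row : ∀ s a {i} j v {b k} → i ≢ k → ∀ l → (s [ a , i , j ≔ v ]) b k l ≡ s b k l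
update-row s a {i} j v {b} {k} i≢k l with a ≡ᵇ b
... | false = refl
... | true rewrite ≡ᵇ-false i≢k = refl

update-column : ∀ s a i {j} v {b k l} → j ≢ l → (s [ a , i , j ≔ v ]) b k l ≡ s b k l
update-column s a i {j} v {b} {k} {l} j≢l with a ≡ᵇ b
... | false = refl
... | true with i ≡ᵇ k
... | false = refl
... | true rewrite ≡ᵇ-false j≢l = refl

-- Each variable, counter and table has an array of its own, so non-interference becomes a Boolean
-- computation and the side conditions on concrete programs hold by `refl`.
writes : Program → ℕ → Bool
writes skip                   b = false
writes (a ⟨ _ , _ ⟩:= _)      b = a ≡ᵇ b
writes (c ⨾ d)                b = writes c b ∨ writes d b
writes (if _ then c else′ d)  b = writes c b ∨ writes d b
writes (while _ loop c)       b = writes c b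
writes (emit _)               b = false
writes (ask a ⟨ _ , _ ⟩)      b = a ≡ᵇ b

-- A record instead of a bare function type, so that the program and both configurations can be
-- inferred from a proof of it.
record Frame (c : Program) (κ κ′ : Config) : Set where
  constructor framed
  field
    keep : ∀ b → writes c b ≡ false → ∀ k l → store κ′ b k l ≡ store κ b k l

open Frame

∨-falseˡ : ∀ {x y} → x ∨ y ≡ false → x ≡ false
∨-falseˡ {false} _ = refl

∨-falseʳ : ∀ {x y} → x ∨ y ≡ false → y ≡ false
∨-falseʳ {false} y≡false = y≡false

∧-trueˡ : ∀ {x y} → x ∧ y ≡ true → x ≡ true
∧-trueˡ {true} _ = refl

∧-trueʳ : ∀ {x y} → x ∧ y ≡ true → y ≡ true
∧-trueʳ {true} p = p

unchanged : ∀ {O c κ κ′ t} → Run O c κ κ′ t → ∀ b → writes c b ≡ false → ∀ k l → store κ′ b k l ≡ store κ b k l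
unchanged run-skip b w k l = refl
unchanged (run-assign {a} {e} {f} {g} {s}) b w k l =
  update-array s a (eval e s) (eval f s) (eval g s) b w k l
unchanged (run-seq {c} r r′) b w k l =
  trans (unchanged r′ b (∨-falseʳ {writes c b} w) k l) (unchanged r b (∨-falseˡ w) k l)
unchanged (run-then {c = c} _ r) b w k l = unchanged r b (∨-falseˡ w) k l
unchanged (run-else {c = c} _ r) b w k l = unchanged r b (∨-falseʳ {writes c b} w) k l
unchanged (run-stop _) b w k l = refl
unchanged (run-loop _ r r′) b w k l = trans (unchanged r′ b w k l) (unchanged r b w k l)
unchanged run-emit b w k l = refl
unchanged {O} (run-ask {a} {e} {f} {s} {q}) b w k l =
  update-array s a (eval e s) (eval f s) (fromBool (O q)) b w k l

silent : Program → Bool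
silent (c ⨾ d)               = silent c ∧ silent d
silent (if _ then c else′ d) = silent c ∧ silent d
silent (while _ loop c)      = silent c
silent (emit _)              = false
silent (ask _ ⟨ _ , _ ⟩)     = false
silent _                     = true

silent-tape : ∀ {O c κ κ′ t} → silent c ≡ true → Run O c κ κ′ t → tape κ′ ≡ tape κ
silent-tape _ run-skip = refl
silent-tape _ run-assign = refl
silent-tape w (run-seq {c} r r′) = trans (silent-tape (∧-trueʳ {silent c} w) r′) (silent-tape (∧-trueˡ w) r)
silent-tape w (run-then _ r) = silent-tape (∧-trueˡ w) r
silent-tape w (run-else {c = c} _ r) = silent-tape (∧-trueʳ {silent c} w) r
silent-tape _ (run-stop _) = refl
silent-tape w (run-loop _ r r′) = trans (silent-tape w r′) (silent-tape w r)

frame : ∀ {O c κ κ′ t} → Run O c κ κ′ t → Frame c κ κ′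
frame r = framed (unchanged r)

scalar : ℕ → Expr
scalar a = a ⟨ lit 0 , lit 0 ⟩

-- The bound is saved at position (1,0) of the counter's array, because the
-- body may change the value of e.
repeat : ℕ → Expr → Program → Program
repeat c e P =
  (c ⟨ lit 1 , lit 0 ⟩:= e) ⨾ (c ⟨ lit 0 , lit 0 ⟩:= lit 0) ⨾
  (while ((c ⟨ lit 1 , lit 0 ⟩) ⊖ scalar c) loop
    (P ⨾ (c ⟨ lit 0 , lit 0 ⟩:= succ (scalar c))))

setCounter : ℕ → ℕ → Config → Config
setCounter c j (s ∥ q) = (s [ c , 0 , 0 ≔ j ]) ∥ q

startLoop : ℕ → ℕ → Config → Config
startLoop c B (s ∥ q) = setCounter c 0 ((s [ c , 1 , 0 ≔ B ]) ∥ q)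

module _ {O : Oracle} {c : ℕ} {e : Expr} {P : Program} (w : writes P c ≡ false) (κ : Config) where

  private
    B = eval e (store κ)

    start-bound : store (startLoop c B κ) c 1 0 ≡ B
    start-bound = trans (update-row (store κ [ c , 1 , 0 ≔ B ]) c {0} 0 0 {c} {1} (λ ()) 0)
                        (update-hit (store κ) c 1 0 B)

    start-counter : store (startLoop c B κ) c 0 0 ≡ 0
    start-counter = update-hit (store κ [ c , 1 , 0 ≔ B ]) c 0 0 0

    frame-start : Frame (repeat c e P) κ (startLoop c B κ)
    frame-start = framed λ b w′ k l →
      trans (update-array (store κ [ c , 1 , 0 ≔ B ]) c 0 0 0 b (∨-falseˡ {c ≡ᵇ b} w′) k l)
            (update-array (store κ) c 1 0 B b (∨-falseˡ {c ≡ᵇ b} w′) k l)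

    frame-step : ∀ {κ₁ κ₂ j t} → Frame (repeat c e P) κ κ₁ → Run O P κ₁ κ₂ t →
                 Frame (repeat c e P) κ (setCounter c j κ₂)
    frame-step {κ₂ = κ₂} {j} f r = framed λ b w′ k l →
      trans (update-array (store κ₂) c 0 0 j b (∨-falseˡ {c ≡ᵇ b} w′) k l)
        (trans (unchanged r b (∨-falseˡ (∨-falseʳ {c ≡ᵇ b} (∨-falseʳ {c ≡ᵇ b} w′))) k l) (keep f b w′ k l))

    bound-step : ∀ {κ₁ κ₂ j t} → Run O P κ₁ κ₂ t →
                 store (setCounter c j κ₂) c 1 0 ≡ store κ₁ c 1 0
    bound-step {κ₂ = κ₂} {j} r =
      trans (update-row (store κ₂) c {0} 0 j {c} {1} (λ ()) 0) (unchanged r c w 1 0)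

  -- Partial correctness. The step receives the frame from the start of the loop to the current
  -- round, so the invariant `I` has to mention only what the loop changes.
  loop-rule : ∀ {κ′ t} (I : ℕ → Config → Set) →
    I 0 (startLoop c B κ) →
    (∀ {j κ₁ κ₂ u} → j < B → store κ₁ c 0 0 ≡ j → Frame (repeat c e P) κ κ₁ →
       Run O P κ₁ κ₂ u → I j κ₁ → I (suc j) (setCounter c (suc j) κ₂)) →
    Run O (repeat c e P) κ κ′ t → I B κ′
  loop-rule I base step (run-seq run-assign (run-seq run-assign r)) =
    go r start-counter start-bound z≤n frame-start base
    where
    go : ∀ {j κ₁ κ′ t} →
      Run O (while ((c ⟨ lit 1 , lit 0 ⟩) ⊖ scalar c) loop (P ⨾ (c ⟨ lit 0 , lit 0 ⟩:= succ (scalar c)))) κ₁ κ′ t →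
      store κ₁ c 0 0 ≡ j → store κ₁ c 1 0 ≡ B → j ≤ B → Frame (repeat c e P) κ κ₁ → I j κ₁ → I B κ′
    go {κ₁ = κ₁} (run-stop eq) refl bd j≤B f i =
      subst (λ j → I j κ₁) (≤-antisym j≤B (subst (_≤ store κ₁ c 0 0) bd (m∸n≡0⇒m≤n eq))) i
    go {κ₁ = κ₁} {κ′} (run-loop {κ′ = _} ne (run-seq {κ′ = κ₂} r run-assign) r′) refl bd j≤B f i
      rewrite unchanged r c w 0 0 =
      go r′ (update-hit (store κ₂) c 0 0 _) (trans (bound-step {j = suc (store κ₁ c 0 0)} r) bd) j<B (frame-step f r)
         (step j<B refl f r i)
      where
      j<B : store κ₁ c 0 0 < B
      j<B = ≤∧≢⇒< j≤B (λ eq → ne (trans (cong₂ _∸_ bd eq) (n∸n≡0 B)))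

  -- A round costs 8 for the guard and 7 for the increment. The two assignments in front cost
  -- `size e + 3` and 4, the final guard another 8.
  loopOverhead : ℕ
  loopOverhead = size e + B * 15 + 15

  -- The invariant also sees the time u spent in the bodies so far. It may thus bound u by a
  -- quantity held in the store, as the search does with the head of its queue.
  loop-total : ∀ (I : ℕ → ℕ → Config → Set) →
    I 0 0 (startLoop c B κ) →
    (∀ {j κ₁ u} → j < B → store κ₁ c 0 0 ≡ j → Frame (repeat c e P) κ κ₁ → I j u κ₁ →
       ∃₂ λ κ₂ v → Run O P κ₁ κ₂ v × I (suc j) (u + v) (setCounter c (suc j) κ₂)) →
    ∃₂ λ κ′ t → Run O (repeat c e P) κ κ′ t × ∃ λ u → I B u κ′ × t ≤ u + loopOverhead
  loop-total I base step with go B (≤-reflexive (+-identityʳ B)) (sym (+-identityʳ B)) start-counter start-bound frame-start base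
    where
    W = while ((c ⟨ lit 1 , lit 0 ⟩) ⊖ scalar c) loop (P ⨾ (c ⟨ lit 0 , lit 0 ⟩:= succ (scalar c)))
    go : ∀ k {j u κ₁} → k + j ≤ B → B ≡ k + j → store κ₁ c 0 0 ≡ j → store κ₁ c 1 0 ≡ B →
         Frame (repeat c e P) κ κ₁ → I j u κ₁ →
         ∃₂ λ κ′ t → Run O W κ₁ κ′ t × ∃ λ u′ → I B u′ κ′ × t + u ≤ u′ + (k * 15 + 8)
    go zero {j} {u} {κ₁} _ refl ct bd f i =
      κ₁ , _ , run-stop (trans (cong₂ _∸_ bd ct) (n∸n≡0 B)) , u , i , ≤-reflexive (+-comm 8 u)
    go (suc k) {j} {u} {κ₁} le eq refl bd f i with step (≤-trans (s≤s (m≤n+m _ k)) le) refl f i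
    ... | κ₂ , v , r , i′
      with go k {suc j} {u + v} {setCounter c (suc j) κ₂}
             (subst (_≤ B) (sym (+-suc k j)) le) (trans eq (sym (+-suc k j)))
             (update-hit (store κ₂) c 0 0 (suc j)) (trans (bound-step {j = suc j} r) bd) (frame-step f r) i′
    ... | κ′ , t , r′ , u′ , i″ , le′ =
      κ′ , _ , run-loop ne (run-seq r run-assign)
                 (subst (λ x → Run O W (setCounter c (suc x) κ₂) κ′ t) (sym (unchanged r c w 0 0)) r′)
         , u′ , i″ , lemma
      where
      ne : store κ₁ c 1 0 ∸ store κ₁ c 0 0 ≢ 0
      ne z = contradiction (subst (_≤ store κ₁ c 0 0) bd (m∸n≡0⇒m≤n z))
               (<⇒≱ (≤-trans (s≤s (m≤n+m _ k)) le))
      open ≤-Reasoning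
      lemma : 8 + (v + 7) + t + u ≤ u′ + (suc k * 15 + 8)
      lemma = begin
        8 + (v + 7) + t + u    ≡⟨ solve 3 (λ v t u → con 8 :+ (v :+ con 7) :+ t :+ u := t :+ (u :+ v) :+ con 15) refl v t u ⟩
        t + (u + v) + 15       ≤⟨ +-monoˡ-≤ 15 le′ ⟩
        u′ + (k * 15 + 8) + 15 ≡⟨ solve 2 (λ u k → u :+ (k :* con 15 :+ con 8) :+ con 15 := u :+ ((con 15 :+ k :* con 15) :+ con 8)) refl u′ k ⟩
        u′ + (suc k * 15 + 8)  ∎
        where open +-*-Solver
  ... | κ′ , t , r , u , i , le = κ′ , _ , run-seq run-assign (run-seq run-assign r) , u , i , lemma
    where
    open ≤-Reasoning
    lemma : 3 + size e + (4 + t) ≤ u + loopOverhead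
    lemma = begin
      3 + size e + (4 + t)                ≡⟨ solve 2 (λ e t → con 3 :+ e :+ (con 4 :+ t) := e :+ con 7 :+ (t :+ con 0)) refl (size e) t ⟩
      size e + 7 + (t + 0)                ≤⟨ +-monoʳ-≤ (size e + 7) le ⟩
      size e + 7 + (u + (B * 15 + 8))     ≡⟨ solve 3 (λ e u k → e :+ con 7 :+ (u :+ (k :+ con 8)) := u :+ (e :+ k :+ con 15)) refl (size e) u (B * 15) ⟩
      u + loopOverhead                    ∎
      where open +-*-Solver

-- Programs all of whose loops run over 0, …, n - 1, where n is the input
-- size held in array 0.
data Stmt : Set where
  set   : ℕ → Expr → Expr → Expr → Stmt
  _⨟_   : Stmt → Stmt → Stmt
  cond  : Expr → Stmt → Stmt → Stmt
  each  : ℕ → Stmt → Stmt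
  nop   : Stmt
  out   : Expr → Stmt
  query : ℕ → Stmt

infixr 5 _⨟_

when : Expr → Stmt → Stmt
when e S = cond e S nop

⌜_⌝ : Stmt → Program
⌜ set a e f g ⌝ = a ⟨ e , f ⟩:= g
⌜ S ⨟ S′ ⌝      = ⌜ S ⌝ ⨾ ⌜ S′ ⌝
⌜ cond e S S′ ⌝ = if e then ⌜ S ⌝ else′ ⌜ S′ ⌝
⌜ each c S ⌝    = repeat c (scalar 0) ⌜ S ⌝
⌜ nop ⌝         = skip
⌜ out e ⌝       = emit e
⌜ query a ⌝     = ask a ⟨ lit 0 , lit 0 ⟩

wellFormed : Stmt → Bool
wellFormed (S ⨟ S′)      = wellFormed S ∧ wellFormed S′
wellFormed (cond e S S′) = wellFormed S ∧ wellFormed S′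
wellFormed (each c S)    = not (writes ⌜ S ⌝ c) ∧ wellFormed S
wellFormed _             = true

coef : Stmt → ℕ
coef (set a e f g) = 1 + size e + size f + size g
coef (S ⨟ S′)      = coef S + coef S′
coef (cond e S S′) = 1 + size e + (coef S + coef S′)
-- The loop overhead is 15 n + 18, hence at most 33 n^(d + 1).
coef (each c S)    = coef S + 33
coef nop           = 1
coef (out e)       = 1 + size e
coef (query a)     = 3

deg : Stmt → ℕ
deg (S ⨟ S′)      = deg S ⊔ deg S′
deg (cond e S S′) = deg S ⊔ deg S′
deg (each c S)    = suc (deg S)
deg _             = 0

not-true : ∀ {x} → not x ≡ true → x ≡ false
not-true {false} _ = refl

module _ {O : Oracle} {n : ℕ} (1≤n : 1 ≤ n) where

  private
    ^-≤ : ∀ {k l} → k ≤ l → n ^ k ≤ n ^ l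
    ^-≤ = ^-monoʳ-≤ n {{>-nonZero 1≤n}}

    1≤^ : ∀ k → 1 ≤ n ^ k
    1≤^ k = ^-≤ {0} {k} z≤n

    const-≤ : ∀ k d → k ≤ k * n ^ d
    const-≤ k d = subst (_≤ k * n ^ d) (*-identityʳ k) (*-monoʳ-≤ k (1≤^ d))

    sum-≤ : ∀ a b k l {t u} → t ≤ a * n ^ k → u ≤ b * n ^ l → t + u ≤ (a + b) * n ^ (k ⊔ l)
    sum-≤ a b k l {t} {u} p q = begin
      t + u                                  ≤⟨ +-mono-≤ p q ⟩
      a * n ^ k + b * n ^ l                  ≤⟨ +-mono-≤ (*-monoʳ-≤ a (^-≤ (m≤m⊔n k l))) (*-monoʳ-≤ b (^-≤ (m≤n⊔m k l))) ⟩
      a * n ^ (k ⊔ l) + b * n ^ (k ⊔ l)      ≡⟨ *-distribʳ-+ (n ^ (k ⊔ l)) a b ⟨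
      (a + b) * n ^ (k ⊔ l)                  ∎
      where open ≤-Reasoning

  -- Every loop bound is the n held in array 0, which the program does not write, so the nesting
  -- depth of loops becomes the degree.
  halts-poly : ∀ S → wellFormed S ≡ true → writes ⌜ S ⌝ 0 ≡ false → ∀ κ → store κ 0 0 0 ≡ n →
          ∃₂ λ κ′ t → Run O ⌜ S ⌝ κ κ′ t × t ≤ coef S * n ^ deg S
  halts-poly (set a e f g) wf w (s ∥ q) eq = _ , _ , run-assign , const-≤ _ 0
  halts-poly (S ⨟ S′) wf w κ eq with halts-poly S (∧-trueˡ wf) (∨-falseˡ w) κ eq
  ... | κ₁ , t , r , t≤
    with halts-poly S′ (∧-trueʳ {wellFormed S} wf) (∨-falseʳ {writes ⌜ S ⌝ 0} w) κ₁ (trans (unchanged r 0 (∨-falseˡ w) 0 0) eq)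
  ... | κ₂ , u , r′ , u≤ = κ₂ , _ , run-seq r r′ , sum-≤ (coef S) (coef S′) (deg S) (deg S′) t≤ u≤
  halts-poly (cond e S S′) wf w κ eq with eval e (store κ) ≟ 0
  ... | yes z with halts-poly S′ (∧-trueʳ {wellFormed S} wf) (∨-falseʳ {writes ⌜ S ⌝ 0} w) κ eq
  ... | κ₁ , t , r , t≤ = κ₁ , _ , run-else z r ,
    sum-≤ (1 + size e) (coef S + coef S′) 0 (deg S ⊔ deg S′) (const-≤ (1 + size e) 0)
      (sum-≤ (coef S) (coef S′) (deg S) (deg S′) {0} z≤n t≤)
  halts-poly (cond e S S′) wf w κ eq | no ¬z with halts-poly S (∧-trueˡ wf) (∨-falseˡ w) κ eq
  ... | κ₁ , t , r , t≤ = κ₁ , _ , run-then ¬z r ,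
    sum-≤ (1 + size e) (coef S + coef S′) 0 (deg S ⊔ deg S′) (const-≤ (1 + size e) 0)
      (subst (_≤ (coef S + coef S′) * n ^ (deg S ⊔ deg S′)) (+-identityʳ t)
        (sum-≤ (coef S) (coef S′) (deg S) (deg S′) {t} {0} t≤ z≤n))
  halts-poly (each c S) wf w κ refl with
    loop-total {O} {c} {scalar 0} {⌜ S ⌝} (not-true (∧-trueˡ wf)) κ (λ j u κ′ → u ≤ j * (coef S * n ^ deg S)) z≤n
      (λ {j} {κ₁} {u} j<B ct f i → step {j} {κ₁} {u} f i)
    where
    w₀ : writes ⌜ S ⌝ 0 ≡ false
    w₀ = ∨-falseˡ (∨-falseʳ {c ≡ᵇ 0} (∨-falseʳ {c ≡ᵇ 0} w))
    step : ∀ {j κ₁ u} → Frame (repeat c (scalar 0) ⌜ S ⌝) κ κ₁ → u ≤ j * (coef S * n ^ deg S) →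
      ∃₂ λ κ₂ v → Run O ⌜ S ⌝ κ₁ κ₂ v × u + v ≤ suc j * (coef S * n ^ deg S)
    step {j} {κ₁} {u} f i with halts-poly S (∧-trueʳ {not (writes ⌜ S ⌝ c)} wf) w₀ κ₁ (keep f 0 w 0 0)
    ... | κ₂ , v , r , v≤ = κ₂ , v , r ,
      ≤-trans (+-mono-≤ i v≤) (≤-reflexive (+-comm (j * (coef S * n ^ deg S)) (coef S * n ^ deg S)))
  ... | κ′ , t , r , u , u≤ , t≤ = κ′ , t , r , lemma
    where
    open ≤-Reasoning
    d = deg S
    lemma : t ≤ (coef S + 33) * n ^ suc d
    lemma = begin
      t                                              ≤⟨ t≤ ⟩
      u + (3 + n * 15 + 15)                          ≤⟨ +-monoˡ-≤ _ u≤ ⟩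
      n * (coef S * n ^ d) + (3 + n * 15 + 15)       ≡⟨ solve 3 (λ n c p → n :* (c :* p) :+ (con 3 :+ n :* con 15 :+ con 15) := c :* (n :* p) :+ (con 15 :* n :+ con 18)) refl n (coef S) (n ^ d) ⟩
      coef S * n ^ suc d + (15 * n + 18)             ≤⟨ +-monoʳ-≤ (coef S * n ^ suc d) (+-mono-≤ (*-monoʳ-≤ 15 (subst (_≤ n ^ suc d) (*-identityʳ n) (*-monoʳ-≤ n (1≤^ d)))) (const-≤ 18 (suc d))) ⟩
      coef S * n ^ suc d + (15 * n ^ suc d + 18 * n ^ suc d) ≡⟨ solve 2 (λ c p → c :* p :+ (con 15 :* p :+ con 18 :* p) := (c :+ con 33) :* p) refl (coef S) (n ^ suc d) ⟩
      (coef S + 33) * n ^ suc d                      ∎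
      where open +-*-Solver
  halts-poly nop wf w κ eq = κ , 1 , run-skip , ≤-refl
  halts-poly (out e) wf w (s ∥ q) eq = _ , _ , run-emit , const-≤ _ 0
  halts-poly (query a) wf w (s ∥ q) eq = _ , _ , run-ask , const-≤ _ 0

abstract
  -- Abstract because unfolding the product with the numeral coef S is infeasible.
  cost : Stmt → ℕ → ℕ
  cost S n = coef S * n ^ deg S

  cost-polynomial : ∀ S → ∃₂ λ C d → ∀ n → cost S n ≤ C * n ^ d
  cost-polynomial S = coef S , deg S , λ n → ≤-refl

  halts : ∀ {O n} → 1 ≤ n → ∀ S → wellFormed S ≡ true → writes ⌜ S ⌝ 0 ≡ false → ∀ κ → store κ 0 0 0 ≡ n →
          ∃₂ λ κ′ t → Run O ⌜ S ⌝ κ κ′ t × t ≤ cost S n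
  halts 1≤n S = halts-poly 1≤n S

  cost-≤ˡ : ∀ {n} → 1 ≤ n → ∀ S S′ → cost S n ≤ cost (S ⨟ S′) n
  cost-≤ˡ {n} 1≤n S S′ = *-mono-≤ (m≤m+n (coef S) (coef S′)) (^-monoʳ-≤ n {{>-nonZero 1≤n}} (m≤m⊔n (deg S) (deg S′)))

  cost-≤ʳ : ∀ {n} → 1 ≤ n → ∀ S S′ → cost S′ n ≤ cost (S ⨟ S′) n
  cost-≤ʳ {n} 1≤n S S′ = *-mono-≤ (m≤n+m (coef S′) (coef S)) (^-monoʳ-≤ n {{>-nonZero 1≤n}} (m≤n⊔m (deg S) (deg S′)))

each-rule : ∀ {O c S κ κ′ t n} → writes ⌜ S ⌝ c ≡ false → store κ 0 0 0 ≡ n →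
  (I : ℕ → Config → Set) →
  I 0 (startLoop c n κ) →
  (∀ {κ₁ κ₂ u} (i : Fin n) → store κ₁ c 0 0 ≡ toℕ i → Frame ⌜ each c S ⌝ κ κ₁ →
     Run O ⌜ S ⌝ κ₁ κ₂ u → I (toℕ i) κ₁ → I (suc (toℕ i)) (setCounter c (suc (toℕ i)) κ₂)) →
  Run O ⌜ each c S ⌝ κ κ′ t → I n κ′
each-rule {O} {c} {S} {κ} w refl I base step = loop-rule w κ I base
  λ {j} {κ₁} {κ₂} j<n ct f r i →
    subst (λ j → I (suc j) (setCounter c (suc j) κ₂)) (toℕ-fromℕ< j<n)
      (step (fromℕ< j<n) (trans ct (sym (toℕ-fromℕ< j<n))) f r
        (subst (λ j → I j κ₁) (sym (toℕ-fromℕ< j<n)) i))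

-- Finite sets and Lagrange's theorem

-- Pigeonhole principle: the head of `xs` is cut out of `ys`, and by uniqueness the tail still
-- embeds into what is left.
length-≤ : ∀ {A : Set} {xs ys : List A} → Unique xs → (∀ {x} → x ∈ xs → x ∈ ys) → length xs ≤ length ys
length-≤ {xs = []} _ _ = z≤n
length-≤ {A} {xs = x ∷ xs} (x∉xs ∷ u) sub with ∈-∃++ (sub (here refl))
... | ys , zs , refl = begin
  suc (length xs)                   ≤⟨ s≤s (length-≤ u sub′) ⟩
  suc (length (ys ++ zs))           ≡⟨ cong suc (length-++ ys) ⟩
  suc (length ys + length zs)       ≡⟨ +-suc (length ys) (length zs) ⟨
  length ys + suc (length zs)       ≡⟨ length-++ ys ⟨
  length (ys ++ x ∷ zs)             ∎
  where
  open ≤-Reasoning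
  sub′ : ∀ {z} → z ∈ xs → z ∈ ys ++ zs
  sub′ z∈xs with ∈-++⁻ ys (sub (there z∈xs))
  ... | inj₁ z∈ys = ∈-++⁺ˡ z∈ys
  ... | inj₂ (here z≡x) = contradiction (sym z≡x) (All.lookup x∉xs z∈xs)
  ... | inj₂ (there z∈zs) = ∈-++⁺ʳ ys z∈zs

map-unique : ∀ {A B : Set} (f : A → B) {xs} → (∀ {x y} → x ∈ xs → y ∈ xs → f x ≡ f y → x ≡ y) →
             Unique xs → Unique (map f xs)
map-unique f inj [] = []
map-unique f inj (x∉xs ∷ u) =
  AllP.map⁺ (All.tabulate λ y∈xs fx≡fy → All.lookup x∉xs y∈xs (inj (here refl) (there y∈xs) fx≡fy)) ∷
  map-unique f (λ x∈ y∈ → inj (there x∈) (there y∈)) u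

length-cartesianProduct : ∀ {A B : Set} (xs : List A) (ys : List B) →
  length (cartesianProduct xs ys) ≡ length xs * length ys
length-cartesianProduct []       ys = refl
length-cartesianProduct (x ∷ xs) ys = trans (length-++ (map (x ,_) ys))
  (cong₂ _+_ (length-map (x ,_) ys) (length-cartesianProduct xs ys))

least : ∀ {n} {P : Fin n → Set} → Decidable P → ∃ P → ∃ λ i → P i × (∀ j → P j → toℕ i ≤ toℕ j)
least {suc n} P? (x , px) with P? fzero
... | yes p₀ = fzero , p₀ , λ _ _ → z≤n
least P? (fzero , px) | no ¬p₀ = contradiction px ¬p₀
least {suc n} {P} P? (fsuc x , px) | no ¬p₀ with least {n} {P ∘ fsuc} (P? ∘ fsuc) (x , px)
... | i , pi , min = fsuc i , pi , min′
  where
  min′ : ∀ j → P j → suc (toℕ i) ≤ toℕ j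
  min′ fzero    pj = contradiction pj ¬p₀
  min′ (fsuc j) pj = s≤s (min j pj)

-- Sets of group elements are given by ℕ-valued characteristic functions,
-- which is how they appear in the arrays of the machine.
FSet : ℕ → Set
FSet n = Fin n → ℕ

module _ {n : ℕ} where

  infix 4 _∋_ _⊑_ _≐_

  _∋_ : FSet n → Fin n → Set
  c ∋ x = c x ≢ 0

  _∋?_ : ∀ c x → Dec (c ∋ x)
  c ∋? x = ¬? (c x ≟ 0)

  _⊑_ : FSet n → FSet n → Set
  c ⊑ d = ∀ {x} → c ∋ x → d ∋ x

  _≐_ : FSet n → FSet n → Set
  c ≐ d = (c ⊑ d) × (d ⊑ c)

  ≐-sym : ∀ {c d} → c ≐ d → d ≐ c
  ≐-sym (p , q) = q , p

  ≗⇒≐ : ∀ {c d : FSet n} → c ≗ d → c ≐ d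
  ≗⇒≐ eq = (λ {x} m e → m (trans (eq x) e)) , (λ {x} m e → m (trans (sym (eq x)) e))

  elements : FSet n → List (Fin n)
  elements c = filter (c ∋?_) (allFin n)

  card : FSet n → ℕ
  card c = length (elements c)

  ∈-elements⁺ : ∀ {c x} → c ∋ x → x ∈ elements c
  ∈-elements⁺ {c} {x} = ∈-filter⁺ (c ∋?_) (∈-allFin x)

  ∈-elements⁻ : ∀ {c x} → x ∈ elements c → c ∋ x
  ∈-elements⁻ {c} = proj₂ ∘ ∈-filter⁻ (c ∋?_) {xs = allFin n}

  elements-unique : ∀ c → Unique (elements c)
  elements-unique c = UniqueP.filter⁺ (c ∋?_) (UniqueP.allFin⁺ n)

  unique-≤ : ∀ {xs : List (Fin n)} → Unique xs → length xs ≤ n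
  unique-≤ u = ≤-trans (length-≤ u (λ _ → ∈-allFin _)) (≤-reflexive (length-tabulate {n = n} id))

  card≤n : ∀ c → card c ≤ n
  card≤n c = unique-≤ (elements-unique c)

  card-mono : ∀ {c d} → c ⊑ d → card c ≤ card d
  card-mono {c} {d} c⊑d = length-≤ (elements-unique c) (∈-elements⁺ {d} ∘ c⊑d ∘ ∈-elements⁻)

  card-strict : ∀ {c d x} → c ⊑ d → d ∋ x → ¬ c ∋ x → card c < card d
  card-strict {c} {d} {x} c⊑d d∋x c∌x = length-≤ {xs = x ∷ elements c}
    (All.tabulate (λ y∈ x≡y → c∌x (subst (c ∋_) (sym x≡y) (∈-elements⁻ y∈))) ∷ elements-unique c)
    λ { (here refl) → ∈-elements⁺ {d} d∋x ; (there y∈) → ∈-elements⁺ {d} (c⊑d (∈-elements⁻ y∈)) }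

  card-full : ∀ {c} → (∀ x → c ∋ x) → card c ≡ n
  card-full {c} full = ≤-antisym (card≤n c)
    (subst (_≤ card c) (length-tabulate {n = n} id) (length-≤ (UniqueP.allFin⁺ n) (λ {x} _ → ∈-elements⁺ {c} (full x))))

  ⊑⊎new : ∀ c d → (c ⊑ d) ⊎ ∃ λ x → c ∋ x × ¬ d ∋ x
  ⊑⊎new c d with any? (λ x → (c ∋? x) ×-dec ¬? (d ∋? x))
  ... | yes p = inj₂ p
  ... | no ¬p = inj₁ λ {x} c∋x → decidable-stable (d ∋? x) λ d∌x → ¬p (x , c∋x , d∌x)

prime-divisor : ∀ r → 1 < r → ∃ λ q → Prime q × q ∣ r
prime-divisor (suc r) 1<r with factorise (suc r)
... | record { factors = [] ; isFactorisation = eq } = contradiction (sym eq) (<⇒≢ 1<r)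
... | record { factors = q ∷ qs ; isFactorisation = eq ; factorsPrime = pq ∷ _ } =
  q , pq , divides (product qs) (trans eq (*-comm q (product qs)))

module _ {n : ℕ} (G : FinGroup n) where
  open FinGroup G
  open Group group using (assoc; identityʳ; inverseˡ)
  open GroupProperties group using (quasigroup; //-rightDividesʳ)
  open QuasigroupProperties quasigroup using (cancelˡ)

  -- Quotients a b⁻¹ are expressed by the equation `mul z b ≡ a`, and conjugates below by z a = a b,
  -- because the machine holds a multiplication table but no table of inverses.
  record Subgroup (k : FSet n) : Set where
    field
      unit∈ : k ∋ unit
      quot∈ : ∀ {a b z} → k ∋ a → k ∋ b → mul z b ≡ a → k ∋ z

    inv∈ : ∀ {b} → k ∋ b → k ∋ inv b
    inv∈ {b} b∈ = quot∈ unit∈ b∈ (inverseˡ b)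

    mul∈ : ∀ {a b} → k ∋ a → k ∋ b → k ∋ mul a b
    mul∈ {a} {b} a∈ b∈ = quot∈ a∈ (inv∈ b∈) (//-rightDividesʳ b a)

  open Subgroup

  CosetLeast : FSet n → Fin n → Set
  CosetLeast k x = ∀ y → k ∋ y → toℕ x ≤ toℕ (mul x y)

  cosetLeast? : ∀ k → Decidable (CosetLeast k)
  cosetLeast? k x = all? λ y → (k ∋? y) →-dec (toℕ x ≤? toℕ (mul x y))

  module _ {k : FSet n} (sk : Subgroup k) where

    private
      shift : ∀ {r r′ y y′} → mul r y ≡ mul r′ y′ → mul r (mul y (inv y′)) ≡ r′
      shift {r} {r′} {y} {y′} eq =
        trans (sym (assoc r y (inv y′))) (trans (cong (λ z → mul z (inv y′)) eq) (//-rightDividesʳ y′ r′))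

    cosetLeast-≤ : ∀ {r r′ y y′} → CosetLeast k r → k ∋ y → k ∋ y′ →
      mul r y ≡ mul r′ y′ → toℕ r ≤ toℕ r′
    cosetLeast-≤ {r} {r′} {y} {y′} lr y∈ y′∈ eq =
      subst (λ z → toℕ r ≤ toℕ z) (shift eq) (lr _ (mul∈ sk y∈ (inv∈ sk y′∈)))

    -- A common product puts r and r′ into one left coset of k; both are least there, so they
    -- coincide, and y can be cancelled.
    cosetLeast-injective : ∀ {r r′ y y′} → CosetLeast k r → CosetLeast k r′ → k ∋ y → k ∋ y′ →
      mul r y ≡ mul r′ y′ → (r , y) ≡ (r′ , y′)
    cosetLeast-injective {r} lr lr′ y∈ y′∈ eq
      with toℕ-injective (≤-antisym (cosetLeast-≤ lr y∈ y′∈ eq) (cosetLeast-≤ lr′ y′∈ y∈ (sym eq)))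
    ... | refl = cong (r ,_) (cancelˡ r _ _ eq)

    products : List (Fin n) → List (Fin n)
    products rs = map (uncurry mul) (cartesianProduct rs (elements k))

    length-products : ∀ rs → length (products rs) ≡ length rs * card k
    length-products rs = trans (length-map (uncurry mul) (cartesianProduct rs (elements k)))
      (length-cartesianProduct rs (elements k))

    products-unique : ∀ {rs} → Unique rs → All (CosetLeast k) rs → Unique (products rs)
    products-unique {rs} u least = map-unique (uncurry mul) inj (UniqueP.cartesianProduct⁺ u (elements-unique k))
      where
      inj : ∀ {p q} → p ∈ cartesianProduct rs (elements k) → q ∈ cartesianProduct rs (elements k) →
            uncurry mul p ≡ uncurry mul q → p ≡ q
      inj p∈ q∈ eq with ∈-cartesianProduct⁻ rs (elements k) p∈ | ∈-cartesianProduct⁻ rs (elements k) q∈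
      ... | r∈ , y∈ | r′∈ , y′∈ =
        cosetLeast-injective (All.lookup least r∈) (All.lookup least r′∈) (∈-elements⁻ y∈) (∈-elements⁻ y′∈) eq

    -- The products r y are pairwise distinct elements of the group. Applied to the generators tried
    -- on top of a term k, this is the bound n / |k| on the branching of the search.
    cosetLeast-count : ∀ {rs} → Unique rs → All (CosetLeast k) rs → length rs * card k ≤ n
    cosetLeast-count {rs} u least = subst (_≤ n) (length-products rs) (unique-≤ (products-unique u least))

    cosetLeast-exists : ∀ x → ∃₂ λ r y → CosetLeast k r × k ∋ y × x ≡ mul r y
    cosetLeast-exists x with least (λ z → any? λ y → (k ∋? y) ×-dec (z ≟ᶠ mul x y)) (x , unit , unit∈ sk , sym (identityʳ x))
    ... | _ , (y , y∈ , refl) , min = mul x y , inv y ,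
      (λ y′ y′∈ → min _ (mul y y′ , mul∈ sk y∈ y′∈ , assoc x y y′)) ,
      inv∈ sk y∈ , sym (//-rightDividesʳ y x)

    -- The least coset representatives that lie in l, multiplied by the elements of k, list l
    -- without repetition.
    lagrange : ∀ {l} → Subgroup l → k ⊑ l → ∃ λ r → card l ≡ r * card k
    lagrange {l} sl k⊑l = length rs , trans (≤-antisym ≤₁ ≤₂) (length-products rs)
      where
      rep? : Decidable (λ x → l ∋ x × CosetLeast k x)
      rep? x = (l ∋? x) ×-dec cosetLeast? k x
      rs = filter rep? (allFin n)
      ≤₁ : card l ≤ length (products rs)
      ≤₁ = length-≤ (elements-unique l) λ {x} x∈ → case cosetLeast-exists x of λ where
        (r , y , least , y∈ , refl) → ∈-map⁺ (uncurry mul) (∈-cartesianProduct⁺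
          (∈-filter⁺ rep? (∈-allFin r) (quot∈ sl (∈-elements⁻ x∈) (k⊑l y∈) refl , least))
          (∈-elements⁺ {c = k} y∈))
      ≤₂ : length (products rs) ≤ card l
      ≤₂ = length-≤ (products-unique (UniqueP.filter⁺ rep? (UniqueP.allFin⁺ n)) (All.tabulate (proj₂ ∘ proj₂ ∘ ∈-filter⁻ rep? {xs = allFin n})))
        λ z∈ → case ∈-map⁻ (uncurry mul) z∈ of λ where
          ((r , y) , p∈ , refl) → case ∈-cartesianProduct⁻ rs (elements k) p∈ of λ where
            (r∈ , y∈) → ∈-elements⁺ {c = l} (mul∈ sl (proj₁ (proj₂ (∈-filter⁻ rep? {xs = allFin n} r∈))) (k⊑l (∈-elements⁻ y∈)))

  all : FSet n
  all _ = 1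

  all-subgroup : Subgroup all
  all-subgroup = record { unit∈ = λ () ; quot∈ = λ _ _ _ () }

  -- The index of k in l divides n and exceeds 1, so it has a prime divisor, and that prime is at
  -- least p.
  card-≥ : ∀ {p k l x} → IsSmallestPrimeDivisor p n → Subgroup k → Subgroup l → k ⊑ l → l ∋ x → ¬ k ∋ x →
           p * card k ≤ card l
  card-≥ {p} {k} {l} (_ , _ , smallest) sk sl k⊑l l∋x k∌x
    with lagrange sk sl k⊑l | lagrange sl all-subgroup (λ _ ())
  ... | r , eq | r′ , eq′ = subst (p * card k ≤_) (sym eq) (*-monoˡ-≤ (card k) p≤r)
    where
    1<r : 1 < r
    1<r = ≰⇒> λ r≤1 → <⇒≱ (card-strict {d = l} k⊑l l∋x k∌x)
            (subst₂ _≤_ (sym eq) (*-identityˡ (card k)) (*-monoˡ-≤ (card k) r≤1))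
    r∣n : r ∣ n
    r∣n = divides (r′ * card k) (trans (sym (card-full {c = all} λ _ ()))
            (trans eq′ (trans (cong (r′ *_) eq) (solve 3 (λ a b c → a :* (b :* c) := a :* c :* b) refl r′ r (card k)))))
      where open +-*-Solver
    p≤r : p ≤ r
    p≤r with prime-divisor r 1<r
    ... | q , pq , q∣r = ≤-trans (smallest q pq (∣-trans q∣r r∣n)) (∣⇒≤ {{>-nonZero (<-trans z<s 1<r)}} q∣r)

-- Chains with simple factors

adjoin : ∀ {n} → FSet n → Fin n → FSet n
adjoin k x z with z ≟ᶠ x
... | yes _ = 1
... | no  _ = k z

module _ {n : ℕ} where

  adjoin-new : ∀ (k : FSet n) x → adjoin k x ∋ x
  adjoin-new k x with x ≟ᶠ x
  ... | yes _   = λ ()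
  ... | no  x≢x = contradiction refl x≢x

  adjoin-old : ∀ (k : FSet n) x → k ⊑ adjoin k x
  adjoin-old k x {z} k∋z with z ≟ᶠ x
  ... | yes _ = λ ()
  ... | no  _ = k∋z

  adjoin-⊑ : ∀ (k d : FSet n) x → k ⊑ d → d ∋ x → adjoin k x ⊑ d
  adjoin-⊑ k d x k⊑d d∋x {z} m with z ≟ᶠ x
  ... | yes refl = d∋x
  ... | no  _    = k⊑d m

  -- An ascending chain of sets is coded by one function v: v x = i + 1 if x first
  -- appears in the i-th set, and v x = 0 if x appears in none of them.
  trunc : FSet n → ℕ → FSet n
  trunc v i z = if v z ≤ᵇ suc i then v z else 0

  trunc-≤ : ∀ v i {z} → v z ≤ suc i → trunc v i z ≡ v z
  trunc-≤ v i {z} le with v z ≤ᵇ suc i in eq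
  ... | true  = refl
  ... | false = ⊥-elim (subst T eq (≤⇒≤ᵇ le))

  trunc-> : ∀ v i {z} → suc i < v z → trunc v i z ≡ 0
  trunc-> v i {z} gt with v z ≤ᵇ suc i in eq
  ... | false = refl
  ... | true  = contradiction (≤ᵇ⇒≤ (v z) (suc i) (subst T (sym eq) _)) (<⇒≱ gt)

  trunc⁺ : ∀ v i {z} → v ∋ z → v z ≤ suc i → trunc v i ∋ z
  trunc⁺ v i v∋z le = v∋z ∘ trans (sym (trunc-≤ v i le))

  trunc⁻ : ∀ v i {z} → trunc v i ∋ z → v ∋ z × v z ≤ suc i
  trunc⁻ v i {z} m with v z ≤? suc i
  ... | yes le = m ∘ trans (trunc-≤ v i le) , le
  ... | no  ≰  = contradiction (trunc-> v i (≰⇒> ≰)) m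

  trunc-mono : ∀ v {i j} → i ≤ j → trunc v i ⊑ trunc v j
  trunc-mono v {i} {j} i≤j m with trunc⁻ v i m
  ... | v∋z , le = trunc⁺ v j v∋z (≤-trans le (s≤s i≤j))

  -- New elements get m + 2: the added set has index m + 1, and values exceed indices by one so that
  -- 0 can stand for absence.
  extendValue : ℕ → ℕ → ℕ → ℕ
  extendValue (suc a) _       m = suc a
  extendValue zero    (suc _) m = suc (suc m)
  extendValue zero    zero    m = 0

  extend : FSet n → FSet n → ℕ → FSet n
  extend v l m z = extendValue (v z) (l z) m

  extend-old : ∀ v l m {z} → v ∋ z → extend v l m z ≡ v z
  extend-old v l m {z} m∈ with v z
  ... | zero  = contradiction refl m∈
  ... | suc _ = refl

  extend-new : ∀ v l m {z} → ¬ v ∋ z → l ∋ z → extend v l m z ≡ suc (suc m)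
  extend-new v l m {z} v∌z l∋z with v z | l z
  ... | suc _ | _     = contradiction (λ ()) v∌z
  ... | zero  | zero  = contradiction refl l∋z
  ... | zero  | suc _ = refl

  extend-none : ∀ v l m {z} → ¬ v ∋ z → ¬ l ∋ z → extend v l m z ≡ 0
  extend-none v l m {z} v∌z l∌z with v z | l z
  ... | suc _ | _     = contradiction (λ ()) v∌z
  ... | zero  | zero  = refl
  ... | zero  | suc _ = contradiction (λ ()) l∌z

  extend-≐ : ∀ {v l} m → v ⊑ l → extend v l m ≐ l
  extend-≐ {v = v} {l = l} m v⊑l = (λ {z} → to z) , (λ {z} → from z)
    where
    to : ∀ z → extend v l m ∋ z → l ∋ z
    to z e with v ∋? z | l ∋? z
    ... | yes v∋z | _       = v⊑l v∋z
    ... | no  _   | yes l∋z = l∋z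
    ... | no  v∌z | no  l∌z = contradiction (extend-none v l m v∌z l∌z) e
    from : ∀ z → l ∋ z → extend v l m ∋ z
    from z l∋z e with v ∋? z
    ... | yes v∋z = v∋z (trans (sym (extend-old v l m v∋z)) e)
    ... | no  v∌z = contradiction (trans (sym (extend-new v l m v∌z l∋z)) e) λ ()

module _ {n : ℕ} (G : FinGroup n) where
  open FinGroup G
  open Group group using (identityˡ; identityʳ)
  open Subgroup

  -- For c = adjoin k x this is the normal closure in l of the set k ∪ {x}.
  data NormalClosure (l c : FSet n) : Fin n → Set where
    base : ∀ {z} → c ∋ z → NormalClosure l c z
    quot : ∀ {z a b} → NormalClosure l c a → NormalClosure l c b → mul z b ≡ a → NormalClosure l c z
    conj : ∀ {z a b} → l ∋ a → NormalClosure l c b → mul z a ≡ mul a b → NormalClosure l c z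

  -- One application of `quot` or `conj` to premises already present. Both rules are indexed by the
  -- same triple, so that a single triple loop of the machine can test both.
  Derives : FSet n → FSet n → Fin n → Fin n → Fin n → Set
  Derives l c z a b = (mul z b ≡ a × c ∋ a × c ∋ b) ⊎ (mul z a ≡ mul a b × l ∋ a × c ∋ b)

  derives? : ∀ l c z a b → Dec (Derives l c z a b)
  derives? l c z a b = ((mul z b ≟ᶠ a) ×-dec (c ∋? a) ×-dec (c ∋? b)) ⊎-dec ((mul z a ≟ᶠ mul a b) ×-dec (l ∋? a) ×-dec (c ∋? b))

  derives-mono : ∀ {l c c′ z a b} → c ⊑ c′ → Derives l c z a b → Derives l c′ z a b
  derives-mono c⊑c′ (inj₁ (eq , a∈ , b∈)) = inj₁ (eq , c⊑c′ a∈ , c⊑c′ b∈)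
  derives-mono c⊑c′ (inj₂ (eq , a∈ , b∈)) = inj₂ (eq , a∈ , c⊑c′ b∈)

  Closed : FSet n → FSet n → Set
  Closed l c = ∀ {z a b} → Derives l c z a b → c ∋ z

  closure-least : ∀ {l c d z} → Closed l d → c ⊑ d → NormalClosure l c z → d ∋ z
  closure-least cl c⊑d (base m)       = c⊑d m
  closure-least cl c⊑d (quot p q eq)  = cl (inj₁ (eq , closure-least cl c⊑d p , closure-least cl c⊑d q))
  closure-least cl c⊑d (conj a∈ q eq) = cl (inj₂ (eq , a∈ , closure-least cl c⊑d q))

  closure-mono : ∀ {l l′ c c′ z} → l ⊑ l′ → c ⊑ c′ → NormalClosure l c z → NormalClosure l′ c′ z
  closure-mono l⊑ c⊑ (base m)       = base (c⊑ m)
  closure-mono l⊑ c⊑ (quot p q eq)  = quot (closure-mono l⊑ c⊑ p) (closure-mono l⊑ c⊑ q) eq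
  closure-mono l⊑ c⊑ (conj a∈ q eq) = conj (l⊑ a∈) (closure-mono l⊑ c⊑ q) eq

  Reaches : FSet n → FSet n → FSet n → Set
  Reaches l c c′ = c ⊑ c′ × (∀ {z} → c′ ∋ z → NormalClosure l c z)

  reaches-refl : ∀ {l c} → Reaches l c c
  reaches-refl = id , base

  reaches-trans : ∀ {l c c′ c″} → Reaches l c c′ → Reaches l c′ c″ → Reaches l c c″
  reaches-trans {l} {c} {c′} (m , s) (m′ , s′) = m′ ∘ m , bind ∘ s′
    where
    bind : ∀ {z} → NormalClosure l c′ z → NormalClosure l c z
    bind (base m)       = s m
    bind (quot p q eq)  = quot (bind p) (bind q) eq
    bind (conj a∈ q eq) = conj a∈ (bind q) eq

  -- J selects the triples already visited, which makes it possible to follow the progress in the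
  -- middle of the triple loop.
  Hits : (Fin n → Fin n → Fin n → Set) → FSet n → FSet n → FSet n → Set
  Hits J l c c′ = ∀ {z a b} → J z a b → Derives l c z a b → c′ ∋ z

  -- A pass of the closure loop that does not reach a closed set adds an element.
  closed-or-grows : ∀ {l c c′ r J} → Reaches l c c′ → Hits J l c c′ → (∀ z a b → J z a b) →
    Closed l c ⊎ r ≤ card c → Closed l c′ ⊎ suc r ≤ card c′
  closed-or-grows {l} {c} {c′} (mono , sound) hits j (inj₁ cl) =
    inj₁ (mono ∘ cl ∘ derives-mono {l} {c′} {c} (closure-least cl id ∘ sound))
  closed-or-grows {l} {c} {c′} (mono , sound) hits j (inj₂ r≤) with ⊑⊎new c′ c
  ... | inj₁ c′⊑c = inj₁ (hits (j _ _ _) ∘ derives-mono {l} {c′} {c} c′⊑c)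
  ... | inj₂ (x , c′∋x , c∌x) = inj₂ (≤-trans (s≤s r≤) (card-strict {d = c′} mono c′∋x c∌x))

  IsClosure : FSet n → FSet n → FSet n → Set
  IsClosure l c d = ∀ {z} → (d ∋ z → NormalClosure l c z) × (NormalClosure l c z → d ∋ z)

  reaches-closed : ∀ {l c c′} → Reaches l c c′ → Closed l c′ → IsClosure l c c′
  reaches-closed (mono , sound) cl = sound , closure-least cl mono

  -- After n + 1 rounds the set is closed or has n + 1 elements, and the latter is impossible. The
  -- resulting characteristic function makes membership in a closure decidable, as the search for a
  -- maximal normal subgroup requires.
  closure-set : ∀ l c → ∃ λ d → IsClosure l c d
  closure-set l c with iterate (suc n)
    where
    step : FSet n → FSet n
    step c z with (c ∋? z) ⊎-dec any? (λ a → any? (λ b → derives? l c z a b))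
    ... | yes _ = 1
    ... | no  _ = 0
    step⁺ : ∀ c {z} → c ∋ z ⊎ ∃₂ (Derives l c z) → step c ∋ z
    step⁺ c {z} m with (c ∋? z) ⊎-dec any? (λ a → any? (λ b → derives? l c z a b))
    ... | yes _ = λ ()
    ... | no ¬m = contradiction m ¬m
    step⁻ : ∀ c {z} → step c ∋ z → NormalClosure l c z
    step⁻ c {z} m with (c ∋? z) ⊎-dec any? (λ a → any? (λ b → derives? l c z a b))
    ... | no _ = contradiction refl m
    ... | yes (inj₁ c∋z) = base c∋z
    ... | yes (inj₂ (_ , _ , inj₁ (eq , a∈ , b∈))) = quot (base a∈) (base b∈) eq
    ... | yes (inj₂ (_ , _ , inj₂ (eq , a∈ , b∈))) = conj a∈ (base b∈) eq
    iterate : ∀ r → ∃ λ d → Reaches l c d × (Closed l d ⊎ r ≤ card d)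
    iterate zero    = c , reaches-refl , inj₂ z≤n
    iterate (suc r) with iterate r
    ... | d , rd , cd = step d , reaches-trans rd rs ,
      closed-or-grows {J = λ _ _ _ → d ≡ d} rs (λ _ dv → step⁺ d (inj₂ (_ , _ , dv))) (λ _ _ _ → refl) cd
      where
      rs : Reaches l d (step d)
      rs = step⁺ d ∘ inj₁ , step⁻ d
  ... | d , rd , inj₁ cl = d , reaches-closed rd cl
  ... | d , rd , inj₂ le = contradiction (card≤n d) (<⇒≱ le)

  Normal : FSet n → FSet n → Set
  Normal k l = ∀ {a b z} → l ∋ a → k ∋ b → mul z a ≡ mul a b → k ∋ z

  -- l / k is a simple group.
  record SimpleStep (k l : FSet n) : Set where
    field
      sub      : k ⊑ l
      new      : ∃ λ x → l ∋ x × ¬ k ∋ x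
      subgroup : Subgroup G l
      normal   : Normal k l
      simple   : ∀ {y} → l ∋ y → ¬ k ∋ y → ∀ {z} → l ∋ z → NormalClosure l (adjoin k y) z

  subgroup-cong : ∀ {k k′} → k ≐ k′ → Subgroup G k → Subgroup G k′
  subgroup-cong (k⊑ , ⊒k) sk = record
    { unit∈ = k⊑ (unit∈ sk) ; quot∈ = λ a∈ b∈ eq → k⊑ (quot∈ sk (⊒k a∈) (⊒k b∈) eq) }

  simpleStep-cong : ∀ {k k′ l l′} → k ≐ k′ → l ≐ l′ → SimpleStep k l → SimpleStep k′ l′
  simpleStep-cong {k} {k′} (k⊑ , ⊒k) (l⊑ , ⊒l) st = record
    { sub      = l⊑ ∘ sub ∘ ⊒k
    ; new      = let x , x∈ , x∉ = new in x , l⊑ x∈ , x∉ ∘ ⊒k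
    ; subgroup = subgroup-cong (l⊑ , ⊒l) subgroup
    ; normal   = λ a∈ b∈ eq → k⊑ (normal (⊒l a∈) (⊒k b∈) eq)
    ; simple   = λ {y} y∈ y∉ z∈ → closure-mono l⊑ (λ {u} → adjoin-⊑ k (adjoin k′ y) y (adjoin-old k′ y ∘ k⊑) (adjoin-new k′ y) {u}) (simple (⊒l y∈) (y∉ ∘ k⊑) (⊒l z∈))
    } where open SimpleStep st

  closed-subgroup : ∀ {l} → Subgroup G l → Closed l l
  closed-subgroup sl (inj₁ (eq , a∈ , b∈)) = quot∈ sl a∈ b∈ eq
  closed-subgroup sl (inj₂ (eq , a∈ , b∈)) = quot∈ sl (mul∈ sl a∈ b∈) a∈ eq

  closure-subgroup : ∀ {l c d} → c ∋ unit →
    IsClosure l c d → Subgroup G d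
  closure-subgroup c∋1 eqv = record
    { unit∈ = proj₂ eqv (base c∋1)
    ; quot∈ = λ a∈ b∈ eq → proj₂ eqv (quot (proj₁ eqv a∈) (proj₁ eqv b∈) eq) }

  -- A composition series of its last term, which may be smaller than the whole group; together with
  -- `Full` it becomes one of G.
  record Chain (v : FSet n) (m : ℕ) : Set where
    field
      bound : ∀ x → v x ≤ suc m
      unit₁ : v unit ≡ 1
      only₁ : ∀ {x} → v x ≡ 1 → x ≡ unit
      step  : ∀ {i} → i < m → SimpleStep (trunc v i) (trunc v (suc i))

    only-unit : ∀ {x} → trunc v 0 ∋ x → x ≡ unit
    only-unit m∈ with trunc⁻ v 0 m∈
    ... | v∋x , le = only₁ (≤-antisym le (n≢0⇒n>0 v∋x))

    unit∈trunc : ∀ i → trunc v i ∋ unit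
    unit∈trunc i = trunc⁺ v i (λ eq → contradiction (trans (sym unit₁) eq) λ ()) (subst (_≤ suc i) (sym unit₁) (s≤s z≤n))

    trunc-top : ∀ {i} → m ≤ i → v ≐ trunc v i
    trunc-top {i} m≤i = (λ {z} v∋z → trunc⁺ v i v∋z (≤-trans (bound z) (s≤s m≤i))) , proj₁ ∘ trunc⁻ v i

    trunc-subgroup : ∀ {i} → i ≤ m → Subgroup G (trunc v i)
    trunc-subgroup {suc i} i<m = SimpleStep.subgroup (step i<m)
    trunc-subgroup {zero}  _   = record
      { unit∈ = unit∈trunc 0
      ; quot∈ = λ {a} {b} {z} a∈ b∈ eq → subst (trunc v 0 ∋_) (sym (lemma (only-unit a∈) (only-unit b∈) eq)) (unit∈trunc 0)
      }
      where
      lemma : ∀ {a b z} → a ≡ unit → b ≡ unit → mul z b ≡ a → z ≡ unit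
      lemma {z = z} refl refl eq = trans (sym (identityʳ z)) eq

    isSubgroup : Subgroup G v
    isSubgroup = subgroup-cong (≐-sym {c = v} {d = trunc v m} (trunc-top ≤-refl)) (trunc-subgroup ≤-refl)

    card-trunc : ∀ {i} → i ≤ m → suc i ≤ card (trunc v i)
    card-trunc {zero}  _ = length-≤ {xs = unit ∷ []} ([] ∷ []) λ { (here refl) → ∈-elements⁺ {c = trunc v 0} (unit∈trunc 0) }
    card-trunc {suc i} i<m = let x , x∈ , x∉ = SimpleStep.new (step i<m) in
      ≤-trans (s≤s (card-trunc (<⇒≤ i<m))) (card-strict {d = trunc v (suc i)} (SimpleStep.sub (step i<m)) x∈ x∉)

    -- Because of this, loops over 0, ..., n - 1 pass through all levels of the search and all m + 1
    -- rows of an emitted series.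
    length< : m < n
    length< = ≤-trans (card-trunc ≤-refl) (card≤n (trunc v m))

    card-power : ∀ {p i} → IsSmallestPrimeDivisor p n → i ≤ m → p ^ i ≤ card (trunc v i)
    card-power {p} {zero}  sp _ = card-trunc z≤n
    card-power {p} {suc i} sp i<m = let x , x∈ , x∉ = SimpleStep.new (step i<m) in
      ≤-trans (*-monoʳ-≤ p (card-power sp (<⇒≤ i<m)))
        (card-≥ G {l = trunc v (suc i)} sp (trunc-subgroup (<⇒≤ i<m)) (trunc-subgroup i<m) (SimpleStep.sub (step i<m)) x∈ x∉)

    card-power-top : ∀ {p} → IsSmallestPrimeDivisor p n → p ^ m ≤ card v
    card-power-top sp = ≤-trans (card-power sp ≤-refl) (card-mono {c = trunc v m} {d = v} (proj₂ (trunc-top ≤-refl)))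

  Full : FSet n → Set
  Full v = ∀ x → v ∋ x

  trunc-extend : ∀ {v l : FSet n} {m i} → (∀ x → v x ≤ suc m) → i ≤ m → trunc (extend v l m) i ≗ trunc v i
  trunc-extend {v} {l} {m} {i} bd i≤m z with v ∋? z
  ... | yes v∋z = cong (λ a → if a ≤ᵇ suc i then a else 0) (extend-old v l m v∋z)
  ... | no  v∌z with l ∋? z
  ... | yes l∋z = trans (trunc-> (extend v l m) i (subst (suc i <_) (sym (extend-new v l m v∌z l∋z)) (s≤s (s≤s i≤m))))
                        (sym (trans (trunc-≤ v i (subst (_≤ suc i) (sym v≡0) z≤n)) v≡0))
    where v≡0 = decidable-stable (v z ≟ 0) v∌z
  ... | no  l∌z = cong (λ a → if a ≤ᵇ suc i then a else 0) (trans (extend-none v l m v∌z l∌z) (sym (decidable-stable (v z ≟ 0) v∌z)))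

  chain-extend : ∀ {v l m} → Chain v m → SimpleStep v l → Chain (extend v l m) (suc m)
  chain-extend {v} {l} {m} ch st = record
    { bound = bound′
    ; unit₁ = trans (extend-old v l m (unit∈ isSubgroup)) unit₁
    ; only₁ = only₁′
    ; step  = step′
    }
    where
    open Chain ch
    v⊑l : v ⊑ l
    v⊑l = SimpleStep.sub st
    bound′ : ∀ x → extend v l m x ≤ suc (suc m)
    bound′ x with v ∋? x | l ∋? x
    ... | yes v∋x | _       = subst (_≤ suc (suc m)) (sym (extend-old v l m v∋x)) (m≤n⇒m≤1+n (bound x))
    ... | no  v∌x | yes l∋x = ≤-reflexive (extend-new v l m v∌x l∋x)
    ... | no  v∌x | no  l∌x = subst (_≤ suc (suc m)) (sym (extend-none v l m v∌x l∌x)) z≤n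
    only₁′ : ∀ {x} → extend v l m x ≡ 1 → x ≡ unit
    only₁′ {x} eq with v ∋? x | l ∋? x
    ... | yes v∋x | _       = only₁ (trans (sym (extend-old v l m v∋x)) eq)
    ... | no  v∌x | yes l∋x = contradiction (trans (sym eq) (extend-new v l m v∌x l∋x)) λ ()
    ... | no  v∌x | no  l∌x = contradiction (trans (sym eq) (extend-none v l m v∌x l∌x)) λ ()
    top : l ≐ trunc (extend v l m) (suc m)
    top = (λ {z} l∋z → trunc⁺ (extend v l m) (suc m) (proj₂ (extend-≐ {v = v} {l = l} m v⊑l) l∋z) (bound′ z)) ,
          proj₁ (extend-≐ {v = v} {l = l} m v⊑l) ∘ proj₁ ∘ trunc⁻ (extend v l m) (suc m)
    old : ∀ {i} → i ≤ m → trunc v i ≐ trunc (extend v l m) i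
    old {i} i≤m = ≗⇒≐ {c = trunc v i} (λ z → sym (trunc-extend {v} {l} {m} {i} bound i≤m z))
    step′ : ∀ {i} → i < suc m → SimpleStep (trunc (extend v l m) i) (trunc (extend v l m) (suc i))
    step′ {i} (s≤s i≤m) with m≤n⇒m<n∨m≡n i≤m
    ... | inj₁ i<m = simpleStep-cong (old i≤m) (old i<m) (step i<m)
    ... | inj₂ refl = simpleStep-cong (v⊑ , ⊒v) top st
      where
      v⊑ : v ⊑ trunc (extend v l m) i
      v⊑ = proj₁ (old i≤m) ∘ proj₁ (trunc-top ≤-refl)
      ⊒v : trunc (extend v l m) i ⊑ v
      ⊒v = proj₂ (trunc-top ≤-refl) ∘ proj₂ (old i≤m)

  -- The code records for each element when it first appears, so it is determined by the sets.
  -- Extending the code of an initial segment by the correct next set therefore reproduces the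
  -- longer code value by value, and the row of the queue can be recognised as a segment of w.
  extend-trunc : ∀ {v l w : FSet n} {j} → v ≗ trunc w j → l ≐ trunc w (suc j) → extend v l j ≗ trunc w (suc j)
  extend-trunc {v} {l} {w} {j} v≗ (l⊑ , ⊒l) z with w z ≤? suc j
  ... | yes le with w ∋? z
  ... | yes w∋z = trans (extend-old v l j (trunc⁺ w j w∋z le ∘ trans (sym (v≗ z))))
                    (trans (trans (v≗ z) (trunc-≤ w j le)) (sym (trunc-≤ w (suc j) (m≤n⇒m≤1+n le))))
  ... | no  w∌z = trans (extend-none v l j (λ v∋z → w∌z (proj₁ (trunc⁻ w j (v∋z ∘ trans (v≗ z))))) (w∌z ∘ proj₁ ∘ trunc⁻ w (suc j) ∘ l⊑))
                    (sym (trans (trunc-≤ w (suc j) (m≤n⇒m≤1+n le)) (decidable-stable (w z ≟ 0) w∌z)))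
  extend-trunc {v} {l} {w} {j} v≗ (l⊑ , ⊒l) z | no ≰ with w z ≤? suc (suc j)
  ... | yes le = trans (extend-new v l j v∌z (⊒l (trunc⁺ w (suc j) w∋z le)))
                   (trans (sym (≤-antisym le (≰⇒> ≰))) (sym (trunc-≤ w (suc j) le)))
    where
    w∋z : w ∋ z
    w∋z eq = ≰ (subst (_≤ suc j) (sym eq) z≤n)
    v∌z : ¬ v ∋ z
    v∌z v∋z = v∋z (trans (v≗ z) (trunc-> w j (≰⇒> ≰)))
  ... | no ≰′ = trans (extend-none v l j v∌z (≰′ ∘ proj₂ ∘ trunc⁻ w (suc j) ∘ l⊑)) (sym (trunc-> w (suc j) (≰⇒> ≰′)))
    where
    v∌z : ¬ v ∋ z
    v∌z v∋z = v∋z (trans (v≗ z) (trunc-> w j (≰⇒> ≰)))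

  -- The sets A₀ = G, Aᵢ₊₁ = normal closure of k ∪ {x} in Aᵢ descend to the
  -- smallest subnormal subgroup containing k and x.
  Squeezed : FSet n → ℕ → ℕ → ℕ → FSet n → Set
  Squeezed w m j i A =
    (∀ e → suc j ≤ e → m ≤ e + i → A ⊑ trunc w e) × trunc w (suc j) ⊑ A

  squeeze-start : ∀ {w m j A} → Chain w m → Full w → Full A → Squeezed w m j 0 A
  squeeze-start ch fw fA =
    (λ e _ m≤e {z} _ → proj₁ (Chain.trunc-top ch (subst (_ ≤_) (+-identityʳ e) m≤e)) (fw z)) , λ {z} _ → fA z

  -- Upper bound: by the bound for i, A lies in the (e + 1)-st term, where the e-th term is normal,
  -- so closing inside A does not leave the e-th term. Lower bound: A contains the (j + 1)-st term,
  -- in which the closure of k and x is everything because the factor is simple.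
  squeeze-step : ∀ {w m j i A A′ k x} → Chain w m → Full w → j < m → k ≐ trunc w j → trunc w (suc j) ∋ x → ¬ trunc w j ∋ x →
    IsClosure A (adjoin k x) A′ →
    Squeezed w m j i A → Squeezed w m j (suc i) A′
  squeeze-step {w} {m} {j} {i} {A} {A′} {k} {x} ch fw j<m (k⊑ , ⊒k) x∈ x∉ eqv (up , low) = up′ , low′
    where
    open Chain ch
    low′ : trunc w (suc j) ⊑ A′
    low′ z∈ = proj₂ eqv (closure-mono low (λ {u} → adjoin-⊑ (trunc w j) (adjoin k x) x (adjoin-old k x ∘ ⊒k) (adjoin-new k x) {u}) (SimpleStep.simple (step j<m) x∈ x∉ z∈))
    up′ : ∀ e → suc j ≤ e → m ≤ e + suc i → A′ ⊑ trunc w e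
    up′ e j<e m≤ {z} z∈ with e <? m
    ... | no  e≮m = proj₁ (trunc-top (≮⇒≥ e≮m)) (fw z)
    ... | yes e<m = closure-least closed (adjoin-⊑ k (trunc w e) x (trunc-mono w (<⇒≤ j<e) ∘ k⊑) (trunc-mono w j<e x∈)) (proj₁ eqv z∈)
      where
      closed : Closed A (trunc w e)
      closed (inj₁ (eq , a∈ , b∈)) = quot∈ (trunc-subgroup (<⇒≤ e<m)) a∈ b∈ eq
      closed (inj₂ (eq , a∈ , b∈)) =
        SimpleStep.normal (step e<m) (up (suc e) (m≤n⇒m≤1+n j<e) (subst (m ≤_) (+-suc e i) m≤) a∈) b∈ eq

  -- As m < n, after n rounds the upper bound reaches down to e = j + 1 and meets the lower one.
  squeeze-end : ∀ {w m j A} → Chain w m → Squeezed w m j n A → A ≐ trunc w (suc j)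
  squeeze-end {j = j} ch (up , low) = up (suc j) ≤-refl (≤-trans (<⇒≤ (Chain.length< ch)) (m≤n+m n (suc j))) , low

  -- An element y outside k whose closure with k misses some z of l yields a larger normal subgroup
  -- that is still proper. The fuel r exceeds `n ∸ card k`, which drops each time.
  maximal-normal : ∀ {l k} r → n ∸ card k < r → Subgroup G l → Subgroup G k → k ⊑ l → Normal k l → (∃ λ x → l ∋ x × ¬ k ∋ x) →
    ∃ λ k′ → Subgroup G k′ × SimpleStep k′ l
  maximal-normal {l} {k} (suc r) (s≤s le) sl sk k⊑l nk new
    with any? (λ y → (l ∋? y) ×-dec ¬? (k ∋? y) ×-dec any? (λ z → (l ∋? z) ×-dec ¬? (proj₁ (closure-set l (adjoin k y)) ∋? z)))
  ... | no none = k , sk , record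
    { sub = k⊑l ; new = new ; subgroup = sl ; normal = nk
    ; simple = λ {y} y∈ y∉ {z} z∈ → proj₁ (proj₂ (closure-set l (adjoin k y)))
        (decidable-stable (proj₁ (closure-set l (adjoin k y)) ∋? z) λ z∉ → none (y , y∈ , y∉ , z , z∈ , z∉)) }
  ... | yes (y , y∈ , y∉ , z , z∈ , z∉) with closure-set l (adjoin k y)
  ... | d , eqv = maximal-normal r
    (<-≤-trans (∸-monoʳ-< (card-strict {d = d} k⊑d d∋y y∉) (card≤n d)) le)
    sl (closure-subgroup (adjoin-old k y (unit∈ sk)) eqv)
    (closure-least (closed-subgroup sl) (adjoin-⊑ k l y k⊑l y∈) ∘ proj₁ eqv)
    (λ a∈ b∈ eq → proj₂ eqv (conj a∈ (proj₁ eqv b∈) eq))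
    (z , z∈ , z∉)
    where
    k⊑d : k ⊑ d
    k⊑d = proj₂ eqv ∘ base ∘ adjoin-old k y
    d∋y : d ∋ y
    d∋y = proj₂ eqv (base (adjoin-new k y))

  single : FSet n
  single = adjoin (λ _ → 0) unit

  single-unit : single unit ≡ 1
  single-unit with unit ≟ᶠ unit
  ... | yes _ = refl
  ... | no ≢  = contradiction refl ≢

  single⁻ : ∀ {x} → single ∋ x → x ≡ unit
  single⁻ {x} m with x ≟ᶠ unit
  ... | yes eq = eq
  ... | no  _  = contradiction refl m

  single-chain : ∀ {v} → v ≗ single → Chain v 0
  single-chain {v} v≗ = record
    { bound = bound′
    ; unit₁ = trans (v≗ unit) single-unit
    ; only₁ = λ {x} eq → single⁻ (λ z → contradiction (trans (sym eq) (trans (v≗ x) z)) λ ())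
    ; step  = λ () }
    where
    bound′ : ∀ x → v x ≤ 1
    bound′ x with v≗ x
    ... | eq with x ≟ᶠ unit
    ... | yes _ = ≤-reflexive eq
    ... | no  _ = subst (_≤ 1) (sym eq) z≤n

  single-normal : ∀ l → Normal single l
  single-normal l {a} {b} {z} a∈ b∈ eq with single⁻ {b} b∈
  ... | refl = subst (single ∋_) (sym z≡1) (adjoin-new _ unit)
    where
    open GroupProperties group using (quasigroup)
    open QuasigroupProperties quasigroup using (cancelʳ)
    z≡1 : z ≡ unit
    z≡1 = cancelʳ a z unit (trans eq (trans (identityʳ a) (sym (identityˡ a))))

  -- The usual existence proof for composition series: a maximal normal subgroup k of l, a chain for
  -- k by recursion, and l on top. It guarantees that the search in G has a complete series to save.
  chain-exists : ∀ r l → card l < r → Subgroup G l → ∃₂ λ v m → Chain v m × v ≐ l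
  chain-exists (suc r) l (s≤s le) sl with ⊑⊎new l single
  ... | inj₁ l⊑ = single , 0 , single-chain (λ _ → refl) , (λ m → subst (l ∋_) (sym (single⁻ m)) (unit∈ sl)) , l⊑
  ... | inj₂ new with maximal-normal {l} {single} (suc n) (s≤s (m∸n≤m n (card single))) sl (Chain.isSubgroup (single-chain (λ _ → refl)))
                        (λ m → subst (l ∋_) (sym (single⁻ m)) (unit∈ sl)) (single-normal l) new
  ... | k , sk , st with chain-exists r k (<-≤-trans (let x , x∈ , x∉ = SimpleStep.new st in card-strict {d = l} (SimpleStep.sub st) x∈ x∉) le) sk
  ... | v , m , ch , v≐k = extend v l m , suc m , chain-extend ch st′ , extend-≐ m (SimpleStep.sub st′)
    where
    st′ : SimpleStep v l
    st′ = simpleStep-cong (≐-sym v≐k) (id , id) st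

  full-chain-exists : ∃₂ λ v m → Chain v m × Full v
  full-chain-exists with chain-exists (suc n) (all G) (s≤s (card≤n (all G))) (all-subgroup G)
  ... | v , m , ch , (_ , all⊑v) = v , m , ch , λ x → all⊑v {x} (λ ())

-- Composition series

module _ {n : ℕ} where

  characteristic : Subset n → FSet n
  characteristic p x = fromBool (Vec.lookup p x)

  characteristic⁺ : ∀ {p x} → x ∈ˢ p → characteristic p ∋ x
  characteristic⁺ x∈ eq = contradiction (trans (sym (cong fromBool ([]=⇒lookup x∈))) eq) λ ()

  characteristic⁻ : ∀ {p x} → characteristic p ∋ x → x ∈ˢ p
  characteristic⁻ {p} {x} m with Vec.lookup p x in eq
  ... | true  = lookup⇒[]= x p eq
  ... | false = contradiction refl m

  ascending : ∀ {k} (t : Fin (suc k) → Subset n) → (∀ i → t (inject₁ i) ⊆ˢ t (fsuc i)) →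
              ∀ a b → toℕ a ≤ toℕ b → t a ⊆ˢ t b
  ascending t asc a = <-weakInduction (λ b → toℕ a ≤ toℕ b → t a ⊆ˢ t b)
    (λ a≤0 → subst (λ c → t a ⊆ˢ t c) (toℕ-injective (n≤0⇒n≡0 a≤0)) id) λ b ih a≤1+b → step b ih (m≤n⇒m<n∨m≡n a≤1+b)
    where
    step : ∀ b → (toℕ a ≤ toℕ (inject₁ b) → t a ⊆ˢ t (inject₁ b)) → toℕ a < suc (toℕ b) ⊎ toℕ a ≡ suc (toℕ b) → t a ⊆ˢ t (fsuc b)
    step b ih (inj₁ (s≤s a≤b)) = asc b ∘ ih (subst (toℕ a ≤_) (sym (toℕ-inject₁ b)) a≤b)
    step b ih (inj₂ eq) = subst (λ c → t a ⊆ˢ t c) (toℕ-injective {j = fsuc b} eq) id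

  -- In a full code the value 0 does not occur, so one comparison decides membership; it is also the
  -- bit that the machine emits.
  chainTerm : FSet n → ∀ {m} → Fin (suc m) → Subset n
  chainTerm v i = Vec.tabulate λ x → v x ≤ᵇ suc (toℕ i)

  ∈-chainTerm⁺ : ∀ v {m} (i : Fin (suc m)) {x} → v x ≤ suc (toℕ i) → x ∈ˢ chainTerm v i
  ∈-chainTerm⁺ v i {x} le = lookup⇒[]= x _ (trans (lookup∘tabulate (λ x → v x ≤ᵇ suc (toℕ i)) x) (Equivalence.to T-≡ (≤⇒≤ᵇ le)))

  ∈-chainTerm⁻ : ∀ v {m} (i : Fin (suc m)) {x} → x ∈ˢ chainTerm v i → v x ≤ suc (toℕ i)
  ∈-chainTerm⁻ v i {x} x∈ = ≤ᵇ⇒≤ (v x) _ (Equivalence.from T-≡ (trans (sym (lookup∘tabulate (λ x → v x ≤ᵇ suc (toℕ i)) x)) ([]=⇒lookup x∈)))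

module _ {n : ℕ} {G : FinGroup n} where
  open FinGroup G
  open GroupProperties group using (//-rightDividesˡ; //-rightDividesʳ)

  module _ {v : FSet n} {m : ℕ} (ch : Chain G v m) (full : Full G v) where
    open Chain ch

    private
      term : Fin (suc m) → Subset n
      term = chainTerm v

      trunc⇒ : ∀ i {x} → trunc v (toℕ i) ∋ x → x ∈ˢ term i
      trunc⇒ i m∈ = ∈-chainTerm⁺ v i (proj₂ (trunc⁻ v (toℕ i) m∈))

      ⇒trunc : ∀ i {x} → x ∈ˢ term i → trunc v (toℕ i) ∋ x
      ⇒trunc i {x} x∈ = trunc⁺ v (toℕ i) (full x) (∈-chainTerm⁻ v i x∈)

      subgroupᵗ : ∀ i → Subgroup G (trunc v (toℕ i))
      subgroupᵗ i = trunc-subgroup (≤-pred (toℕ<n i))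

      stepᵗ : (i : Fin m) → SimpleStep G (trunc v (toℕ (inject₁ i))) (trunc v (toℕ (fsuc i)))
      stepᵗ i = subst (λ j → SimpleStep G (trunc v j) (trunc v (suc (toℕ i)))) (sym (toℕ-inject₁ i)) (step (toℕ<n i))

    chainSeries : SubnormalSeries G m
    chainSeries = record
      { term       = term
      ; isSubgroup = λ i → record
        { unit-closed = trunc⇒ i (Subgroup.unit∈ (subgroupᵗ i))
        ; mul-closed  = λ x∈ y∈ → trunc⇒ i (Subgroup.mul∈ (subgroupᵗ i) (⇒trunc i x∈) (⇒trunc i y∈))
        ; inv-closed  = λ x∈ → trunc⇒ i (Subgroup.inv∈ (subgroupᵗ i) (⇒trunc i x∈))
        }
      ; bottom     = ⊆-antisym (λ {x} x∈ → subst (_∈ˢ ⁅ unit ⁆) (sym (only-unit (⇒trunc fzero x∈))) (x∈⁅x⁆ unit))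
                       (λ {x} x∈ → subst (_∈ˢ term fzero) (sym (x∈⁅y⁆⇒x≡y unit x∈)) (trunc⇒ fzero (unit∈trunc 0)))
      ; top        = ⊆-antisym (λ _ → ∈⊤) (λ {x} _ → ∈-chainTerm⁺ v (fromℕ m) (subst (λ j → v x ≤ suc j) (sym (toℕ-fromℕ m)) (bound x)))
      ; proper     = λ i → let x , x∈ , x∉ = SimpleStep.new (stepᵗ i) in
                       (λ {y} y∈ → trunc⇒ (fsuc i) (SimpleStep.sub (stepᵗ i) (⇒trunc (inject₁ i) y∈))) ,
                       x , trunc⇒ (fsuc i) x∈ , x∉ ∘ ⇒trunc (inject₁ i)
      ; normal     = λ i {g} {x} g∈ x∈ → trunc⇒ (inject₁ i)
                       (SimpleStep.normal (stepᵗ i) (⇒trunc (fsuc i) g∈) (⇒trunc (inject₁ i) x∈) (//-rightDividesˡ g (mul g x)))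
      }

    -- Downward induction along a refinement S. If its (j + 1)-st term is the (i + 1)-st of the
    -- chain, the i-th term of the chain occurs in S properly below it and hence lies in the j-th
    -- term of S. Were the latter larger, its normality and the simplicity of the chain's factor
    -- would make it equal to the (j + 1)-st term of S, against properness.
    chainSeries-maximal : IsMaximal G chainSeries
    chainSeries-maximal {k} S refines = >-weakInduction (λ j → ∃ λ i → term i ≡ S.term j)
      (fromℕ m , trans (SubnormalSeries.top chainSeries) (sym S.top)) λ j → λ where
        (fzero   , eq) → contradiction eq (bottom-impossible j)
        (fsuc i  , eq) → descend j i eq
      where
      module S = SubnormalSeries S
      open module Sub j = IsSubgroup (S.isSubgroup j) using (unit-closed; mul-closed; inv-closed)

      bottom-impossible : ∀ j → term fzero ≢ S.term (fsuc j)
      bottom-impossible j eq = let _ , x , x∈ , x∉ = S.proper j in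
        x∉ (subst (_∈ˢ S.term (inject₁ j)) (sym (only-unit (⇒trunc fzero (subst (x ∈ˢ_) (sym eq) x∈)))) (unit-closed (inject₁ j)))

      below : ∀ j i j′ → term (fsuc i) ≡ S.term (fsuc j) → S.term j′ ≡ term (inject₁ i) → term (inject₁ i) ⊆ˢ S.term (inject₁ j)
      below j i j′ eq eq′ {x} x∈ with toℕ j′ ≤? toℕ j
      ... | yes le = ascending S.term (λ i → proj₁ (S.proper i)) j′ (inject₁ j) (subst (toℕ j′ ≤_) (sym (toℕ-inject₁ j)) le) (subst (x ∈ˢ_) (sym eq′) x∈)
      ... | no  ≰  = let z , z∈ , z∉ = SimpleStep.new (stepᵗ i) in
        contradiction (⇒trunc (inject₁ i) (subst (z ∈ˢ_) eq′
          (ascending S.term (λ i → proj₁ (S.proper i)) (fsuc j) j′ (≰⇒> ≰) (subst (z ∈ˢ_) eq (trunc⇒ (fsuc i) z∈))))) z∉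

      descend : ∀ j i → term (fsuc i) ≡ S.term (fsuc j) → ∃ λ i′ → term i′ ≡ S.term (inject₁ j)
      descend j i eq with refines (inject₁ i)
      ... | j′ , eq′ with any? (λ y → (y ∈? S.term (inject₁ j)) ×-dec ¬? (y ∈? term (inject₁ i)))
      ... | no none = inject₁ i , ⊆-antisym (below j i j′ eq eq′) λ {y} y∈ → decidable-stable (y ∈? term (inject₁ i)) λ y∉ → none (y , y∈ , y∉)
      ... | yes (y , y∈ , y∉) = let _ , x , x∈ , x∉ = S.proper j in
        contradiction (characteristic⁻ (closure-least G closed
          (λ {u} → adjoin-⊑ (trunc v (toℕ (inject₁ i))) d y (λ {u} u∈ → characteristic⁺ (below j i j′ eq eq′ (trunc⇒ (inject₁ i) u∈))) (characteristic⁺ y∈) {u})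
          (SimpleStep.simple (stepᵗ i) (⇒trunc (fsuc i) (subst (y ∈ˢ_) (sym eq) (proj₁ (S.proper j) y∈))) (y∉ ∘ trunc⇒ (inject₁ i))
            (⇒trunc (fsuc i) (subst (x ∈ˢ_) (sym eq) x∈))))) x∉
        where
        d = characteristic (S.term (inject₁ j))
        closed : Closed G (trunc v (toℕ (fsuc i))) d
        closed {z} {a} {b} (inj₁ (refl , a∈ , b∈)) = characteristic⁺ (subst (_∈ˢ S.term (inject₁ j)) (//-rightDividesʳ b z)
          (mul-closed (inject₁ j) (characteristic⁻ a∈) (inv-closed (inject₁ j) (characteristic⁻ b∈))))
        closed {z} {a} {b} (inj₂ (e , a∈ , b∈)) = characteristic⁺ (subst (_∈ˢ S.term (inject₁ j))
          (trans (cong (λ u → mul u (inv a)) (sym e)) (//-rightDividesʳ a z))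
          (S.normal j (subst (a ∈ˢ_) eq (trunc⇒ (fsuc i) a∈)) (characteristic⁻ b∈)))

    compositionSeries : CompositionSeries G m
    compositionSeries = record { series = chainSeries ; isMaximal = chainSeries-maximal }

-- Transport of chains along an isomorphism

module _ {n : ℕ} {G H : FinGroup n} {φ : Fin n → Fin n} (iso : IsIsomorphism G H φ) where
  private
    module G = FinGroup G
    module H = FinGroup H
  open GroupMorphisms (Group.rawGroup G.group) (Group.rawGroup H.group) using (module IsGroupIsomorphism)
  open IsGroupIsomorphism iso using (injective; surjective; ∙-homo; ε-homo)

  preimage : Fin n → Fin n
  preimage y = proj₁ (surjective y)

  image-preimage : ∀ y → φ (preimage y) ≡ y
  image-preimage y = proj₂ (surjective y) refl

  preimage-image : ∀ x → preimage (φ x) ≡ x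
  preimage-image x = injective (image-preimage (φ x))

  preimage-homo : ∀ a b → preimage (H.mul a b) ≡ G.mul (preimage a) (preimage b)
  preimage-homo a b = injective (trans (image-preimage _) (sym (trans (∙-homo _ _) (cong₂ H.mul (image-preimage a) (image-preimage b)))))

  preimage-unit : preimage H.unit ≡ G.unit
  preimage-unit = injective (trans (image-preimage _) (sym ε-homo))

  private
    ψ = preimage

    homo-eq : ∀ {a b z} → H.mul z b ≡ a → G.mul (ψ z) (ψ b) ≡ ψ a
    homo-eq {a} {b} {z} eq = trans (sym (preimage-homo z b)) (cong ψ eq)

    unhomo-eq : ∀ {a b z} → G.mul z b ≡ a → H.mul (φ z) (φ b) ≡ φ a
    unhomo-eq {a} {b} {z} eq = trans (sym (∙-homo z b)) (cong φ eq)

    pull : (k : FSet n) → ∀ {x} → k ∋ x → k ∘ ψ ∋ φ x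
    pull k {x} = subst (k ∋_) (sym (preimage-image x))

    closure-transport : ∀ {l c c′ z} → (∀ {x} → c ∋ x → c′ ∋ φ x) → NormalClosure G l c z → NormalClosure H (l ∘ ψ) c′ (φ z)
    closure-transport f (base m) = base (f m)
    closure-transport f (quot p q eq) = quot (closure-transport f p) (closure-transport f q) (unhomo-eq eq)
    closure-transport {l} f (conj a∈ q eq) = conj (pull l a∈) (closure-transport f q) (trans (unhomo-eq eq) (∙-homo _ _))

    subgroup-transport : ∀ {l} → Subgroup G l → Subgroup H (l ∘ ψ)
    subgroup-transport {l} sl = record
      { unit∈ = subst (l ∋_) (sym preimage-unit) (Subgroup.unit∈ sl)
      ; quot∈ = λ a∈ b∈ eq → Subgroup.quot∈ sl a∈ b∈ (homo-eq eq) }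

    step-transport : ∀ {k l} → SimpleStep G k l → SimpleStep H (k ∘ ψ) (l ∘ ψ)
    step-transport {k} {l} st = record
      { sub      = sub
      ; new      = let x , x∈ , x∉ = new in φ x , pull l x∈ , x∉ ∘ subst (k ∋_) (preimage-image x)
      ; subgroup = subgroup-transport subgroup
      ; normal   = λ {a} {b} {z} a∈ b∈ eq → normal a∈ b∈ (trans (homo-eq eq) (preimage-homo a b))
      ; simple   = λ {y} y∈ y∉ {z} z∈ → subst (NormalClosure H (l ∘ ψ) (adjoin (k ∘ ψ) y)) (image-preimage z)
          (closure-transport (λ {x} → adjoin-transport y x) (simple y∈ y∉ z∈)) }
      where
      open SimpleStep st
      adjoin-transport : ∀ y x → adjoin k (ψ y) ∋ x → adjoin (k ∘ ψ) y ∋ φ x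
      adjoin-transport y x m with x ≟ᶠ ψ y
      ... | yes refl = subst (adjoin (k ∘ ψ) y ∋_) (sym (image-preimage y)) (adjoin-new (k ∘ ψ) y)
      ... | no _ = adjoin-old (k ∘ ψ) y (pull k m)

  -- An element of H enters the image chain when its preimage enters the original one, so the code
  -- is composed with the inverse of φ. This image is the series that the search in H has to meet
  -- when G and H are isomorphic.
  chain-transport : ∀ {v m} → Chain G v m → Chain H (v ∘ preimage) m
  chain-transport {v} {m} ch = record
    { bound = bound ∘ ψ
    ; unit₁ = trans (cong v preimage-unit) unit₁
    ; only₁ = λ {x} eq → trans (sym (image-preimage x)) (trans (cong φ (only₁ eq)) ε-homo)
    ; step  = step-transport ∘ step }
    where open Chain ch

  series-isomorphic : ∀ {v w m m′} (cv : Chain G v m) (fv : Full G v) (cw : Chain H w m′) (fw : Full H w) →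
    m ≡ m′ → w ≗ v ∘ preimage → SeriesIsomorphic G H (compositionSeries cv fv) (compositionSeries cw fw)
  series-isomorphic {v} {w} cv fv cw fw m≡m′ w≗ = m≡m′ , φ , iso , λ i j i≡j y → mk⇔
    (λ y∈ → ψ y , ∈-chainTerm⁺ v i (subst₂ _≤_ (w≗ y) (cong suc (sym i≡j)) (∈-chainTerm⁻ w j y∈)) , image-preimage y)
    (λ { (x , x∈ , refl) → ∈-chainTerm⁺ w j (subst₂ _≤_ (sym (trans (w≗ y) (cong v (preimage-image x)))) (cong suc i≡j) (∈-chainTerm⁻ v i x∈)) })

-- Arithmetic of the running time

-- d (d - 1) / 2, the total exponent of p gained from terms of at least 1, p, ..., p^(d - 1)
-- elements.
tri : ℕ → ℕ
tri zero    = 0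
tri (suc d) = d + tri d

2tri : ∀ d → 2 * tri d + d ≡ d * d
2tri zero    = refl
2tri (suc d) = begin
  2 * (d + tri d) + suc d       ≡⟨ solve 2 (λ d t → con 2 :* (d :+ t) :+ (con 1 :+ d) := con 2 :* t :+ d :+ (con 1 :+ con 2 :* d)) refl d (tri d) ⟩
  2 * tri d + d + (1 + 2 * d)   ≡⟨ cong (_+ (1 + 2 * d)) (2tri d) ⟩
  d * d + (1 + 2 * d)           ≡⟨ solve 1 (λ d → d :* d :+ (con 1 :+ con 2 :* d) := (con 1 :+ d) :* (con 1 :+ d)) refl d ⟩
  suc d * suc d                 ∎
  where
  open ≡-Reasoning
  open +-*-Solver

am-gm : ∀ a e s → a + e ≡ 2 * s → a * e ≤ s * s
am-gm a e s eq with ≤-total a s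
... | inj₁ a≤s = ordered a e s a≤s eq
  where
  ordered : ∀ a e s → a ≤ s → a + e ≡ 2 * s → a * e ≤ s * s
  ordered a e s a≤s eq with m≤n⇒∃[o]m+o≡n a≤s
  ... | x , refl = begin
    a * e                   ≡⟨ cong (a *_) (+-cancelˡ-≡ a e (a + 2 * x) (trans eq (solve 2 (λ a x → con 2 :* (a :+ x) := a :+ (a :+ con 2 :* x)) refl a x))) ⟩
    a * (a + 2 * x)         ≤⟨ m≤m+n _ (x * x) ⟩
    a * (a + 2 * x) + x * x ≡⟨ solve 2 (λ a x → a :* (a :+ con 2 :* x) :+ x :* x := (a :+ x) :* (a :+ x)) refl a x ⟩
    (a + x) * (a + x)       ∎
    where
    open ≤-Reasoning
    open +-*-Solver
... | inj₂ s≤a with m≤n⇒∃[o]m+o≡n s≤a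
... | x , refl = begin
  (s + x) * e             ≡⟨ *-distribʳ-+ e s x ⟩
  s * e + x * e           ≤⟨ +-monoʳ-≤ (s * e) (*-monoʳ-≤ x e≤s) ⟩
  s * e + x * s           ≡⟨ solve 3 (λ s x e → s :* e :+ x :* s := s :* (x :+ e)) refl s x e ⟩
  s * (x + e)             ≡⟨ cong (s *_) x+e≡s ⟩
  s * s                   ∎
  where
  open ≤-Reasoning
  open +-*-Solver
  x+e≡s : x + e ≡ s
  x+e≡s = +-cancelˡ-≡ s (x + e) s (trans (sym (+-assoc s x e)) (trans eq (cong (s +_) (+-identityʳ s))))
  e≤s : e ≤ s
  e≤s = subst (e ≤_) x+e≡s (m≤n+m e x)

^-cancelˡ-≤ : ∀ x y b → b ≢ 0 → x ^ b ≤ y ^ b → x ≤ y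
^-cancelˡ-≤ x y zero    b≢0 _  = contradiction refl b≢0
^-cancelˡ-≤ x y (suc b) _   le = ≮⇒≥ λ y<x → <⇒≱ (^-monoˡ-< (suc b) y<x) le

^-distribʳ-* : ∀ k x y → (x * y) ^ k ≡ x ^ k * y ^ k
^-distribʳ-* zero    x y = refl
^-distribʳ-* (suc k) x y = trans (cong (x * y *_) (^-distribʳ-* k x y))
  (solve 4 (λ x y u v → x :* y :* (u :* v) := x :* u :* (y :* v)) refl x y (x ^ k) (y ^ k))
  where open +-*-Solver

-- Writing λ for log_p n, the hypotheses give
-- 2 log_p N ≤ 2 λ m - m (m - 1) = λ² + m - (λ - m)² ≤ λ² + λ.
level-bound : ∀ {p n N m} → 1 ≤ p → 1 ≤ n → N * p ^ tri m ≤ n ^ m → p ^ m ≤ n → WithinBound p n 1 N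
level-bound {p} {n} {N} {m} 1≤p 1≤n count small a b b≢0 log with 2 * b * m ≤? a
-- If m ≤ a / (2 b), even the crude count n^m is within the bound.
... | yes le = begin
  N ^ (2 * b)           ≤⟨ ^-monoˡ-≤ (2 * b) (≤-trans N≤ count) ⟩
  (n ^ m) ^ (2 * b)     ≡⟨ ^-*-assoc n m (2 * b) ⟩
  n ^ (m * (2 * b))     ≤⟨ ^-monoʳ-≤ n {{n≢0}} (≤-trans (subst (_≤ a) (*-comm (2 * b) m) le) (m≤m+n a _)) ⟩
  n ^ (a + 2 * b * 1)   ∎
  where
  open ≤-Reasoning
  n≢0 = >-nonZero 1≤n
  N≤ : N ≤ N * p ^ tri m
  N≤ = subst (_≤ N * p ^ tri m) (*-identityʳ N) (*-monoʳ-≤ N (^-monoʳ-≤ p {{>-nonZero 1≤p}} {0} {tri m} z≤n))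
-- With e = 2 b m - a the power n^(2 b m) splits into n^a and n^e, and n^e must be absorbed by n^b
-- and the factor P^(2 b).
... | no ≰ with m≤n⇒∃[o]m+o≡n (<⇒≤ (≰⇒> ≰))
... | e , eq = *-cancelʳ-≤ _ _ (P ^ (2 * b)) {{P^≢0}} (begin
  N ^ (2 * b) * P ^ (2 * b)              ≡⟨ ^-distribʳ-* (2 * b) N P ⟨
  (N * P) ^ (2 * b)                      ≤⟨ ^-monoˡ-≤ (2 * b) count ⟩
  (n ^ m) ^ (2 * b)                      ≡⟨ ^-*-assoc n m (2 * b) ⟩
  n ^ (m * (2 * b))                      ≡⟨ cong (n ^_) (trans (*-comm m (2 * b)) (sym eq)) ⟩
  n ^ (a + e)                            ≡⟨ ^-distribˡ-+-* n a e ⟩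
  n ^ a * n ^ e                          ≤⟨ *-monoʳ-≤ (n ^ a) n^e≤ ⟩
  n ^ a * (n ^ b * P ^ (2 * b))          ≡⟨ *-assoc (n ^ a) (n ^ b) (P ^ (2 * b)) ⟨
  n ^ a * n ^ b * P ^ (2 * b)            ≡⟨ cong (_* P ^ (2 * b)) (^-distribˡ-+-* n a b) ⟨
  n ^ (a + b) * P ^ (2 * b)              ≤⟨ *-monoˡ-≤ (P ^ (2 * b)) (^-monoʳ-≤ n {{>-nonZero 1≤n}} (+-monoʳ-≤ a (subst (b ≤_) (sym (*-identityʳ (2 * b))) (m≤m+n b (b + 0))))) ⟩
  n ^ (a + 2 * b * 1) * P ^ (2 * b)      ∎)
  where
  open ≤-Reasoning
  P = p ^ tri m
  P^≢0 : NonZero (P ^ (2 * b))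
  P^≢0 = m^n≢0 P (2 * b) {{m^n≢0 p (tri m) {{>-nonZero 1≤p}}}}
  ae≤ : a * e ≤ (b * m) * (b * m)
  ae≤ = am-gm a e (b * m) (trans eq (*-assoc 2 b m))
  -- The hypothesis on the logarithm bounds n^b, so b-th powers are compared; a and e have the mean
  -- b m, whence a e ≤ (b m)².
  root : (n ^ e) ^ b ≤ (p ^ (b * (m * m))) ^ b
  root = begin
    (n ^ e) ^ b                   ≡⟨ ^-*-assoc n e b ⟩
    n ^ (e * b)                   ≡⟨ cong (n ^_) (*-comm e b) ⟩
    n ^ (b * e)                   ≡⟨ ^-*-assoc n b e ⟨
    (n ^ b) ^ e                   ≤⟨ ^-monoˡ-≤ e log ⟩
    (p ^ a) ^ e                   ≡⟨ ^-*-assoc p a e ⟩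
    p ^ (a * e)                   ≤⟨ ^-monoʳ-≤ p {{>-nonZero 1≤p}} ae≤ ⟩
    p ^ (b * m * (b * m))         ≡⟨ cong (p ^_) (solve 2 (λ b m → b :* m :* (b :* m) := b :* (m :* m) :* b) refl b m) ⟩
    p ^ (b * (m * m) * b)         ≡⟨ ^-*-assoc p (b * (m * m)) b ⟨
    (p ^ (b * (m * m))) ^ b       ∎
    where open +-*-Solver
  n^e≤ : n ^ e ≤ n ^ b * P ^ (2 * b)
  n^e≤ = begin
    n ^ e                               ≤⟨ ^-cancelˡ-≤ (n ^ e) (p ^ (b * (m * m))) b b≢0 root ⟩
    p ^ (b * (m * m))                   ≡⟨ cong (λ x → p ^ (b * x)) (2tri m) ⟨
    p ^ (b * (2 * tri m + m))           ≡⟨ cong (p ^_) (solve 3 (λ b t m → b :* (con 2 :* t :+ m) := m :* b :+ t :* (con 2 :* b)) refl b (tri m) m) ⟩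
    p ^ (m * b + tri m * (2 * b))       ≡⟨ ^-distribˡ-+-* p (m * b) (tri m * (2 * b)) ⟩
    p ^ (m * b) * p ^ (tri m * (2 * b)) ≡⟨ cong₂ _*_ (^-*-assoc p m b) (^-*-assoc p (tri m) (2 * b)) ⟨
    (p ^ m) ^ b * P ^ (2 * b)           ≤⟨ *-monoˡ-≤ (P ^ (2 * b)) (^-monoˡ-≤ b small) ⟩
    n ^ b * P ^ (2 * b)                 ∎
    where open +-*-Solver

within-bound-scale : ∀ {p n k c N t} → t ≤ n ^ k * N → WithinBound p n c N → WithinBound p n (k + c) t
within-bound-scale {p} {n} {k} {c} {N} {t} t≤ bd a b b≢0 log = begin
  t ^ (2 * b)                           ≤⟨ ^-monoˡ-≤ (2 * b) t≤ ⟩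
  (n ^ k * N) ^ (2 * b)                 ≡⟨ ^-distribʳ-* (2 * b) (n ^ k) N ⟩
  (n ^ k) ^ (2 * b) * N ^ (2 * b)       ≤⟨ *-mono-≤ (≤-reflexive (^-*-assoc n k (2 * b))) (bd a b b≢0 log) ⟩
  n ^ (k * (2 * b)) * n ^ (a + 2 * b * c) ≡⟨ ^-distribˡ-+-* n (k * (2 * b)) (a + 2 * b * c) ⟨
  n ^ (k * (2 * b) + (a + 2 * b * c))   ≡⟨ cong (n ^_) (solve 4 (λ k b a c → k :* (con 2 :* b) :+ (a :+ con 2 :* b :* c) := a :+ con 2 :* b :* (k :+ c)) refl k b a c) ⟩
  n ^ (a + 2 * b * (k + c))             ∎
  where
  open ≤-Reasoning
  open +-*-Solver

-- Levels are combined by their maximum, which leaves the exponent c alone; the number of levels is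
-- a polynomial factor and is left to `within-bound-scale`.
within-bound-⊔ : ∀ {p n c M N} → WithinBound p n c M → WithinBound p n c N → WithinBound p n c (M ⊔ N)
within-bound-⊔ {p} {n} {c} {M} {N} bM bN with ≤-total M N
... | inj₁ M≤N = subst (WithinBound p n c) (sym (m≤n⇒m⊔n≡n M≤N)) bN
... | inj₂ N≤M = subst (WithinBound p n c) (sym (m≥n⇒m⊔n≡m N≤M)) bM

-- Absorbs a constant factor into a power of the group order, since the time bound has no constant
-- in front.
n≤m^n : ∀ {m} n → 2 ≤ m → n ≤ m ^ n
n≤m^n {m} zero    2≤m = z≤n
n≤m^n {m} (suc n) 2≤m = begin
  suc n           ≤⟨ +-mono-≤ (m^n>0 m {{>-nonZero (≤-trans (s≤s z≤n) 2≤m)}} n) (n≤m^n n 2≤m) ⟩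
  m ^ n + m ^ n   ≡⟨ cong (m ^ n +_) (+-identityʳ (m ^ n)) ⟨
  2 * m ^ n       ≤⟨ *-monoˡ-≤ (m ^ n) 2≤m ⟩
  m * m ^ n       ∎
  where open ≤-Reasoning

-- Basic program rules

tableᴬ queueᴬ depthᴬ headᴬ tailᴬ ambientᴬ closureᴬ generatorᴬ okᴬ : ℕ
tableᴬ     = 4
queueᴬ     = 5
depthᴬ     = 6
headᴬ      = 7
tailᴬ      = 8
ambientᴬ   = 9
closureᴬ   = 10
generatorᴬ = 11
okᴬ        = 12

zᴬ aᴬ bᴬ roundᴬ squeezeᴬ xᴬ levelᴬ nodeᴬ yᴬ savedᴬ savedDepthᴬ iᴬ qᴬ answerᴬ currentᴬ : ℕ
zᴬ          = 13
aᴬ          = 14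
bᴬ          = 15
roundᴬ      = 16
squeezeᴬ    = 17
xᴬ          = 18
levelᴬ      = 19
nodeᴬ       = 20
yᴬ          = 21
savedᴬ      = 22
savedDepthᴬ = 23
iᴬ          = 25
qᴬ          = 26
answerᴬ     = 27
currentᴬ    = 28

at : ℕ → Expr → Expr
at a i = a ⟨ lit 0 , i ⟩

infixr 6 _and_

-- The machine has no Boolean connectives; any nonzero value counts as true.
_and_ : Expr → Expr → Expr
e and f = (lit 1 ⊖ (e == lit 0)) ⊖ (f == lit 0)

isZero : Expr → Expr
isZero e = e == lit 0

module _ (s : Store) where

  ==⁻ : ∀ e f → eval (e == f) s ≢ 0 → eval e s ≡ eval f s
  ==⁻ e f ne with eval e s ≡ᵇ eval f s in eq
  ... | true  = ≡ᵇ⇒≡ _ _ (subst T (sym eq) _)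
  ... | false = contradiction refl ne

  ==⁺ : ∀ e f → eval e s ≡ eval f s → eval (e == f) s ≢ 0
  ==⁺ e f eq rewrite eq | ≡ᵇ-refl (eval f s) = λ ()

  isZero⁻ : ∀ e → eval (isZero e) s ≢ 0 → eval e s ≡ 0
  isZero⁻ e = ==⁻ e (lit 0)

  isZero⁺ : ∀ e → eval e s ≡ 0 → eval (isZero e) s ≢ 0
  isZero⁺ e = ==⁺ e (lit 0)

  and⁻ : ∀ e f → eval (e and f) s ≢ 0 → eval e s ≢ 0 × eval f s ≢ 0
  and⁻ e f ne with eval e s | eval f s
  ... | zero  | zero  = contradiction refl ne
  ... | zero  | suc _ = contradiction refl ne
  ... | suc _ | zero  = contradiction refl ne
  ... | suc _ | suc _ = (λ ()) , (λ ())

  and⁺ : ∀ e f → eval e s ≢ 0 → eval f s ≢ 0 → eval (e and f) s ≢ 0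
  and⁺ e f ne nf with eval e s | eval f s
  ... | zero  | _     = contradiction refl ne
  ... | suc _ | zero  = contradiction refl nf
  ... | suc _ | suc _ = λ ()

if-hit : ∀ {i l} {u v : ℕ} → i ≡ l → (if i ≡ᵇ l then v else u) ≡ v
if-hit {i} refl rewrite ≡ᵇ-refl i = refl

if-miss : ∀ {i l} {u v : ℕ} → i ≢ l → (if i ≡ᵇ l then v else u) ≡ u
if-miss i≢l rewrite ≡ᵇ-false i≢l = refl

-- Tests do not stop the program; each can only clear a flag that was set before the first of them.
-- The relation makes the new flag the conjunction of the old one with J, so consecutive tests
-- compose.
Lowers : Set → ℕ → ℕ → Set
Lowers J o o′ = (o′ ≢ 0 → o ≢ 0 × J) × (o ≢ 0 → J → o′ ≢ 0)

lowers-map : ∀ {J J′ o o′} → (J → J′) → (J′ → J) → Lowers J o o′ → Lowers J′ o o′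
lowers-map to from (p , q) = (λ o → let o′ , j = p o in o′ , to j) , λ o j → q o (from j)

lowers-seq : ∀ {J J′ o o₁ o₂} → Lowers J o o₁ → Lowers J′ o₁ o₂ → Lowers (J × J′) o o₂
lowers-seq (p , q) (p′ , q′) = (λ o → let o₁ , j′ = p′ o ; o₀ , j = p o₁ in o₀ , j , j′) , λ o (j , j′) → q′ (q o j) j′

ok : Config → ℕ
ok κ = store κ okᴬ 0 0

lower : Expr → Stmt
lower e = when e (set okᴬ (lit 0) (lit 0) (lit 0))

lower-rule : ∀ {O e κ κ′ t} {C : Set} → (eval e (store κ) ≢ 0 → C) → (C → eval e (store κ) ≢ 0) →
  Run O ⌜ lower e ⌝ κ κ′ t → Lowers (¬ C) (ok κ) (ok κ′)
lower-rule to from (run-then ne run-assign) = (λ z → contradiction refl z) , (λ _ ¬c → contradiction (to ne) ¬c)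
lower-rule to from (run-else eq run-skip)   = (λ o → o , λ c → from c eq) , (λ o _ → o)

module _ {n : ℕ} where

  row : Store → ℕ → ℕ → FSet n
  row s a i x = s a i (toℕ x)

  below-suc : ∀ {x y : Fin n} → toℕ x < suc (toℕ y) → toℕ x < toℕ y ⊎ x ≡ y
  below-suc (s≤s le) with m≤n⇒m<n∨m≡n le
  ... | inj₁ lt = inj₁ lt
  ... | inj₂ eq = inj₂ (toℕ-injective eq)

  module _ {O : Oracle} where

    -- Reduces filling a row to one entry per round. The clause on the other rows keeps the older
    -- queue entries intact while a new one is written.
    fill-rule : ∀ {c S a i κ κ′ t} (F : FSet n) → writes ⌜ S ⌝ c ≡ false → (c ≡ᵇ a) ≡ false → store κ 0 0 0 ≡ n →
      (∀ {κ₁ κ₂ u} (x : Fin n) → store κ₁ c 0 0 ≡ toℕ x → Frame ⌜ each c S ⌝ κ κ₁ →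
         Run O ⌜ S ⌝ κ₁ κ₂ u → ∃ λ v → v ≡ F x × (∀ k l → store κ₂ a k l ≡ (store κ₁ [ a , i , toℕ x ≔ v ]) a k l)) →
      Run O ⌜ each c S ⌝ κ κ′ t →
      row (store κ′) a i ≗ F × (∀ {k} → k ≢ i → ∀ l → store κ′ a k l ≡ store κ a k l)
    fill-rule {c} {S} {a} {i} {κ} F w c≢a size body r =
      (λ x → proj₁ final x (toℕ<n x)) , (λ k≢i l → proj₂ final k≢i l)
      where
      I : ℕ → Config → Set
      I j κ₁ = (∀ x → toℕ x < j → row (store κ₁) a i x ≡ F x) × (∀ {k} → k ≢ i → ∀ l → store κ₁ a k l ≡ store κ a k l)
      final = each-rule {S = S} w size I
        ((λ x ()) , λ {k} k≢i l → trans (update-array (store κ [ c , 1 , 0 ≔ n ]) c 0 0 0 a c≢a k l) (update-array (store κ) c 1 0 n a c≢a k l))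
        (λ {κ₁} {κ₂} x ct f r₁ inv → step {κ₁} {κ₂} x (body x ct f r₁) inv) r
        where
        step : ∀ {κ₁ κ₂} (x : Fin n) → ∃ (λ v → v ≡ F x × (∀ k l → store κ₂ a k l ≡ (store κ₁ [ a , i , toℕ x ≔ v ]) a k l)) →
               I (toℕ x) κ₁ → I (suc (toℕ x)) (setCounter c (suc (toℕ x)) κ₂)
        step {κ₁} {κ₂} x (v , v≡ , upd) (done , others) = done′ , others′
          where
          counter : ∀ k l → store (setCounter c (suc (toℕ x)) κ₂) a k l ≡ store κ₂ a k l
          counter = update-array (store κ₂) c 0 0 (suc (toℕ x)) a c≢a
          done′ : ∀ y → toℕ y < suc (toℕ x) → row (store (setCounter c (suc (toℕ x)) κ₂)) a i y ≡ F y
          done′ y y< with below-suc y<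
          ... | inj₁ lt = trans (counter i (toℕ y)) (trans (upd i (toℕ y))
                  (trans (update-column (store κ₁) a i v {a} {i} (λ eq → <⇒≢ lt (sym eq))) (done y lt)))
          ... | inj₂ refl = trans (counter i (toℕ y)) (trans (upd i (toℕ y)) (trans (update-hit (store κ₁) a i (toℕ y) v) v≡))
          others′ : ∀ {k} → k ≢ i → ∀ l → store (setCounter c (suc (toℕ x)) κ₂) a k l ≡ store κ a k l
          others′ {k} k≢i l = trans (counter k l) (trans (upd k l)
            (trans (update-row (store κ₁) a {i} (toℕ x) v {a} {k} (λ eq → k≢i (sym eq)) l) (others k≢i l)))

    fill-set : ∀ {c a i e f κ κ′ t} (F : FSet n) → (a ≡ᵇ c) ≡ false → (c ≡ᵇ a) ≡ false → store κ 0 0 0 ≡ n →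
      (∀ {κ₁} (x : Fin n) → store κ₁ c 0 0 ≡ toℕ x → Frame ⌜ each c (set a e (scalar c) f) ⌝ κ κ₁ →
         eval e (store κ₁) ≡ i × eval f (store κ₁) ≡ F x) →
      Run O ⌜ each c (set a e (scalar c) f) ⌝ κ κ′ t →
      row (store κ′) a i ≗ F × (∀ {k} → k ≢ i → ∀ l → store κ′ a k l ≡ store κ a k l)
    fill-set {c} {a} {i} {e} {f} F a≢c c≢a size ev = fill-rule {S = set a e (scalar c) f} F a≢c c≢a size
      λ where x ct fr (run-assign {s = s} {q}) → eval f s , proj₂ (ev {s ∥ q} x ct fr) ,
                λ k l → cong₂ (λ p q → (s [ a , p , q ≔ eval f s ]) a k l) (proj₁ (ev {s ∥ q} x ct fr)) ct

    each-lowers : ∀ {c S κ κ′ t} {J : Fin n → Set} → writes ⌜ S ⌝ c ≡ false → (c ≡ᵇ okᴬ) ≡ false → store κ 0 0 0 ≡ n →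
      (∀ {κ₁ κ₂ u} (x : Fin n) → store κ₁ c 0 0 ≡ toℕ x → Frame ⌜ each c S ⌝ κ κ₁ → Run O ⌜ S ⌝ κ₁ κ₂ u → Lowers (J x) (ok κ₁) (ok κ₂)) →
      Run O ⌜ each c S ⌝ κ κ′ t → Lowers (∀ x → J x) (ok κ) (ok κ′)
    each-lowers {c} {S} {κ} {J = J} w c≢ok size body r =
      lowers-map (λ j x → j x (toℕ<n x)) (λ j x _ → j x)
        (each-rule {S = S} w size (λ j κ₁ → Lowers (∀ x → toℕ x < j → J x) (ok κ) (ok κ₁)) start step r)
      where
      ok-start : store (startLoop c n κ) okᴬ 0 0 ≡ store κ okᴬ 0 0
      ok-start = trans (update-array (store κ [ c , 1 , 0 ≔ n ]) c 0 0 0 okᴬ c≢ok 0 0) (update-array (store κ) c 1 0 n okᴬ c≢ok 0 0)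
      start : Lowers (∀ x → toℕ x < 0 → J x) (ok κ) (ok (startLoop c n κ))
      start = (λ o → o ∘ trans ok-start , λ _ ()) , λ o _ → o ∘ trans (sym ok-start)
      step : ∀ {κ₁ κ₂ u} (x : Fin n) → store κ₁ c 0 0 ≡ toℕ x → Frame ⌜ each c S ⌝ κ κ₁ → Run O ⌜ S ⌝ κ₁ κ₂ u →
        Lowers (∀ y → toℕ y < toℕ x → J y) (ok κ) (ok κ₁) → Lowers (∀ y → toℕ y < suc (toℕ x) → J y) (ok κ) (ok (setCounter c (suc (toℕ x)) κ₂))
      step {κ₁} {κ₂} x ct f r₁ i with lowers-seq i (body x ct f r₁)
      ... | p , q = (λ o → let o₀ , j , j′ = p (o ∘ trans (update-array (store κ₂) c 0 0 (suc (toℕ x)) okᴬ c≢ok 0 0)) in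
                       o₀ , λ y y< → Data.Sum.[ j y , (λ { refl → j′ }) ] (below-suc y<)) ,
                    λ o j → q o ((λ y y< → j y (m≤n⇒m≤1+n y<)) , j x ≤-refl) ∘
                              trans (sym (update-array (store κ₂) c 0 0 (suc (toℕ x)) okᴬ c≢ok 0 0))

-- Normal closures

zᴱ aᴱ bᴱ xᴱ yᴱ : Expr
zᴱ = scalar zᴬ
aᴱ = scalar aᴬ
bᴱ = scalar bᴬ
xᴱ = scalar xᴬ
yᴱ = scalar yᴬ

quotTest conjTest : Expr
quotTest = ((tableᴬ ⟨ zᴱ , bᴱ ⟩) == aᴱ) and at closureᴬ aᴱ and at closureᴬ bᴱ
conjTest = ((tableᴬ ⟨ zᴱ , aᴱ ⟩) == (tableᴬ ⟨ aᴱ , bᴱ ⟩)) and at ambientᴬ aᴱ and at closureᴬ bᴱ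

insert : Expr → Stmt
insert e = when e (set closureᴬ (lit 0) zᴱ (lit 1))

mark pass closure : Stmt
mark    = insert quotTest ⨟ insert conjTest
pass    = each zᴬ (each aᴬ (each bᴬ mark))
closure = each zᴬ (set closureᴬ (lit 0) zᴱ (at currentᴬ zᴱ)) ⨟
          set closureᴬ (lit 0) (scalar generatorᴬ) (lit 1) ⨟
          each roundᴬ pass

squeeze : Stmt
squeeze = each zᴬ (set ambientᴬ (lit 0) zᴱ (lit 1)) ⨟
          each squeezeᴬ (closure ⨟ each zᴬ (set ambientᴬ (lit 0) zᴱ (at closureᴬ zᴱ)))

module _ {n : ℕ} where

  clo : Config → FSet n
  clo κ = row (store κ) closureᴬ 0

  cloAt : ∀ κ {c x} → store κ c 0 0 ≡ toℕ x → store κ closureᴬ 0 (store κ c 0 0) ≡ clo κ x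
  cloAt κ p = cong (store κ closureᴬ 0) p

  amb : Config → FSet n
  amb κ = row (store κ) ambientᴬ 0

module _ {n : ℕ} (G : FinGroup n) where
  open FinGroup G

  record Env (k l : FSet n) (s : Store) : Set where
    constructor env
    field
      size′   : s 0 0 0 ≡ n
      table   : ∀ x y → s tableᴬ (toℕ x) (toℕ y) ≡ toℕ (mul x y)
      current : row s currentᴬ 0 ≗ k
      ambient : row s ambientᴬ 0 ≗ l

    tableAt : ∀ {c d x y} → s c 0 0 ≡ toℕ x → s d 0 0 ≡ toℕ y → s tableᴬ (s c 0 0) (s d 0 0) ≡ toℕ (mul x y)
    tableAt {x = x} {y} p q = trans (cong₂ (s tableᴬ) p q) (table x y)

    currentAt : ∀ {c x} → s c 0 0 ≡ toℕ x → s currentᴬ 0 (s c 0 0) ≡ k x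
    currentAt {x = x} p = trans (cong (s currentᴬ 0) p) (current x)

    ambientAt : ∀ {c x} → s c 0 0 ≡ toℕ x → s ambientᴬ 0 (s c 0 0) ≡ l x
    ambientAt {x = x} p = trans (cong (s ambientᴬ 0) p) (ambient x)

  Progress : (Fin n → Fin n → Fin n → Set) → FSet n → FSet n → FSet n → Set
  Progress J l c c′ = Reaches G l c c′ × Hits G J l c c′

  -- Completeness is always relative to a full chain w that the machine does not know: k is its
  -- segment of length j and x a suitable next generator. Soundness statements do without w and
  -- assume only a subgroup or a chain.
  record Extends (w : FSet n) (m j : ℕ) (k : FSet n) (x : Fin n) : Set where
    field
      chain : Chain G w m
      full  : Full G w
      j<m   : j < m
      k≗    : k ≗ trunc w j
      x∈    : trunc w (suc j) ∋ x
      x∉    : ¬ trunc w j ∋ x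

    k≐ : k ≐ trunc w j
    k≐ = ≗⇒≐ {c = k} k≗

module _ {n : ℕ} {G : FinGroup n} where
  open Env

  env-frame : ∀ {c k l κ κ′} → Frame c κ κ′ →
    writes c 0 ≡ false → writes c tableᴬ ≡ false → writes c currentᴬ ≡ false → writes c ambientᴬ ≡ false →
    Env G k l (store κ) → Env G k l (store κ′)
  env-frame f w₀ w₁ w₂ w₃ (env a b c d) = env
    (trans (keep f 0 w₀ 0 0) a)
    (λ x y → trans (keep f tableᴬ w₁ (toℕ x) (toℕ y)) (b x y))
    (λ x → trans (keep f currentᴬ w₂ 0 (toℕ x)) (c x))
    (λ x → trans (keep f ambientᴬ w₃ 0 (toℕ x)) (d x))

  -- For programs that overwrite the ambient array: the new ambient set is whatever they leave
  -- there.
  env-reload : ∀ {c k l κ κ′} → Frame c κ κ′ →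
    writes c 0 ≡ false → writes c tableᴬ ≡ false → writes c currentᴬ ≡ false →
    Env G k l (store κ) → Env G k (amb κ′) (store κ′)
  env-reload f w₀ w₁ w₂ (env a b c d) = env
    (trans (keep f 0 w₀ 0 0) a)
    (λ x y → trans (keep f tableᴬ w₁ (toℕ x) (toℕ y)) (b x y))
    (λ x → trans (keep f currentᴬ w₂ 0 (toℕ x)) (c x))
    (λ _ → refl)

  progress-trans : ∀ {J J′ J″ : Fin n → Fin n → Fin n → Set} {l c c₁ c₂ : FSet n} → (∀ z a b → J″ z a b → J z a b ⊎ J′ z a b) →
    Progress G J l c c₁ → Progress G J′ l c₁ c₂ → Progress G J″ l c c₂
  progress-trans {J″ = J″} {l} {c} {c₁} {c₂} split (reach₁ , hit₁) (reach₂ , hit₂) = reaches-trans G {c′ = c₁} reach₁ reach₂ , hit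
    where
    hit : ∀ {z a b} → J″ z a b → Derives G l c z a b → c₂ ∋ z
    hit {z} {a} {b} j d with split z a b j
    ... | inj₁ j₁ = proj₁ reach₂ (hit₁ j₁ d)
    ... | inj₂ j₂ = hit₂ j₂ (derives-mono G {l} {c} {c₁} (proj₁ reach₁) d)

module _ {n : ℕ} {O : Oracle} {G : FinGroup n} where
  open FinGroup G
  open Env

  insert-rule : ∀ {e l z κ κ′ t} → store κ zᴬ 0 0 ≡ toℕ z → (eval e (store κ) ≢ 0 → NormalClosure G l (clo κ) z) →
    Run O ⌜ insert e ⌝ κ κ′ t → Reaches G l (clo κ) (clo κ′) × (eval e (store κ) ≢ 0 → clo κ′ ∋ z)
  insert-rule ez der (run-else eq run-skip) = reaches-refl G , λ ne → contradiction eq ne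
  insert-rule {e} {l} {z} ez der (run-then ne (run-assign {s = s})) =
    ((λ {x} → old x) , λ {x} → new x) , λ _ eq → contradiction (trans (sym (if-hit ez)) eq) λ ()
    where
    c : FSet n
    c = row s closureᴬ 0
    old : ∀ x → c ∋ x → (if s zᴬ 0 0 ≡ᵇ toℕ x then 1 else c x) ≢ 0
    old x c∋x with s zᴬ 0 0 ≡ᵇ toℕ x
    ... | true  = λ ()
    ... | false = c∋x
    new : ∀ x → (if s zᴬ 0 0 ≡ᵇ toℕ x then 1 else c x) ≢ 0 → NormalClosure G l c x
    new x m with s zᴬ 0 0 ≟ toℕ x
    ... | yes eq = subst (NormalClosure G l c) (toℕ-injective (trans (sym ez) eq)) (der ne)
    ... | no  ≢x = base (m ∘ trans (if-miss ≢x))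

  mark-rule : ∀ {k l z a b κ κ′ t} → Env G k l (store κ) →
    store κ zᴬ 0 0 ≡ toℕ z → store κ aᴬ 0 0 ≡ toℕ a → store κ bᴬ 0 0 ≡ toℕ b →
    Run O ⌜ mark ⌝ κ κ′ t → Reaches G l (clo κ) (clo κ′) × (Derives G l (clo κ) z a b → clo κ′ ∋ z)
  mark-rule {k} {l} {z} {a} {b} {κ} {κ′} E ez ea eb (run-seq {κ′ = κ₁} r₁ r₂) =
    reaches-trans G {c′ = clo κ₁} (proj₁ step₁) (proj₁ step₂) , hit
    where
    s  = store κ
    s₁ = store κ₁
    products₁ = (tableᴬ ⟨ zᴱ , bᴱ ⟩) == aᴱ
    products₂ = (tableᴬ ⟨ zᴱ , aᴱ ⟩) == (tableᴬ ⟨ aᴱ , bᴱ ⟩)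
    members₁  = at closureᴬ aᴱ and at closureᴬ bᴱ
    members₂  = at ambientᴬ aᴱ and at closureᴬ bᴱ
    quot⇒ : eval quotTest s ≢ 0 → NormalClosure G l (clo κ) z
    quot⇒ ne =
      let p , q = and⁻ s products₁ members₁ ne
          a∈ , b∈ = and⁻ s (at closureᴬ aᴱ) (at closureᴬ bᴱ) q
      in quot {a = a} {b = b} (base (a∈ ∘ trans (cloAt κ ea))) (base (b∈ ∘ trans (cloAt κ eb)))
           (toℕ-injective (trans (sym (tableAt E ez eb)) (trans (==⁻ s (tableᴬ ⟨ zᴱ , bᴱ ⟩) aᴱ p) ea)))
    step₁ : Reaches G l (clo κ) (clo κ₁) × (eval quotTest s ≢ 0 → clo κ₁ ∋ z)
    step₁ = insert-rule {quotTest} {l} ez quot⇒ r₁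
    E₁ : Env G k l s₁
    E₁ = env-frame (frame r₁) refl refl refl refl E
    ez₁ = trans (unchanged r₁ zᴬ refl 0 0) ez
    ea₁ = trans (unchanged r₁ aᴬ refl 0 0) ea
    eb₁ = trans (unchanged r₁ bᴬ refl 0 0) eb
    conj⇒ : eval conjTest s₁ ≢ 0 → NormalClosure G l (clo κ₁) z
    conj⇒ ne =
      let p , q = and⁻ s₁ products₂ members₂ ne
          a∈ , b∈ = and⁻ s₁ (at ambientᴬ aᴱ) (at closureᴬ bᴱ) q
      in conj {a = a} {b = b} (a∈ ∘ trans (ambientAt E₁ ea₁)) (base (b∈ ∘ trans (cloAt κ₁ eb₁)))
           (toℕ-injective (trans (sym (tableAt E₁ ez₁ ea₁))
             (trans (==⁻ s₁ (tableᴬ ⟨ zᴱ , aᴱ ⟩) (tableᴬ ⟨ aᴱ , bᴱ ⟩) p) (tableAt E₁ ea₁ eb₁))))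
    step₂ : Reaches G l (clo κ₁) (clo κ′) × (eval conjTest s₁ ≢ 0 → clo κ′ ∋ z)
    step₂ = insert-rule {conjTest} {l} ez₁ conj⇒ r₂
    hit : Derives G l (clo κ) z a b → clo κ′ ∋ z
    hit (inj₁ (eq , a∈ , b∈)) = proj₁ (proj₁ step₂) (proj₂ step₁ (and⁺ s products₁ members₁
      (==⁺ s (tableᴬ ⟨ zᴱ , bᴱ ⟩) aᴱ (trans (tableAt E ez eb) (trans (cong toℕ eq) (sym ea))))
      (and⁺ s (at closureᴬ aᴱ) (at closureᴬ bᴱ) (a∈ ∘ trans (sym (cloAt κ ea))) (b∈ ∘ trans (sym (cloAt κ eb))))))
    hit (inj₂ (eq , a∈ , b∈)) = proj₂ step₂ (and⁺ s₁ products₂ members₂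
      (==⁺ s₁ (tableᴬ ⟨ zᴱ , aᴱ ⟩) (tableᴬ ⟨ aᴱ , bᴱ ⟩)
        (trans (tableAt E₁ ez₁ ea₁) (trans (cong toℕ eq) (sym (tableAt E₁ ea₁ eb₁)))))
      (and⁺ s₁ (at ambientᴬ aᴱ) (at closureᴬ bᴱ) (a∈ ∘ trans (sym (ambientAt E₁ ea₁)))
        (proj₁ (proj₁ step₁) b∈ ∘ trans (sym (cloAt κ₁ eb₁)))))

  -- The set grows while the loop reads it. A derivation from the initial set remains valid in a
  -- larger one, and elements once inserted stay, so it suffices to visit each triple once.
  each-progress : ∀ {c S l κ κ′ t} (J : Fin n → Fin n → Fin n → Fin n → Set) → writes ⌜ S ⌝ c ≡ false → (c ≡ᵇ closureᴬ) ≡ false → store κ 0 0 0 ≡ n →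
    (∀ {κ₁ κ₂ u} (x : Fin n) → store κ₁ c 0 0 ≡ toℕ x → Frame ⌜ each c S ⌝ κ κ₁ → Run O ⌜ S ⌝ κ₁ κ₂ u →
       Progress G (J x) l (clo κ₁) (clo κ₂)) →
    Run O ⌜ each c S ⌝ κ κ′ t → Progress G (λ z a b → ∃ λ x → J x z a b) l (clo κ) (clo κ′)
  each-progress {c} {S} {l} {κ} {κ′} J w c≢ size body r =
    progress-trans {J = λ _ _ _ → ⊥} {l = l} {c₁ = clo κ} {c₂ = clo κ′} (λ z a b (x , j) → inj₂ (x , toℕ<n x , j))
      (reaches-refl G , λ ())
      (each-rule {S = S} w size (λ j κ₁ → Progress G (λ z a b → ∃ λ x → toℕ x < j × J x z a b) l (clo κ) (clo κ₁)) start step r)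
    where
    transport : ∀ {J : Fin n → Fin n → Fin n → Set} {c c₁ c₂ : FSet n} → c₁ ≗ c₂ → Progress G J l c c₁ → Progress G J l c c₂
    transport {J} {c} {c₁} {c₂} eq ((m , s) , h) =
      ((λ {x} c∋x e → m c∋x (trans (eq x) e)) , λ {x} c₂∋x → s {x} (c₂∋x ∘ trans (sym (eq x)))) ,
      λ {z} j d e → h j d (trans (eq z) e)
    start : Progress G (λ z a b → ∃ λ x → toℕ x < 0 × J x z a b) l (clo κ) (clo (startLoop c n κ))
    start = transport {c = clo κ} {clo κ} {clo (startLoop c n κ)}
      (λ x → sym (trans (update-array (store κ [ c , 1 , 0 ≔ n ]) c 0 0 0 closureᴬ c≢ 0 (toℕ x)) (update-array (store κ) c 1 0 n closureᴬ c≢ 0 (toℕ x))))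
      (reaches-refl G , λ { (_ , () , _) })
    step : ∀ {κ₁ κ₂ u} (x : Fin n) → store κ₁ c 0 0 ≡ toℕ x → Frame ⌜ each c S ⌝ κ κ₁ → Run O ⌜ S ⌝ κ₁ κ₂ u →
      Progress G (λ z a b → ∃ λ y → toℕ y < toℕ x × J y z a b) l (clo κ) (clo κ₁) →
      Progress G (λ z a b → ∃ λ y → toℕ y < suc (toℕ x) × J y z a b) l (clo κ) (clo (setCounter c (suc (toℕ x)) κ₂))
    step {κ₁} {κ₂} x ct f r₁ i = transport {c = clo κ} {clo κ₂} {clo (setCounter c (suc (toℕ x)) κ₂)}
      (λ y → sym (update-array (store κ₂) c 0 0 (suc (toℕ x)) closureᴬ c≢ 0 (toℕ y)))
      (progress-trans {l = l} {c = clo κ} {clo κ₁} {clo κ₂}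
        (λ z a b (y , y< , j) → Data.Sum.map (λ lt → y , lt , j) (λ eq → subst (λ y → J y z a b) eq j) (below-suc y<))
        i (body x ct f r₁))

  -- The nested existentials arise from the three loops, one each; together they hold for every
  -- triple.
  pass-rule : ∀ {k l κ κ′ t} → Env G k l (store κ) → Run O ⌜ pass ⌝ κ κ′ t →
    Progress G (λ z a b → ∃ λ z′ → ∃ λ a′ → ∃ λ b′ → z′ ≡ z × a′ ≡ a × b′ ≡ b) l (clo κ) (clo κ′)
  pass-rule {k} {l} E = each-progress {c = zᴬ} {S = each aᴬ (each bᴬ mark)} {l = l} (λ z′ z a b → ∃ λ a′ → ∃ λ b′ → z′ ≡ z × a′ ≡ a × b′ ≡ b) refl refl (size′ E) λ z′ ez fz →
    each-progress {c = aᴬ} {S = each bᴬ mark} {l = l} (λ a′ z a b → ∃ λ b′ → z′ ≡ z × a′ ≡ a × b′ ≡ b) refl refl (size′ (env-frame fz refl refl refl refl E)) λ a′ ea fa →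
    each-progress {c = bᴬ} {S = mark} {l = l} (λ b′ z a b → z′ ≡ z × a′ ≡ a × b′ ≡ b) refl refl (size′ (env-frame fa refl refl refl refl (env-frame fz refl refl refl refl E))) λ {κ₁} {κ₂} b eb fb r →
      let E₁ = env-frame fb refl refl refl refl (env-frame fa refl refl refl refl (env-frame fz refl refl refl refl E))
          reach , hit = mark-rule E₁ (trans (keep fb zᴬ refl 0 0) (trans (keep fa zᴬ refl 0 0) ez)) (trans (keep fb aᴬ refl 0 0) ea) eb r
      in reach , λ { (refl , refl , refl) d → hit d }

  closure-rule : ∀ {k l x κ κ′ t} → Env G k l (store κ) → store κ generatorᴬ 0 0 ≡ toℕ x → Run O ⌜ closure ⌝ κ κ′ t → IsClosure G l (adjoin k x) (clo κ′)
  closure-rule {k} {l} {x} {κ} {κ′} E ex (run-seq {κ′ = κ₁} r₁ (run-seq {κ′ = κ₂} r₂@(run-assign {s = s₁}) r₃)) = conclude rounds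
    where
    E₁ : Env G k l s₁
    E₁ = env-frame (frame r₁) refl refl refl refl E
    E₂ : Env G k l (store κ₂)
    E₂ = env-frame (frame r₂) refl refl refl refl E₁
    ex₁ : s₁ generatorᴬ 0 0 ≡ toℕ x
    ex₁ = trans (unchanged r₁ generatorᴬ refl 0 0) ex
    copied : row s₁ closureᴬ 0 ≗ k
    copied = proj₁ (fill-set {c = zᴬ} {a = closureᴬ} {i = 0} {e = lit 0} {f = at currentᴬ zᴱ} k refl refl (size′ E)
      (λ {κ₃} y ct f → refl , currentAt (env-frame f refl refl refl refl E) ct) r₁)
    hit : ∀ u → u ≡ x → clo κ₂ u ≡ 1
    hit u refl = if-hit ex₁
    miss : ∀ u → u ≢ x → clo κ₂ u ≡ k u
    miss u u≢x = trans (if-miss (λ eq → u≢x (toℕ-injective (trans (sym eq) ex₁)))) (copied u)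
    to : ∀ u → clo κ₂ ∋ u → adjoin k x ∋ u
    to u m with u ≟ᶠ x
    ... | yes _  = λ ()
    ... | no u≢x = m ∘ trans (miss u u≢x)
    from : ∀ u → adjoin k x ∋ u → clo κ₂ ∋ u
    from u m e with u ≟ᶠ x
    ... | yes u≡x = contradiction (trans (sym (hit u u≡x)) e) λ ()
    ... | no u≢x = m (trans (sym (miss u u≢x)) e)
    x∈ : clo κ₂ ∋ x
    x∈ eq = contradiction (trans (sym (hit x refl)) eq) λ ()
    I : ℕ → Config → Set
    I r κ₃ = Reaches G l (clo κ₂) (clo κ₃) × (Closed G l (clo κ₃) ⊎ suc r ≤ card {n} (clo κ₃))
    step : ∀ {r κ₃ κ₄ t} → Env G k l (store κ₃) → Run O ⌜ pass ⌝ κ₃ κ₄ t → I r κ₃ → I (suc r) κ₄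
    step {r} {κ₃} {κ₄} E₃ ru (reach , cl) = reaches-trans G {c′ = clo κ₃} reach (proj₁ progress) ,
      closed-or-grows G {l} {clo κ₃} {clo κ₄} (proj₁ progress) (proj₂ progress) (λ z a b → z , a , b , refl , refl , refl) cl
      where progress = pass-rule {k} {l} {κ₃} {κ₄} E₃ ru
    rounds : I n κ′
    rounds = each-rule {c = roundᴬ} {S = pass} {κ = κ₂} refl (size′ E₂) I
      -- The set already contains x, so the count starts at 1 and n rounds are enough.
      (reaches-refl G , inj₂ (length-≤ {xs = x ∷ []} ([] ∷ []) λ { (here refl) → ∈-elements⁺ {c = clo κ₂} x∈ }))
      (λ i _ f r → step {toℕ i} (env-frame f refl refl refl refl E₂) r) r₃
    conclude : I n κ′ → IsClosure G l (adjoin k x) (clo κ′)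
    conclude (reach , inj₂ full) = contradiction (card≤n {n} (clo κ′)) (<⇒≱ full)
    conclude (reach , inj₁ cl) {z} =
      (λ m → closure-mono G id (λ {u} → to u) (proj₁ (reaches-closed G {l} {clo κ₂} {clo κ′} reach cl {z}) m)) ,
      (λ m → proj₂ (reaches-closed G {l} {clo κ₂} {clo κ′} reach cl {z}) (closure-mono G id (λ {u} → from u) m))

  -- The first half holds for every x and serves soundness. The second shows that all full chains
  -- which pass through k and take in x at the next step share that next term, so k and x determine
  -- it.
  squeeze-rule : ∀ {k l x κ κ′ t} → Env G k l (store κ) → Subgroup G k → store κ generatorᴬ 0 0 ≡ toℕ x → Run O ⌜ squeeze ⌝ κ κ′ t →
    (Subgroup G (amb κ′) × k ⊑ amb κ′ × amb κ′ ∋ x) ×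
    (∀ {w m j} → Extends G w m j k x → amb κ′ ≐ trunc w (suc j))
  squeeze-rule {k} {l} {x} {κ} {κ′} E sk ex (run-seq {κ′ = κ₁} r₁ r₂)
    with fill-set {c = zᴬ} {a = ambientᴬ} {i = 0} {e = lit 0} {f = lit 1} (λ _ → 1) refl refl (size′ E) (λ _ _ _ → refl , refl) r₁
  ... | ones , _ = proj₁ loop-result , λ ext → squeeze-end G {A = amb κ′} (Extends.chain ext) (proj₂ loop-result ext)
    where
    E₁ : Env G k (amb κ₁) (store κ₁)
    E₁ = env-reload (frame r₁) refl refl refl E
    full₁ : ∀ z → amb κ₁ ∋ z
    full₁ z eq = contradiction (trans (sym (ones z)) eq) λ ()
    body = closure ⨟ each zᴬ (set ambientᴬ (lit 0) zᴱ (at closureᴬ zᴱ))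
    I : ℕ → Config → Set
    I i κ₂ = (Subgroup G (amb κ₂) × k ⊑ amb κ₂ × amb κ₂ ∋ x) ×
             (∀ {w m j} → Extends G w m j k x → Squeezed G w m j i (amb κ₂))
    step : ∀ {κ₂ κ₃ u i} → Frame ⌜ each squeezeᴬ body ⌝ κ₁ κ₂ → Run O ⌜ body ⌝ κ₂ κ₃ u → I i κ₂ → I (suc i) κ₃
    step {κ₂} {κ₄} f (run-seq {κ′ = κ₃} ra rb) (_ , sq) =
      (closure-subgroup G {c = adjoin k x} {d = amb κ₄} (adjoin-old k x (Subgroup.unit∈ sk)) eqv′ ,
       (λ {z} m → proj₂ (eqv′ {z}) (base (adjoin-old k x m))) , proj₂ (eqv′ {x}) (base (adjoin-new k x))) ,
      λ ext → let open Extends ext in squeeze-step G {A = amb κ₂} {A′ = amb κ₄} chain full j<m k≐ x∈ x∉ eqv′ (sq ext)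
      where
      E₂ : Env G k (amb κ₂) (store κ₂)
      E₂ = env-reload f refl refl refl E₁
      eqv : IsClosure G (amb κ₂) (adjoin k x) (clo κ₃)
      eqv = closure-rule {k} {amb κ₂} {x} E₂ (trans (keep f generatorᴬ refl 0 0) (trans (unchanged r₁ generatorᴬ refl 0 0) ex)) ra
      copied : amb κ₄ ≗ clo κ₃
      copied = proj₁ (fill-set {c = zᴬ} {a = ambientᴬ} {i = 0} {e = lit 0} {f = at closureᴬ zᴱ} (clo κ₃) refl refl (trans (unchanged ra 0 refl 0 0) (size′ E₂))
        (λ {κ₅} y ct g → refl , trans (cong (store κ₅ closureᴬ 0) ct) (keep g closureᴬ refl 0 (toℕ y))) rb)
      eqv′ : IsClosure G (amb κ₂) (adjoin k x) (amb κ₄)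
      eqv′ {z} = (λ m → proj₁ (eqv {z}) (m ∘ trans (copied z))) , (λ m e → proj₂ (eqv {z}) m (trans (sym (copied z)) e))
    loop-result : I n κ′
    loop-result = each-rule {S = body} {κ = κ₁} refl (size′ E₁) I
      ((record { unit∈ = full₁ unit ; quot∈ = λ {_} {_} {z} _ _ _ → full₁ z } , (λ {z} _ → full₁ z) , full₁ x) ,
       λ ext → let open Extends ext in squeeze-start G {A = amb κ₁} chain full full₁)
      (λ _ _ f r i → step f r i) r₂

-- Testing a candidate extension

normalCond simpleCond : Expr
normalCond = (at ambientᴬ aᴱ and at currentᴬ bᴱ) and
             (((tableᴬ ⟨ zᴱ , aᴱ ⟩) == (tableᴬ ⟨ aᴱ , bᴱ ⟩)) and isZero (at currentᴬ zᴱ))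
simpleCond = (at ambientᴬ yᴱ and isZero (at currentᴬ yᴱ)) and (at ambientᴬ zᴱ and isZero (at closureᴬ zᴱ))

-- `simpleTest` runs `closure` again and overwrites `generatorᴬ` and `closureᴬ`; the candidate is
-- safe in `ambientᴬ`, where `append` reads it.
normalTest simpleBody simpleTest cosetTest try append tryBody node : Stmt
normalTest = each zᴬ (each aᴬ (each bᴬ (lower normalCond)))
simpleBody = set generatorᴬ (lit 0) (lit 0) yᴱ ⨟ closure ⨟ each zᴬ (lower simpleCond)
simpleTest = each yᴬ simpleBody
cosetTest  = each zᴬ (lower (at currentᴬ zᴱ and (xᴱ ⊖ (tableᴬ ⟨ xᴱ , zᴱ ⟩))))
try =
  set generatorᴬ (lit 0) (lit 0) xᴱ ⨟
  set okᴬ (lit 0) (lit 0) (lit 1) ⨟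
  lower (at currentᴬ xᴱ) ⨟
  cosetTest ⨟
  squeeze ⨟
  normalTest ⨟
  simpleTest
append =
  each zᴬ (cond (at currentᴬ zᴱ)
    (set queueᴬ (scalar tailᴬ) zᴱ (at currentᴬ zᴱ))
    (cond (at ambientᴬ zᴱ)
      (set queueᴬ (scalar tailᴬ) zᴱ (succ (succ (scalar levelᴬ))))
      (set queueᴬ (scalar tailᴬ) zᴱ (lit 0)))) ⨟
  set depthᴬ (scalar tailᴬ) (lit 0) (succ (scalar levelᴬ)) ⨟
  set tailᴬ (lit 0) (lit 0) (succ (scalar tailᴬ))
tryBody = try ⨟ when (scalar okᴬ) append
node =
  each zᴬ (set currentᴬ (lit 0) zᴱ (queueᴬ ⟨ scalar headᴬ , zᴱ ⟩)) ⨟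
  each xᴬ tryBody ⨟
  set headᴬ (lit 0) (lit 0) (succ (scalar headᴬ))

module _ {n : ℕ} {O : Oracle} {G : FinGroup n} where
  open FinGroup G

  open Env

  normalTest-rule : ∀ {k l κ κ′ t} → Env G k l (store κ) → Run O ⌜ normalTest ⌝ κ κ′ t → Lowers (Normal G k l) (ok κ) (ok κ′)
  normalTest-rule {k} {l} {κ} E r = lowers-map {J = ∀ z a b → ¬ C z a b}
    (λ h {a} {b} {z} l∋a k∋b eq kz≡0 → h z a b ((l∋a , k∋b) , eq , kz≡0))
    (λ N z a b ((l∋a , k∋b) , eq , kz≡0) → N {a} {b} {z} l∋a k∋b eq kz≡0)
    (each-lowers {c = zᴬ} {S = each aᴬ (each bᴬ (lower normalCond))} {κ = κ} {J = λ z → ∀ a b → ¬ C z a b} refl refl (size′ E) (λ z ez fz →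
      let Ez = env-frame fz refl refl refl refl E in
      each-lowers {c = aᴬ} {S = each bᴬ (lower normalCond)} {J = λ a → ∀ b → ¬ C z a b} refl refl (size′ Ez) (λ a ea fa →
        let Ea = env-frame fa refl refl refl refl Ez in
        each-lowers {c = bᴬ} {S = lower normalCond} {J = λ b → ¬ C z a b} refl refl (size′ Ea) (λ {κ₁} b eb fb →
          inner κ₁ (env-frame fb refl refl refl refl Ea)
            (trans (keep fb zᴬ refl 0 0) (trans (keep fa zᴬ refl 0 0) ez)) (trans (keep fb aᴬ refl 0 0) ea) eb))) r)
    where
    C : Fin n → Fin n → Fin n → Set
    C z a b = (l ∋ a × k ∋ b) × (mul z a ≡ mul a b × k z ≡ 0)
    inner : ∀ κ₁ {κ₂ u z a b} → Env G k l (store κ₁) → store κ₁ zᴬ 0 0 ≡ toℕ z → store κ₁ aᴬ 0 0 ≡ toℕ a → store κ₁ bᴬ 0 0 ≡ toℕ b →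
      Run O ⌜ lower normalCond ⌝ κ₁ κ₂ u →
      Lowers (¬ C z a b) (ok κ₁) (ok κ₂)
    inner κ₁ {z = z} {a} {b} E₁ ez ea eb = lower-rule to from
      where
      s = store κ₁
      e₁ = at ambientᴬ aᴱ and at currentᴬ bᴱ
      e₃ = (tableᴬ ⟨ zᴱ , aᴱ ⟩) == (tableᴬ ⟨ aᴱ , bᴱ ⟩)
      e₂ = e₃ and isZero (at currentᴬ zᴱ)
      to : eval (e₁ and e₂) s ≢ 0 → C z a b
      to ne =
        let p , q = and⁻ s e₁ e₂ ne
            a∈ , b∈ = and⁻ s (at ambientᴬ aᴱ) (at currentᴬ bᴱ) p
            eq , z∉ = and⁻ s e₃ (isZero (at currentᴬ zᴱ)) q
        in (a∈ ∘ trans (ambientAt E₁ ea) , b∈ ∘ trans (currentAt E₁ eb)) ,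
           toℕ-injective (trans (sym (tableAt E₁ ez ea)) (trans (==⁻ s (tableᴬ ⟨ zᴱ , aᴱ ⟩) (tableᴬ ⟨ aᴱ , bᴱ ⟩) eq) (tableAt E₁ ea eb))) ,
           trans (sym (currentAt E₁ ez)) (isZero⁻ s (at currentᴬ zᴱ) z∉)
      from : C z a b → eval (e₁ and e₂) s ≢ 0
      from ((a∈ , b∈) , eq , z∉) = and⁺ s e₁ e₂
        (and⁺ s (at ambientᴬ aᴱ) (at currentᴬ bᴱ) (a∈ ∘ trans (sym (ambientAt E₁ ea))) (b∈ ∘ trans (sym (currentAt E₁ eb))))
        (and⁺ s e₃ (isZero (at currentᴬ zᴱ))
          (==⁺ s (tableᴬ ⟨ zᴱ , aᴱ ⟩) (tableᴬ ⟨ aᴱ , bᴱ ⟩) (trans (tableAt E₁ ez ea) (trans (cong toℕ eq) (sym (tableAt E₁ ea eb)))))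
          (isZero⁺ s (at currentᴬ zᴱ) (trans (currentAt E₁ ez) z∉)))

  simpleTest-rule : ∀ {k l κ κ′ t} → Env G k l (store κ) → Run O ⌜ simpleTest ⌝ κ κ′ t →
    Lowers (∀ y → l ∋ y → ¬ k ∋ y → ∀ z → l ∋ z → NormalClosure G l (adjoin k y) z) (ok κ) (ok κ′)
  simpleTest-rule {k} {l} {κ} E r = each-lowers {c = yᴬ} {S = simpleBody} {κ = κ} refl refl (size′ E)
    (λ y ey f ru → body y ey (env-frame f refl refl refl refl E) ru) r
    where
    Covers : Fin n → Set
    Covers y = l ∋ y → ¬ k ∋ y → ∀ z → l ∋ z → NormalClosure G l (adjoin k y) z
    body : ∀ y {κ₁ κ₂ u} → store κ₁ yᴬ 0 0 ≡ toℕ y → Env G k l (store κ₁) →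
      Run O ⌜ simpleBody ⌝ κ₁ κ₂ u → Lowers (Covers y) (ok κ₁) (ok κ₂)
    body y {κ₁} {κ₄} ey E₁ (run-seq {κ′ = κ₂} r₁@run-assign (run-seq {κ′ = κ₃} r₂ r₃)) =
      subst (λ o → Lowers (Covers y) o (ok κ₄)) (unchanged r₂ okᴬ refl 0 0)
        (lowers-map {J = ∀ z → ¬ C z}
          (λ h l∋y k∌y z l∋z → proj₁ (eqv {z}) λ cz≡0 → h z ((l∋y , decidable-stable (k y ≟ 0) k∌y) , l∋z , cz≡0))
          (λ h z ((l∋y , ky≡0) , l∋z , cz≡0) → proj₂ (eqv {z}) (h l∋y (λ k∋y → k∋y ky≡0) z l∋z) cz≡0)
          (each-lowers {c = zᴬ} {S = lower simpleCond} {κ = κ₃} {J = λ z → ¬ C z} refl refl (size′ E₃) (λ {κ₅} z ez f →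
            inner κ₅ (env-frame f refl refl refl refl E₃) (trans (keep f yᴬ refl 0 0) ey₃) ez (keep f closureᴬ refl 0 (toℕ z))) r₃))
      where
      E₂ : Env G k l (store κ₂)
      E₂ = env-frame (frame r₁) refl refl refl refl E₁
      E₃ : Env G k l (store κ₃)
      E₃ = env-frame (frame r₂) refl refl refl refl E₂
      ey₃ : store κ₃ yᴬ 0 0 ≡ toℕ y
      ey₃ = trans (unchanged r₂ yᴬ refl 0 0) ey
      eqv : IsClosure G l (adjoin k y) (clo κ₃)
      eqv = closure-rule {k = k} {l} {y} E₂ ey r₂
      C : Fin n → Set
      C z = (l ∋ y × k y ≡ 0) × (l ∋ z × clo κ₃ z ≡ 0)
      inner : ∀ κ₅ {κ₆ u z} → Env G k l (store κ₅) → store κ₅ yᴬ 0 0 ≡ toℕ y → store κ₅ zᴬ 0 0 ≡ toℕ z → clo κ₅ z ≡ clo κ₃ z →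
        Run O ⌜ lower simpleCond ⌝ κ₅ κ₆ u → Lowers (¬ C z) (ok κ₅) (ok κ₆)
      inner κ₅ {z = z} E₅ ey′ ez ec = lower-rule to from
        where
        s = store κ₅
        e₁ = at ambientᴬ yᴱ and isZero (at currentᴬ yᴱ)
        e₂ = at ambientᴬ zᴱ and isZero (at closureᴬ zᴱ)
        to : eval (e₁ and e₂) s ≢ 0 → C z
        to ne =
          let p , q = and⁻ s e₁ e₂ ne
              y∈ , y∉ = and⁻ s (at ambientᴬ yᴱ) (isZero (at currentᴬ yᴱ)) p
              z∈ , z∉ = and⁻ s (at ambientᴬ zᴱ) (isZero (at closureᴬ zᴱ)) q
          in (y∈ ∘ trans (ambientAt E₅ ey′) , trans (sym (currentAt E₅ ey′)) (isZero⁻ s (at currentᴬ yᴱ) y∉)) ,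
             z∈ ∘ trans (ambientAt E₅ ez) , trans (sym (trans (cloAt κ₅ ez) ec)) (isZero⁻ s (at closureᴬ zᴱ) z∉)
        from : C z → eval (e₁ and e₂) s ≢ 0
        from ((y∈ , y∉) , z∈ , z∉) = and⁺ s e₁ e₂
          (and⁺ s (at ambientᴬ yᴱ) (isZero (at currentᴬ yᴱ)) (y∈ ∘ trans (sym (ambientAt E₅ ey′))) (isZero⁺ s (at currentᴬ yᴱ) (trans (currentAt E₅ ey′) y∉)))
          (and⁺ s (at ambientᴬ zᴱ) (isZero (at closureᴬ zᴱ)) (z∈ ∘ trans (sym (ambientAt E₅ ez))) (isZero⁺ s (at closureᴬ zᴱ) (trans (trans (cloAt κ₅ ez) ec) z∉)))

  cosetTest-rule : ∀ {k l x κ κ′ t} → Env G k l (store κ) → store κ xᴬ 0 0 ≡ toℕ x → Run O ⌜ cosetTest ⌝ κ κ′ t →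
    Lowers (CosetLeast G k x) (ok κ) (ok κ′)
  cosetTest-rule {k} {l} {x} {κ} E ex r = lowers-map {J = ∀ y → ¬ (k ∋ y × toℕ (mul x y) < toℕ x)}
    (λ h y k∋y → ≮⇒≥ λ lt → h y (k∋y , lt)) (λ h y (k∋y , lt) → <⇒≱ lt (h y k∋y))
    (each-lowers {c = zᴬ} {S = lower (at currentᴬ zᴱ and (xᴱ ⊖ (tableᴬ ⟨ xᴱ , zᴱ ⟩)))} {κ = κ} {J = λ y → ¬ (k ∋ y × toℕ (mul x y) < toℕ x)} refl refl (size′ E)
      (λ {κ₁} y ez f → inner κ₁ (env-frame f refl refl refl refl E) (trans (keep f xᴬ refl 0 0) ex) ez) r)
    where
    inner : ∀ κ₁ {κ₂ u y} → Env G k l (store κ₁) → store κ₁ xᴬ 0 0 ≡ toℕ x → store κ₁ zᴬ 0 0 ≡ toℕ y →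
      Run O ⌜ lower (at currentᴬ zᴱ and (xᴱ ⊖ (tableᴬ ⟨ xᴱ , zᴱ ⟩))) ⌝ κ₁ κ₂ u →
      Lowers (¬ (k ∋ y × toℕ (mul x y) < toℕ x)) (ok κ₁) (ok κ₂)
    inner κ₁ {y = y} E₁ ex₁ ez = lower-rule to from
      where
      s = store κ₁
      to : _ → k ∋ y × toℕ (mul x y) < toℕ x
      to ne = let p , q = and⁻ s (at currentᴬ zᴱ) (xᴱ ⊖ (tableᴬ ⟨ xᴱ , zᴱ ⟩)) ne in
        p ∘ trans (currentAt E₁ ez) , ≰⇒> λ le → q (trans (cong₂ _∸_ ex₁ (tableAt E₁ ex₁ ez)) (m≤n⇒m∸n≡0 le))
      from : k ∋ y × toℕ (mul x y) < toℕ x → _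
      from (k∋y , lt) = and⁺ s (at currentᴬ zᴱ) (xᴱ ⊖ (tableᴬ ⟨ xᴱ , zᴱ ⟩)) (k∋y ∘ trans (sym (currentAt E₁ ez)))
        λ eq → <⇒≱ lt (m∸n≡0⇒m≤n (trans (sym (cong₂ _∸_ ex₁ (tableAt E₁ ex₁ ez))) eq))

  -- For an arbitrary x the squeezed subgroup need not be a simple step over k, so the later tests
  -- provide soundness. For an x that continues a full chain it is the next term of this chain, and
  -- the tests succeed.
  try-rule : ∀ {k l x κ κ′ t} → Env G k l (store κ) → Subgroup G k → store κ xᴬ 0 0 ≡ toℕ x → Run O ⌜ try ⌝ κ κ′ t →
    (ok κ′ ≢ 0 → CosetLeast G k x × SimpleStep G k (amb κ′)) ×
    (∀ {w m j} → Extends G w m j k x → CosetLeast G k x → ok κ′ ≢ 0 × amb κ′ ≐ trunc w (suc j))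
  try-rule {k} {l} {x} {κ} {κ′} E sk ex
    (run-seq {κ′ = κ₁} r₁@run-assign (run-seq {κ′ = κ₂} r₂@run-assign (run-seq {κ′ = κ₃} r₃ (run-seq {κ′ = κ₄} r₄
      (run-seq {κ′ = κ₅} r₅ (run-seq {κ′ = κ₆} r₆ r₇)))))) = sound , complete
    where
    E₂ : Env G k l (store κ₂)
    E₂ = env-frame (frame r₂) refl refl refl refl (env-frame (frame r₁) refl refl refl refl E)
    E₃ : Env G k l (store κ₃)
    E₃ = env-frame (frame r₃) refl refl refl refl E₂
    E₄ : Env G k l (store κ₄)
    E₄ = env-frame (frame r₄) refl refl refl refl E₃
    E₅ : Env G k (amb κ₅) (store κ₅)
    E₅ = env-reload (frame r₅) refl refl refl E₄
    E₆ : Env G k (amb κ₅) (store κ₆)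
    E₆ = env-frame (frame r₆) refl refl refl refl E₅
    same : amb κ₅ ≐ amb κ′
    same = ≗⇒≐ {c = amb κ₅} {d = amb κ′} (λ z → sym (trans (unchanged r₇ ambientᴬ refl 0 (toℕ z)) (unchanged r₆ ambientᴬ refl 0 (toℕ z))))
    gx : store κ₄ generatorᴬ 0 0 ≡ toℕ x
    gx = trans (unchanged r₄ generatorᴬ refl 0 0) (trans (unchanged r₃ generatorᴬ refl 0 0) ex)
    squeezed : (Subgroup G (amb κ₅) × k ⊑ amb κ₅ × amb κ₅ ∋ x) × (∀ {w m j} → Extends G w m j k x → amb κ₅ ≐ trunc w (suc j))
    squeezed = squeeze-rule {k = k} {l} {x} E₄ sk gx r₅
    newTest : Lowers (¬ k ∋ x) (ok κ₂) (ok κ₃)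
    newTest = lower-rule {e = at currentᴬ xᴱ} (λ ne → ne ∘ trans (currentAt E₂ {xᴬ} ex)) (λ k∋x → k∋x ∘ trans (sym (currentAt E₂ {xᴬ} ex))) r₃
    tests : Lowers ((¬ k ∋ x) × CosetLeast G k x × Normal G k (amb κ₅) ×
              (∀ y → amb κ₅ ∋ y → ¬ k ∋ y → ∀ z → amb κ₅ ∋ z → NormalClosure G (amb κ₅) (adjoin k y) z))
              (ok κ₂) (ok κ′)
    tests = lowers-seq newTest (lowers-seq (cosetTest-rule E₃ (trans (unchanged r₃ xᴬ refl 0 0) ex) r₄)
      (subst (λ o → Lowers _ o (ok κ′)) (unchanged r₅ okᴬ refl 0 0)
        (lowers-seq (normalTest-rule E₅ r₆) (simpleTest-rule E₆ r₇))))
    sound : ok κ′ ≢ 0 → CosetLeast G k x × SimpleStep G k (amb κ′)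
    sound o = conclude (proj₁ tests o) (proj₁ squeezed)
      where
      conclude : ok κ₂ ≢ 0 × (¬ k ∋ x) × CosetLeast G k x × Normal G k (amb κ₅) ×
          (∀ y → amb κ₅ ∋ y → ¬ k ∋ y → ∀ z → amb κ₅ ∋ z → NormalClosure G (amb κ₅) (adjoin k y) z) →
        Subgroup G (amb κ₅) × k ⊑ amb κ₅ × amb κ₅ ∋ x → CosetLeast G k x × SimpleStep G k (amb κ′)
      conclude (_ , k∌x , least , nm , si) (sl , k⊑l , l∋x) = least , simpleStep-cong G {k} {k} {amb κ₅} {amb κ′} (id , id) same record
        { sub = k⊑l ; new = x , l∋x , k∌x ; subgroup = sl ; normal = nm ; simple = λ {y} y∈ y∉ {z} z∈ → si y y∈ y∉ z z∈ }
    complete : ∀ {w m j} → Extends G w m j k x → CosetLeast G k x → ok κ′ ≢ 0 × amb κ′ ≐ trunc w (suc j)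
    complete {w} {m} {j} ext least = proj₂ tests (λ ()) (x∉ ∘ proj₁ k≐ , least , normal , λ y y∈ y∉ z z∈ → simple y∈ y∉ z∈) ,
      (proj₁ l≐ ∘ proj₂ same) , (proj₁ same ∘ proj₂ l≐)
      where
      open Extends ext
      l≐ : amb κ₅ ≐ trunc w (suc j)
      l≐ = proj₂ squeezed ext
      open SimpleStep (simpleStep-cong G {trunc w j} {k} {trunc w (suc j)} {amb κ₅} (≐-sym {c = k} k≐) (≐-sym {c = amb κ₅} l≐) (Chain.step chain j<m))

module _ {n : ℕ} {G : FinGroup n} where
  open FinGroup G

  -- The least element x of the next term outside k is also least in its coset, because the whole
  -- coset x k lies in the next term and avoids k.
  extension-candidate : ∀ {w m j k} → Chain G w m → Full G w → j < m → k ≗ trunc w j →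
    ∃ λ x → Extends G w m j k x × CosetLeast G k x
  extension-candidate {w} {m} {j} {k} ch fw j<m k≗
    with least (λ x → (trunc w (suc j) ∋? x) ×-dec ¬? (trunc w j ∋? x)) (SimpleStep.new (Chain.step ch j<m))
  ... | x , (x∈ , x∉) , min = x , record { chain = ch ; full = fw ; j<m = j<m ; k≗ = k≗ ; x∈ = x∈ ; x∉ = x∉ } ,
    λ y k∋y → min (mul x y)
      ( Subgroup.mul∈ (Chain.trunc-subgroup ch j<m) x∈ (trunc-mono w (n≤1+n j) (proj₁ (≗⇒≐ {c = k} k≗) k∋y))
      , λ xy∈ → x∉ (Subgroup.quot∈ (Chain.trunc-subgroup ch (<⇒≤ j<m)) xy∈ (proj₁ (≗⇒≐ {c = k} k≗) k∋y) refl))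

-- The queue of partial chains

record Queue (n : ℕ) : Set where
  constructor queue
  field
    rows   : ℕ → FSet n
    depths : ℕ → ℕ
    next   : ℕ

open Queue

-- Pointwise, since frames equate stores only entry by entry.
record _≈_ {n} (Q Q′ : Queue n) : Set where
  field
    rows≈   : ∀ q → rows Q q ≗ rows Q′ q
    depths≈ : ∀ q → depths Q q ≡ depths Q′ q
    next≈   : next Q ≡ next Q′

open _≈_

queueOf : ∀ {n} → Config → Queue n
queueOf κ = queue (row (store κ) queueᴬ) (λ q → store κ depthᴬ q 0) (store κ tailᴬ 0 0)

queue-frame : ∀ {n c κ κ′} → Frame c κ κ′ → writes c queueᴬ ≡ false → writes c depthᴬ ≡ false → writes c tailᴬ ≡ false →
  queueOf {n} κ ≈ queueOf κ′
queue-frame f w₁ w₂ w₃ = record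
  { rows≈   = λ q x → sym (keep f queueᴬ w₁ q (toℕ x))
  ; depths≈ = λ q → sym (keep f depthᴬ w₂ q 0)
  ; next≈   = sym (keep f tailᴬ w₃ 0 0) }

record Appended {n} (v : FSet n) (d : ℕ) (Q Q′ : Queue n) : Set where
  field
    newRow   : rows Q′ (next Q) ≗ v
    oldRow   : ∀ {q} → q ≢ next Q → rows Q′ q ≗ rows Q q
    newDepth : depths Q′ (next Q) ≡ d
    oldDepth : ∀ {q} → q ≢ next Q → depths Q′ q ≡ depths Q q
    next′    : next Q′ ≡ suc (next Q)

module _ {n : ℕ} (G : FinGroup n) where
  open FinGroup G

  -- The effect of one node for the x in `Done`, those tried so far. `reps` exists only in the
  -- proof: it names the x behind each appended row, so that `cosetLeast-count` bounds the number of
  -- rows.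
  record Expanded (k : FSet n) (d : ℕ) (Done : Fin n → Set) (Q Q′ : Queue n) : Set where
    field
      reps     : List (Fin n)
      unique   : Unique reps
      allLeast : All (CosetLeast G k) reps
      done     : All Done reps
      next≡    : next Q′ ≡ next Q + length reps
      oldRow   : ∀ {q} → q < next Q → rows Q′ q ≗ rows Q q
      oldDepth : ∀ {q} → q < next Q → depths Q′ q ≡ depths Q q
      newChain : ∀ {q} → next Q ≤ q → q < next Q′ → Chain G (rows Q′ q) (suc d)
      newDepth : ∀ {q} → next Q ≤ q → q < next Q′ → depths Q′ q ≡ suc d
      found    : ∀ {w m x} → Done x → Extends G w m d k x → CosetLeast G k x →
                 ∃ λ q → next Q ≤ q × q < next Q′ × rows Q′ q ≗ trunc w (suc d)

    next≤ : next Q ≤ next Q′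
    next≤ = subst (next Q ≤_) (sym next≡) (m≤m+n (next Q) (length reps))

  -- Rows before h are expanded, those from h on form the frontier of depth d. Expanded rows are
  -- kept, so full chains of every length are available at the end. The last clause of `complete`
  -- places segments of length d in the frontier, where the next level will extend them; M in
  -- `total` dominates the size of every single level.
  record Level (d h : ℕ) (Q : Queue n) : Set where
    field
      h≤       : h ≤ next Q
      chains   : ∀ {q} → q < next Q → Chain G (rows Q q) (depths Q q)
      frontier : ∀ {q} → h ≤ q → q < next Q → depths Q q ≡ d
      complete : ∀ {w m j} → Chain G w m → Full G w → j ≤ m → j ≤ d →
                 ∃ λ q → q < next Q × rows Q q ≗ trunc w j × depths Q q ≡ j × (j ≡ d → h ≤ q)
      count    : ∀ {p} → IsSmallestPrimeDivisor p n → (next Q ∸ h) * p ^ tri d ≤ n ^ d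
      total    : ∀ {p} → IsSmallestPrimeDivisor p n → ∃ λ M → WithinBound p n 1 M × next Q ≤ suc d * M

  -- The state after i nodes of a level that began with head `h₀` and queue `Q₀`. A node is a chain
  -- whose top has at least p^d elements and its new rows come from distinct cosets, so it adds at
  -- most n / p^d of them.
  record Processed (d h₀ i : ℕ) (Q₀ : Queue n) (h : ℕ) (Q : Queue n) : Set where
    field
      h≡       : h ≡ h₀ + i
      next≤    : next Q₀ ≤ next Q
      oldRow   : ∀ {q} → q < next Q₀ → rows Q q ≗ rows Q₀ q
      oldDepth : ∀ {q} → q < next Q₀ → depths Q q ≡ depths Q₀ q
      newChain : ∀ {q} → next Q₀ ≤ q → q < next Q → Chain G (rows Q q) (suc d)
      newDepth : ∀ {q} → next Q₀ ≤ q → q < next Q → depths Q q ≡ suc d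
      found    : ∀ {w m q} → Chain G w m → Full G w → d < m → h₀ ≤ q → q < h₀ + i → rows Q₀ q ≗ trunc w d →
                 ∃ λ q′ → next Q₀ ≤ q′ × q′ < next Q × rows Q q′ ≗ trunc w (suc d)
      count    : ∀ {p} → IsSmallestPrimeDivisor p n → (next Q ∸ next Q₀) * p ^ d ≤ i * n

module _ {n : ℕ} {G : FinGroup n} where
  open FinGroup G

  chain-cong : ∀ {v v′ m} → v ≗ v′ → Chain G v m → Chain G v′ m
  chain-cong {v} {v′} eq ch = record
    { bound = λ x → subst (_≤ _) (eq x) (bound x)
    ; unit₁ = trans (sym (eq unit)) unit₁
    ; only₁ = λ {x} e → only₁ (trans (eq x) e)
    ; step  = λ {i} i<m → simpleStep-cong G {trunc v i} {trunc v′ i} {trunc v (suc i)} {trunc v′ (suc i)} (trunc-cong i) (trunc-cong (suc i)) (step i<m) }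
    where
    open Chain ch
    trunc-cong : ∀ i → trunc v i ≐ trunc v′ i
    trunc-cong i = ≗⇒≐ {c = trunc v i} (λ x → cong (λ a → if a ≤ᵇ suc i then a else 0) (eq x))

  expanded-start : ∀ {k d Done Q Q′} → (∀ {x} → ¬ Done x) → Q ≈ Q′ → Expanded G k d Done Q Q′
  expanded-start none e = record
    { reps = [] ; unique = [] ; allLeast = [] ; done = []
    ; next≡    = trans (sym (next≈ e)) (sym (+-identityʳ _))
    ; oldRow   = λ {q} _ x → sym (rows≈ e q x)
    ; oldDepth = λ {q} _ → sym (depths≈ e q)
    ; newChain = λ ≤q q< → contradiction (≤-trans q< (≤-trans (≤-reflexive (sym (next≈ e))) ≤q)) 1+n≰n
    ; newDepth = λ ≤q q< → contradiction (≤-trans q< (≤-trans (≤-reflexive (sym (next≈ e))) ≤q)) 1+n≰n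
    ; found    = λ dx → contradiction dx none }

  expanded-cong : ∀ {k d Done Q Q₁ Q₂} → Q₁ ≈ Q₂ → Expanded G k d Done Q Q₁ → Expanded G k d Done Q Q₂
  expanded-cong {Q = Q} {Q₁} {Q₂} e ex = record
    { reps = reps ; unique = unique ; allLeast = allLeast ; done = done
    ; next≡    = trans (sym (next≈ e)) next≡
    ; oldRow   = λ {q} q< x → trans (sym (rows≈ e q x)) (oldRow q< x)
    ; oldDepth = λ {q} q< → trans (sym (depths≈ e q)) (oldDepth q<)
    ; newChain = λ {q} ≤q q< → chain-cong (rows≈ e q) (newChain ≤q (subst (q <_) (sym (next≈ e)) q<))
    ; newDepth = λ {q} ≤q q< → trans (sym (depths≈ e q)) (newDepth ≤q (subst (q <_) (sym (next≈ e)) q<))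
    ; found    = λ dx ext l → let q , ≤q , q< , eq = found dx ext l in
                   q , ≤q , subst (q <_) (next≈ e) q< , λ z → trans (sym (rows≈ e q z)) (eq z) }
    where open Expanded ex

  expanded-skip : ∀ {k d Done Done′ x Q Q₁} → (∀ {y} → Done y → Done′ y) → (∀ {y} → Done′ y → Done y ⊎ y ≡ x) →
    (∀ {w m} → Extends G w m d k x → ¬ CosetLeast G k x) → Expanded G k d Done Q Q₁ → Expanded G k d Done′ Q Q₁
  expanded-skip {k} {d} {Done} {Done′} {x} {Q} {Q₁} weaken split none ex = record
    { reps = reps ; unique = unique ; allLeast = allLeast ; done = All.map weaken done ; next≡ = next≡
    ; oldRow = oldRow ; oldDepth = oldDepth ; newChain = newChain ; newDepth = newDepth ; found = λ {w} {m} → found′ {w} {m} }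
    where
    open Expanded ex
    found′ : ∀ {w m y} → Done′ y → Extends G w m d k y → CosetLeast G k y →
      ∃ λ q → next Q ≤ q × q < next Q₁ × rows Q₁ q ≗ trunc w (suc d)
    found′ dy ext l with split dy
    ... | inj₁ dy′  = found dy′ ext l
    ... | inj₂ refl = contradiction l (none ext)

  expanded-append : ∀ {k d Done Done′ x v Q Q₁ Q₂} → (∀ {y} → Done y → Done′ y) → (∀ {y} → Done′ y → Done y ⊎ y ≡ x) →
    ¬ Done x → Done′ x → CosetLeast G k x → Chain G v (suc d) →
    (∀ {w m} → Extends G w m d k x → CosetLeast G k x → v ≗ trunc w (suc d)) →
    Appended v (suc d) Q₁ Q₂ → Expanded G k d Done Q Q₁ → Expanded G k d Done′ Q Q₂
  expanded-append {k} {d} {Done} {Done′} {x} {v} {Q} {Q₁} {Q₂} weaken split fresh dx lx ch match app ex = record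
    { reps     = x ∷ reps
    ; unique   = All.map (λ dy x≡y → fresh (subst Done (sym x≡y) dy)) done ∷ unique
    ; allLeast = lx ∷ allLeast
    ; done     = dx ∷ All.map weaken done
    ; next≡    = trans next′ (trans (cong suc next≡) (sym (+-suc (next Q) (length reps))))
    ; oldRow   = λ {q} q< z → trans (A.oldRow (<⇒≢ (<-≤-trans q< next≤)) z) (oldRow q< z)
    ; oldDepth = λ {q} q< → trans (A.oldDepth (<⇒≢ (<-≤-trans q< next≤))) (oldDepth q<)
    ; newChain = newChain′
    ; newDepth = newDepth′
    ; found    = λ {w} {m} → found′ {w} {m} }
    where
    open Expanded ex
    module A = Appended app
    open A using (next′)
    last : ∀ {q} → q < next Q₂ → q < next Q₁ ⊎ q ≡ next Q₁
    last {q} q< = m≤n⇒m<n∨m≡n (≤-pred (subst (q <_) next′ q<))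
    newChain′ : ∀ {q} → next Q ≤ q → q < next Q₂ → Chain G (rows Q₂ q) (suc d)
    newChain′ ≤q q< with last q<
    ... | inj₁ lt   = chain-cong (λ z → sym (A.oldRow (<⇒≢ lt) z)) (newChain ≤q lt)
    ... | inj₂ refl = chain-cong (λ z → sym (A.newRow z)) ch
    newDepth′ : ∀ {q} → next Q ≤ q → q < next Q₂ → depths Q₂ q ≡ suc d
    newDepth′ ≤q q< with last q<
    ... | inj₁ lt   = trans (A.oldDepth (<⇒≢ lt)) (newDepth ≤q lt)
    ... | inj₂ refl = A.newDepth
    found′ : ∀ {w m y} → Done′ y → Extends G w m d k y → CosetLeast G k y →
      ∃ λ q → next Q ≤ q × q < next Q₂ × rows Q₂ q ≗ trunc w (suc d)
    found′ dy ext l with split dy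
    ... | inj₁ dy′  = let q , ≤q , q< , eq = found dy′ ext l in
                      q , ≤q , subst (q <_) (sym next′) (m≤n⇒m≤1+n q<) , λ z → trans (A.oldRow (<⇒≢ q<) z) (eq z)
    ... | inj₂ refl = next Q₁ , next≤ , subst (next Q₁ <_) (sym next′) ≤-refl , λ z → trans (A.newRow z) (match ext l z)

  processed-start : ∀ {d h Q} → Processed G d h 0 Q h Q
  processed-start {d} {h} {Q} = record
    { h≡ = sym (+-identityʳ h) ; next≤ = ≤-refl ; oldRow = λ _ _ → refl ; oldDepth = λ _ → refl
    ; newChain = λ ≤q q< → contradiction (≤-trans q< ≤q) 1+n≰n
    ; newDepth = λ ≤q q< → contradiction (≤-trans q< ≤q) 1+n≰n
    ; found = λ {_} {_} {q} _ _ _ ≤q q< → contradiction (≤-trans q< (≤-trans (≤-reflexive (+-identityʳ h)) ≤q)) 1+n≰n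
    ; count = λ {p} _ → ≤-reflexive (cong (_* p ^ d) (n∸n≡0 (next Q))) }

  processed-step : ∀ {d h₀ i Q₀ h Q Q′} → Chain G (rows Q h) d → h₀ + i < next Q₀ → Processed G d h₀ i Q₀ h Q →
    Expanded G (rows Q h) d (λ x → toℕ x < n) Q Q′ → Processed G d h₀ (suc i) Q₀ (suc h) Q′
  processed-step {d} {h₀} {i} {Q₀} {h} {Q} {Q′} ch lt pr ex = record
    { h≡       = trans (cong suc h≡) (sym (+-suc h₀ i))
    ; next≤    = ≤-trans next≤ X.next≤
    ; oldRow   = λ q< x → trans (X.oldRow (<-≤-trans q< next≤) x) (oldRow q< x)
    ; oldDepth = λ q< → trans (X.oldDepth (<-≤-trans q< next≤)) (oldDepth q<)
    ; newChain = newChain′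
    ; newDepth = newDepth′
    ; found    = found′
    ; count    = count′ }
    where
    open Processed pr
    module X = Expanded ex
    newChain′ : ∀ {q} → next Q₀ ≤ q → q < next Q′ → Chain G (rows Q′ q) (suc d)
    newChain′ {q} ≤q q< with q <? next Q
    ... | yes lt = chain-cong (λ x → sym (X.oldRow lt x)) (newChain ≤q lt)
    ... | no  ≮  = X.newChain (≮⇒≥ ≮) q<
    newDepth′ : ∀ {q} → next Q₀ ≤ q → q < next Q′ → depths Q′ q ≡ suc d
    newDepth′ {q} ≤q q< with q <? next Q
    ... | yes lt = trans (X.oldDepth lt) (newDepth ≤q lt)
    ... | no  ≮  = X.newDepth (≮⇒≥ ≮) q<
    found′ : ∀ {w m q} → Chain G w m → Full G w → d < m → h₀ ≤ q → q < h₀ + suc i → rows Q₀ q ≗ trunc w d →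
             ∃ λ q′ → next Q₀ ≤ q′ × q′ < next Q′ × rows Q′ q′ ≗ trunc w (suc d)
    found′ {w} {m} {q} cw fw d<m ≤q q< eq with m≤n⇒m<n∨m≡n (≤-pred (subst (q <_) (+-suc h₀ i) q<))
    ... | inj₁ q<i = let q′ , ≤q′ , q′< , e = found cw fw d<m ≤q q<i eq in
                     q′ , ≤q′ , <-≤-trans q′< X.next≤ , λ x → trans (X.oldRow q′< x) (e x)
    ... | inj₂ refl = let x , ext , l = extension-candidate {w = w} {m} {d} {rows Q h} cw fw d<m
                                          (λ x → trans (trans (cong (λ h → rows Q h x) h≡) (oldRow lt x)) (eq x))
                          q′ , ≤q′ , q′< , e = X.found (toℕ<n x) ext l
                      in q′ , ≤-trans next≤ ≤q′ , q′< , e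
    count′ : ∀ {p} → IsSmallestPrimeDivisor p n → (next Q′ ∸ next Q₀) * p ^ d ≤ suc i * n
    count′ {p} sp = begin
      (next Q′ ∸ next Q₀) * p ^ d           ≡⟨ cong (λ a → (a ∸ next Q₀) * p ^ d) X.next≡ ⟩
      (next Q + c ∸ next Q₀) * p ^ d        ≡⟨ cong (_* p ^ d) (+-∸-comm c next≤) ⟩
      (next Q ∸ next Q₀ + c) * p ^ d        ≡⟨ *-distribʳ-+ (p ^ d) (next Q ∸ next Q₀) c ⟩
      (next Q ∸ next Q₀) * p ^ d + c * p ^ d ≤⟨ +-mono-≤ (count sp) (≤-trans (*-monoʳ-≤ c (Chain.card-power-top ch sp))
                                                   (cosetLeast-count G (Chain.isSubgroup ch) X.unique X.allLeast)) ⟩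
      i * n + n                             ≡⟨ +-comm (i * n) n ⟩
      suc i * n                             ∎
      where
      open ≤-Reasoning
      c = length X.reps

  -- The gain p^d at each node multiplies the gain p^(tri d) of the old frontier, and d + tri d is
  -- the next exponent.
  level-step : ∀ {d h₀ Q₀ h Q} → 1 ≤ n → Level G d h₀ Q₀ → Processed G d h₀ (next Q₀ ∸ h₀) Q₀ h Q → Level G (suc d) h Q
  level-step {d} {h₀} {Q₀} {h} {Q} 1≤n lv pr = record
    { h≤       = subst (_≤ next Q) (sym h≡next) next≤
    ; chains   = chains′
    ; frontier = λ {q} h≤q q< → newDepth (subst (_≤ q) h≡next h≤q) q<
    ; complete = complete′
    ; count    = λ sp → subst (λ h → (next Q ∸ h) * _ ≤ _) (sym h≡next) (count′ sp)
    ; total    = total′ }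
    where
    open Processed pr hiding (count)
    module L = Level lv
    h≡next : h ≡ next Q₀
    h≡next = trans h≡ (m+[n∸m]≡n L.h≤)
    chains′ : ∀ {q} → q < next Q → Chain G (rows Q q) (depths Q q)
    chains′ {q} q< with q <? next Q₀
    ... | yes lt = subst (Chain G (rows Q q)) (sym (oldDepth lt)) (chain-cong (λ x → sym (oldRow lt x)) (L.chains lt))
    ... | no  ≮  = subst (Chain G (rows Q q)) (sym (newDepth (≮⇒≥ ≮) q<)) (newChain (≮⇒≥ ≮) q<)
    complete′ : ∀ {w m j} → Chain G w m → Full G w → j ≤ m → j ≤ suc d →
      ∃ λ q → q < next Q × rows Q q ≗ trunc w j × depths Q q ≡ j × (j ≡ suc d → h ≤ q)
    complete′ {w} {m} {j} cw fw j≤m j≤ with m≤n⇒m<n∨m≡n j≤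
    ... | inj₁ (s≤s j≤d) = let q , q< , e , dq , _ = L.complete cw fw j≤m j≤d in
      q , <-≤-trans q< next≤ , (λ x → trans (oldRow q< x) (e x)) , trans (oldDepth q<) dq ,
      λ j≡ → contradiction (subst (_≤ d) j≡ j≤d) 1+n≰n
    ... | inj₂ refl = let q , q< , e , _ , h₀≤q = L.complete cw fw (<⇒≤ j≤m) ≤-refl
                          q′ , ≤q′ , q′< , e′ = found cw fw j≤m (h₀≤q refl) (subst (q <_) (sym (m+[n∸m]≡n L.h≤)) q<) e
                      in q′ , q′< , e′ , newDepth ≤q′ q′< , λ _ → subst (_≤ q′) (sym h≡next) ≤q′
    N = next Q ∸ next Q₀
    count′ : ∀ {p} → IsSmallestPrimeDivisor p n → N * p ^ tri (suc d) ≤ n ^ suc d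
    count′ {p} sp = begin
      N * p ^ (d + tri d)                     ≡⟨ cong (N *_) (^-distribˡ-+-* p d (tri d)) ⟩
      N * (p ^ d * p ^ tri d)                 ≡⟨ *-assoc N (p ^ d) (p ^ tri d) ⟨
      N * p ^ d * p ^ tri d                   ≤⟨ *-monoˡ-≤ (p ^ tri d) (Processed.count pr sp) ⟩
      (next Q₀ ∸ h₀) * n * p ^ tri d          ≡⟨ solve 3 (λ a b c → a :* b :* c := b :* (a :* c)) refl (next Q₀ ∸ h₀) n (p ^ tri d) ⟩
      n * ((next Q₀ ∸ h₀) * p ^ tri d)        ≤⟨ *-monoʳ-≤ n (L.count sp) ⟩
      n ^ suc d                               ∎
      where
      open ≤-Reasoning
      open +-*-Solver
    total′ : ∀ {p} → IsSmallestPrimeDivisor p n → ∃ λ M → WithinBound p n 1 M × next Q ≤ suc (suc d) * M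
    -- `level-bound` requires p^(d + 1) ≤ n, which is read off from a new row; if there is none, the
    -- old M still serves.
    total′ {p} sp with L.total sp | next Q₀ <? next Q
    ... | M , bM , le | no ≮ = M , bM , ≤-trans (≮⇒≥ ≮) (≤-trans le (m≤n+m (suc d * M) M))
    ... | M , bM , le | yes lt = M ⊔ N , within-bound-⊔ {p} {n} {1} {M} {N} bM bN , (begin
      next Q                                  ≡⟨ m+[n∸m]≡n next≤ ⟨
      next Q₀ + N                             ≤⟨ +-mono-≤ (≤-trans le (*-monoʳ-≤ (suc d) (m≤m⊔n M N))) (m≤n⊔m M N) ⟩
      suc d * (M ⊔ N) + (M ⊔ N)               ≡⟨ +-comm (suc d * (M ⊔ N)) (M ⊔ N) ⟩
      suc (suc d) * (M ⊔ N)                   ∎)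
      where
      open ≤-Reasoning
      bN : WithinBound p n 1 N
      bN = level-bound {m = suc d} (>-nonZero⁻¹ p {{prime⇒nonZero (proj₁ sp)}}) 1≤n (count′ sp)
        (≤-trans (Chain.card-power-top (newChain ≤-refl lt) sp) (card≤n (rows Q (next Q₀))))

  trunc-zero : ∀ {w m} → Chain G w m → trunc w 0 ≗ single G
  trunc-zero {w} ch x with x ≟ᶠ unit
  ... | yes refl = trans (trunc-≤ w 0 (≤-reflexive (Chain.unit₁ ch))) (Chain.unit₁ ch)
  ... | no  x≢1 = decidable-stable (trunc w 0 x ≟ 0) (x≢1 ∘ Chain.only-unit ch)

  level-start : ∀ {Q} → 1 ≤ n → rows Q 0 ≗ single G → depths Q 0 ≡ 0 → next Q ≡ 1 → Level G 0 0 Q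
  level-start {Q} 1≤n row₀ depth₀ next₁ = record
    { h≤       = z≤n
    ; chains   = λ {q} q< → subst (λ q → Chain G (rows Q q) (depths Q q)) (sym (zero′ q<))
                   (subst (Chain G (rows Q 0)) (sym depth₀) (single-chain G row₀))
    ; frontier = λ _ q< → trans (cong (depths Q) (zero′ q<)) depth₀
    ; complete = λ { cw fw _ z≤n → 0 , subst (0 <_) (sym next₁) z<s , (λ x → trans (row₀ x) (sym (trunc-zero cw x))) , depth₀ , λ _ → z≤n }
    ; count    = λ _ → subst (λ a → a * 1 ≤ 1) (sym next₁) ≤-refl
    ; total    = λ _ → 1 , (λ a b _ _ → ≤-trans (≤-reflexive (^-zeroˡ (2 * b))) (m^n>0 n {{>-nonZero 1≤n}} (a + 2 * b * 1))) , ≤-reflexive next₁ }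
    where
    zero′ : ∀ {q} → q < next Q → q ≡ 0
    zero′ {q} q< = n≤0⇒n≡0 (≤-pred (subst (q <_) next₁ q<))

module _ {n : ℕ} {O : Oracle} {G : FinGroup n} where
  open FinGroup G
  open Env

  append-rule : ∀ {k l d κ κ′ t} → Env G k l (store κ) → store κ levelᴬ 0 0 ≡ d → Run O ⌜ append ⌝ κ κ′ t →
    Appended (extend k l d) (suc d) (queueOf κ) (queueOf κ′)
  append-rule {k} {l} {d} {κ} {κ′} E ed (run-seq {κ′ = κ₁} r₁ (run-seq {κ′ = κ₂} r₂@run-assign r₃@run-assign)) = record
    { newRow   = proj₁ filled
    ; oldRow   = λ q≢ x → proj₂ filled q≢ (toℕ x)
    ; newDepth = trans (if-hit {u = if-else} tail₁) (cong suc level₁)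
    ; oldDepth = λ {q} q≢ → trans (if-miss {u = store κ₁ depthᴬ q 0} (λ eq → q≢ (trans (sym eq) tail₁))) (unchanged r₁ depthᴬ refl q 0)
    ; next′    = cong suc tail₁
    }
    where
    if-else = store κ₁ depthᴬ (store κ tailᴬ 0 0) 0
    tail₁ : store κ₁ tailᴬ 0 0 ≡ store κ tailᴬ 0 0
    tail₁ = unchanged r₁ tailᴬ refl 0 0
    level₁ : store κ₁ levelᴬ 0 0 ≡ d
    level₁ = trans (unchanged r₁ levelᴬ refl 0 0) ed
    body = cond (at currentᴬ zᴱ)
      (set queueᴬ (scalar tailᴬ) zᴱ (at currentᴬ zᴱ))
      (cond (at ambientᴬ zᴱ)
        (set queueᴬ (scalar tailᴬ) zᴱ (succ (succ (scalar levelᴬ))))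
        (set queueᴬ (scalar tailᴬ) zᴱ (lit 0)))
    value : ∀ {κ₁ κ₂ u} (x : Fin n) → Env G k l (store κ₁) → store κ₁ levelᴬ 0 0 ≡ d → store κ₁ tailᴬ 0 0 ≡ store κ tailᴬ 0 0 →
      store κ₁ zᴬ 0 0 ≡ toℕ x → Run O ⌜ body ⌝ κ₁ κ₂ u →
      ∃ λ v → v ≡ extend k l d x × (∀ i j → store κ₂ queueᴬ i j ≡ (store κ₁ [ queueᴬ , store κ tailᴬ 0 0 , toℕ x ≔ v ]) queueᴬ i j)
    value {κ₁} x E₁ ed₁ et ez (run-then ne run-assign) =
      k x , sym (extend-old k l d (ne ∘ trans (currentAt E₁ {zᴬ} ez))) ,
      λ i j → trans (cong₂ (λ p q → (store κ₁ [ queueᴬ , p , q ≔ store κ₁ currentᴬ 0 (store κ₁ zᴬ 0 0) ]) queueᴬ i j) et ez)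
                (cong (λ v → (store κ₁ [ queueᴬ , store κ tailᴬ 0 0 , toℕ x ≔ v ]) queueᴬ i j) (currentAt E₁ {zᴬ} ez))
    value {κ₁} x E₁ ed₁ et ez (run-else eq (run-then ne run-assign)) =
      suc (suc d) , sym (extend-new k l d (λ k∋x → k∋x (trans (sym (currentAt E₁ {zᴬ} ez)) eq)) (ne ∘ trans (ambientAt E₁ {zᴬ} ez))) ,
      λ i j → trans (cong₂ (λ p q → (store κ₁ [ queueᴬ , p , q ≔ suc (suc (store κ₁ levelᴬ 0 0)) ]) queueᴬ i j) et ez)
                (cong (λ v → (store κ₁ [ queueᴬ , store κ tailᴬ 0 0 , toℕ x ≔ suc (suc v) ]) queueᴬ i j) ed₁)
    value {κ₁} x E₁ ed₁ et ez (run-else eq (run-else eq′ run-assign)) =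
      0 , sym (extend-none k l d (λ k∋x → k∋x (trans (sym (currentAt E₁ {zᴬ} ez)) eq)) (λ l∋x → l∋x (trans (sym (ambientAt E₁ {zᴬ} ez)) eq′))) ,
      λ i j → cong₂ (λ p q → (store κ₁ [ queueᴬ , p , q ≔ 0 ]) queueᴬ i j) et ez
    filled : row (store κ₁) queueᴬ (store κ tailᴬ 0 0) ≗ extend k l d ×
             (∀ {q} → q ≢ store κ tailᴬ 0 0 → ∀ j → store κ₁ queueᴬ q j ≡ store κ queueᴬ q j)
    filled = fill-rule {c = zᴬ} {S = body} {a = queueᴬ} (extend k l d) refl refl (size′ E)
      (λ x ez f r → value x (env-frame f refl refl refl refl E) (trans (keep f levelᴬ refl 0 0) ed) (keep f tailᴬ refl 0 0) ez r) r₁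

  tryBody-rule : ∀ {k d x κ κ′ t l Q} → Env G k l (store κ) → Chain G k d → store κ xᴬ 0 0 ≡ toℕ x → store κ levelᴬ 0 0 ≡ d →
    Run O ⌜ tryBody ⌝ κ κ′ t → Expanded G k d (λ y → toℕ y < toℕ x) Q (queueOf κ) → Expanded G k d (λ y → toℕ y < suc (toℕ x)) Q (queueOf κ′)
  tryBody-rule {k} {d} {x} {κ} {κ′} E ch ex ed (run-seq {κ′ = κ₁} r₁ (run-else eq run-skip)) ed₀ =
    expanded-skip {x = x} m≤n⇒m≤1+n below-suc (λ ext l → contradiction eq (proj₁ (proj₂ tried ext l)))
      (expanded-cong (queue-frame (frame r₁) refl refl refl) ed₀)
    where
    tried : (ok κ₁ ≢ 0 → CosetLeast G k x × SimpleStep G k (amb κ₁)) ×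
      (∀ {w m j} → Extends G w m j k x → CosetLeast G k x → ok κ₁ ≢ 0 × amb κ₁ ≐ trunc w (suc j))
    tried = try-rule E (Chain.isSubgroup ch) ex r₁
  tryBody-rule {k} {d} {x} {κ} {κ′} E ch ex ed (run-seq {κ′ = κ₁} r₁ (run-then ne r₂)) ed₀ =
    expanded-append {x = x} {v = extend k (amb κ₁) d} m≤n⇒m≤1+n below-suc (<-irrefl refl) ≤-refl (proj₁ (proj₁ tried ne))
      (chain-extend G ch (proj₂ (proj₁ tried ne)))
      (λ {w} ext l → extend-trunc′ ext (proj₂ (proj₂ tried ext l)))
      (append-rule (env-reload (frame r₁) refl refl refl E) (trans (unchanged r₁ levelᴬ refl 0 0) ed) r₂)
      (expanded-cong (queue-frame (frame r₁) refl refl refl) ed₀)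
    where
    tried : (ok κ₁ ≢ 0 → CosetLeast G k x × SimpleStep G k (amb κ₁)) ×
      (∀ {w m j} → Extends G w m j k x → CosetLeast G k x → ok κ₁ ≢ 0 × amb κ₁ ≐ trunc w (suc j))
    tried = try-rule E (Chain.isSubgroup ch) ex r₁
    extend-trunc′ : ∀ {w m} → Extends G w m d k x → amb κ₁ ≐ trunc w (suc d) → extend k (amb κ₁) d ≗ trunc w (suc d)
    extend-trunc′ {w} ext l≐ = extend-trunc G {w = w} (Extends.k≗ ext) l≐

  node-rule : ∀ {d κ κ′ t} → store κ 0 0 0 ≡ n → (∀ x y → store κ tableᴬ (toℕ x) (toℕ y) ≡ toℕ (mul x y)) →
    Chain G (row (store κ) queueᴬ (store κ headᴬ 0 0)) d → store κ levelᴬ 0 0 ≡ d → Run O ⌜ node ⌝ κ κ′ t →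
    Expanded G (row (store κ) queueᴬ (store κ headᴬ 0 0)) d (λ x → toℕ x < n) (queueOf κ) (queueOf κ′) ×
    store κ′ headᴬ 0 0 ≡ suc (store κ headᴬ 0 0)
  node-rule {d} {κ} {κ′} en et ch ed (run-seq {κ′ = κ₁} r₁ (run-seq {κ′ = κ₂} r₂ run-assign)) =
    expanded , cong suc (trans (unchanged r₂ headᴬ refl 0 0) (unchanged r₁ headᴬ refl 0 0))
    where
    k : FSet n
    k = row (store κ) queueᴬ (store κ headᴬ 0 0)
    E₁ : Env G k (amb κ₁) (store κ₁)
    E₁ = env (trans (unchanged r₁ 0 refl 0 0) en) (λ x y → trans (unchanged r₁ tableᴬ refl (toℕ x) (toℕ y)) (et x y))
      (proj₁ (fill-set {c = zᴬ} {a = currentᴬ} {i = 0} {e = lit 0} {f = queueᴬ ⟨ scalar headᴬ , zᴱ ⟩} k refl refl en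
        (λ {κ₃} x ez f → refl , trans (cong₂ (store κ₃ queueᴬ) (keep f headᴬ refl 0 0) ez) (keep f queueᴬ refl (store κ headᴬ 0 0) (toℕ x))) r₁))
      (λ _ → refl)
    expanded : Expanded G k d (λ x → toℕ x < n) (queueOf κ) (queueOf κ₂)
    expanded = each-rule {c = xᴬ} {S = tryBody} {κ = κ₁} refl (size′ E₁)
      (λ j κ₃ → Expanded G k d (λ x → toℕ x < j) (queueOf κ) (queueOf κ₃))
      (expanded-start (λ ()) (queue-frame (frame r₁) refl refl refl))
      (λ x ex f r → tryBody-rule (env-reload f refl refl refl E₁) ch ex
        (trans (keep f levelᴬ refl 0 0) (trans (unchanged r₁ levelᴬ refl 0 0) ed)) r) r₂

-- Searching for all chains

-- The unit is not part of the input but is the only idempotent, so the test z z = z writes down the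
-- trivial group.
init : Stmt
init =
  each zᴬ (set queueᴬ (lit 0) zᴱ ((tableᴬ ⟨ zᴱ , zᴱ ⟩) == zᴱ)) ⨟
  set depthᴬ (lit 0) (lit 0) (lit 0) ⨟
  set headᴬ (lit 0) (lit 0) (lit 0) ⨟
  set tailᴬ (lit 0) (lit 0) (lit 1)

-- The number of nodes of a level is fixed before the first is expanded; rows appended meanwhile
-- belong to the next level.
levelBody levels search : Program
levelBody = repeat nodeᴬ (scalar tailᴬ ⊖ scalar headᴬ) ⌜ node ⌝
levels    = repeat levelᴬ (scalar 0) levelBody
search    = ⌜ init ⌝ ⨾ levels

module _ {n : ℕ} (G : FinGroup n) where
  open FinGroup G

  Loaded : Store → Set
  Loaded s = s 0 0 0 ≡ n × (∀ x y → s tableᴬ (toℕ x) (toℕ y) ≡ toℕ (mul x y))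

module _ {n : ℕ} {G : FinGroup n} where

  loaded-frame : ∀ {c κ κ′} → Frame c κ κ′ → writes c 0 ≡ false → writes c tableᴬ ≡ false → Loaded G (store κ) → Loaded G (store κ′)
  loaded-frame f w₀ w₁ (en , et) = trans (keep f 0 w₀ 0 0) en , λ x y → trans (keep f tableᴬ w₁ (toℕ x) (toℕ y)) (et x y)

module _ {n : ℕ} {O : Oracle} {G : FinGroup n} where
  open FinGroup G
  open Group group using (identityˡ)
  open GroupProperties group using (loop)
  open LoopProperties loop using (identityʳ-unique)

  init-rule : ∀ {κ κ′ t} → 1 ≤ n → Loaded G (store κ) → Run O ⌜ init ⌝ κ κ′ t → Level G 0 (store κ′ headᴬ 0 0) (queueOf κ′)
  init-rule {κ} {κ′} 1≤n (en , et) (run-seq {κ′ = κ₁} r₁ (run-seq run-assign (run-seq run-assign run-assign))) =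
    level-start {Q = queueOf κ′} 1≤n filled refl refl
    where
    value : ∀ s (x : Fin n) → s zᴬ 0 0 ≡ toℕ x → s tableᴬ (toℕ x) (toℕ x) ≡ toℕ (mul x x) →
      eval ((tableᴬ ⟨ zᴱ , zᴱ ⟩) == zᴱ) s ≡ single G x
    value s x ez es with x ≟ᶠ unit
    ... | yes refl = cong fromBool (trans (cong₂ _≡ᵇ_ (trans (cong₂ (s tableᴬ) ez ez) (trans es (cong toℕ (identityˡ unit)))) ez) (≡ᵇ-refl (toℕ x)))
    ... | no x≢1 = cong fromBool (trans (cong₂ _≡ᵇ_ (trans (cong₂ (s tableᴬ) ez ez) es) ez)
        (≡ᵇ-false (λ eq → x≢1 (identityʳ-unique x x (toℕ-injective eq)))))
    filled : row (store κ₁) queueᴬ 0 ≗ single G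
    filled = proj₁ (fill-set {c = zᴬ} {a = queueᴬ} {i = 0} {e = lit 0} {f = (tableᴬ ⟨ zᴱ , zᴱ ⟩) == zᴱ} (single G) refl refl en
      (λ {κ₂} x ez f → refl , value (store κ₂) x ez (trans (keep f tableᴬ refl (toℕ x) (toℕ x)) (et x x))) r₁)

  levelBody-rule : ∀ {d κ κ′ t} → 1 ≤ n → Loaded G (store κ) → store κ levelᴬ 0 0 ≡ d →
    Level G d (store κ headᴬ 0 0) (queueOf κ) → Run O levelBody κ κ′ t → Level G (suc d) (store κ′ headᴬ 0 0) (queueOf κ′)
  levelBody-rule {d} {κ} {κ′} 1≤n ld ed lv r = level-step 1≤n lv
    (loop-rule {c = nodeᴬ} {e = scalar tailᴬ ⊖ scalar headᴬ} {P = ⌜ node ⌝} refl κ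
      (λ i κ₁ → Processed G d h₀ i Q₀ (store κ₁ headᴬ 0 0) (queueOf κ₁)) (processed-start) step r)
    where
    h₀ = store κ headᴬ 0 0
    Q₀ : Queue n
    Q₀ = queueOf κ
    open Level lv
    step : ∀ {i κ₁ κ₂ u} → i < Queue.next Q₀ ∸ h₀ → store κ₁ nodeᴬ 0 0 ≡ i → Frame levelBody κ κ₁ → Run O ⌜ node ⌝ κ₁ κ₂ u →
      Processed G d h₀ i Q₀ (store κ₁ headᴬ 0 0) (queueOf κ₁) → Processed G d h₀ (suc i) Q₀ (store κ₂ headᴬ 0 0) (queueOf κ₂)
    step {i} {κ₁} {κ₂} i< _ f r₁ pr = subst (λ h → Processed G d h₀ (suc i) Q₀ h (queueOf κ₂)) (sym (proj₂ noded))
      (processed-step ch lt pr (proj₁ noded))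
      where
      module P = Processed pr
      lt : h₀ + i < Queue.next Q₀
      lt = subst (h₀ + i <_) (m+[n∸m]≡n h≤) (+-monoʳ-< h₀ i<)
      ch : Chain G (row (store κ₁) queueᴬ (store κ₁ headᴬ 0 0)) d
      ch = subst (λ h → Chain G (row (store κ₁) queueᴬ h) d) (sym P.h≡)
        (subst (Chain G (row (store κ₁) queueᴬ (h₀ + i))) (frontier (m≤m+n h₀ i) lt)
          (chain-cong (λ x → sym (P.oldRow lt x)) (chains lt)))
      ld₁ = loaded-frame {G = G} f refl refl ld
      noded = node-rule {d = d} (proj₁ ld₁) (proj₂ ld₁) ch (trans (keep f levelᴬ refl 0 0) ed) r₁

  search-rule : ∀ {κ κ′ t} → 1 ≤ n → Loaded G (store κ) → Run O search κ κ′ t → Level G n (store κ′ headᴬ 0 0) (queueOf κ′)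
  search-rule {κ} {κ′} 1≤n ld (run-seq {κ′ = κ₁} r₁ r₂) = subst (λ d → Level G d (store κ′ headᴬ 0 0) (queueOf κ′)) (proj₁ ld₁)
    (loop-rule {c = levelᴬ} {e = scalar 0} {P = levelBody} refl κ₁
      (λ d κ₂ → Level G d (store κ₂ headᴬ 0 0) (queueOf κ₂)) (init-rule 1≤n ld r₁)
      (λ _ ed f r lv → levelBody-rule 1≤n (loaded-frame {G = G} f refl refl ld₁) ed lv r) r₂)
    where
    ld₁ : Loaded G (store κ₁)
    ld₁ = loaded-frame {G = G} (frame r₁) refl refl ld

-- Running times of the loops over the queue

node-head : ∀ {O κ κ′ t} → Run O ⌜ node ⌝ κ κ′ t → store κ′ headᴬ 0 0 ≡ suc (store κ headᴬ 0 0)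
node-head (run-seq r₁ (run-seq r₂ run-assign)) = cong suc (trans (unchanged r₂ headᴬ refl 0 0) (unchanged r₁ headᴬ refl 0 0))

module _ {O : Oracle} {n : ℕ} (1≤n : 1 ≤ n) where

  private
    C = cost node n

  -- Time is charged to the advance of the head, whatever the queue contains; `Level` bounds the
  -- head afterwards. The 22 is the size 7 of the loop bound plus 15.
  levelBody-halts : ∀ κ → store κ 0 0 0 ≡ n → ∃₂ λ κ′ t → Run O levelBody κ κ′ t ×
    t + store κ headᴬ 0 0 * (C + 15) ≤ store κ′ headᴬ 0 0 * (C + 15) + 22
  levelBody-halts κ en = conclude (loop-total {O} {nodeᴬ} {scalar tailᴬ ⊖ scalar headᴬ} {⌜ node ⌝} refl κ
    (λ i u κ₁ → u ≤ i * C × store κ₁ headᴬ 0 0 ≡ h + i) (z≤n , sym (+-identityʳ h)) step)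
    where
    h = store κ headᴬ 0 0
    B = store κ tailᴬ 0 0 ∸ h
    step : ∀ {i κ₁ u} → i < B → store κ₁ nodeᴬ 0 0 ≡ i → Frame levelBody κ κ₁ → u ≤ i * C × store κ₁ headᴬ 0 0 ≡ h + i →
      ∃₂ λ κ₂ v → Run O ⌜ node ⌝ κ₁ κ₂ v × (u + v ≤ suc i * C × store κ₂ headᴬ 0 0 ≡ h + suc i)
    step {i} {κ₁} {u} _ _ f (u≤ , h≡) =
      let κ₂ , v , r , v≤ = halts {O} {n} 1≤n node refl refl κ₁ (trans (keep f 0 refl 0 0) en)
      in κ₂ , v , r , ≤-trans (+-mono-≤ u≤ v≤) (≤-reflexive (+-comm (i * C) C)) ,
         trans (node-head r) (trans (cong suc h≡) (sym (+-suc h i)))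
    conclude : (∃₂ λ κ′ t → Run O levelBody κ κ′ t × ∃ λ u → (u ≤ B * C × store κ′ headᴬ 0 0 ≡ h + B) × t ≤ u + (7 + B * 15 + 15)) →
      ∃₂ λ κ′ t → Run O levelBody κ κ′ t × t + h * (C + 15) ≤ store κ′ headᴬ 0 0 * (C + 15) + 22
    conclude (κ′ , t , r , u , (u≤ , h≡) , t≤) = κ′ , t , r , (begin
      t + h * (C + 15)                           ≤⟨ +-monoˡ-≤ _ (≤-trans t≤ (+-monoˡ-≤ _ u≤)) ⟩
      B * C + (7 + B * 15 + 15) + h * (C + 15)   ≡⟨ solve 3 (λ b c h → b :* c :+ (con 7 :+ b :* con 15 :+ con 15) :+ h :* (c :+ con 15) := (h :+ b) :* (c :+ con 15) :+ con 22) refl B C h ⟩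
      (h + B) * (C + 15) + 22                    ≡⟨ cong (λ a → a * (C + 15) + 22) h≡ ⟨
      store κ′ headᴬ 0 0 * (C + 15) + 22         ∎)
      where
      open ≤-Reasoning
      open +-*-Solver

  -- Here 37 is the 22 of a level plus the 15 of a loop round, and 18 is the size 3 of the loop
  -- bound plus 15.
  levels-halts : ∀ κ → store κ 0 0 0 ≡ n → ∃₂ λ κ′ t → Run O levels κ κ′ t ×
    t ≤ store κ′ headᴬ 0 0 * (C + 15) + (n * 37 + 18)
  levels-halts κ refl = conclude (loop-total {O} {levelᴬ} {scalar 0} {levelBody} refl κ
    (λ d u κ₁ → u ≤ store κ₁ headᴬ 0 0 * (C + 15) + d * 22) z≤n step)
    where
    step : ∀ {d κ₁ u} → d < n → store κ₁ levelᴬ 0 0 ≡ d → Frame levels κ κ₁ → u ≤ store κ₁ headᴬ 0 0 * (C + 15) + d * 22 →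
      ∃₂ λ κ₂ v → Run O levelBody κ₁ κ₂ v × u + v ≤ store κ₂ headᴬ 0 0 * (C + 15) + suc d * 22
    step {d} {κ₁} {u} _ _ f u≤ = let κ₂ , v , r , v≤ = levelBody-halts κ₁ (keep f 0 refl 0 0) in κ₂ , v , r , (begin
      u + v                                               ≤⟨ +-monoˡ-≤ v u≤ ⟩
      store κ₁ headᴬ 0 0 * (C + 15) + d * 22 + v          ≡⟨ solve 3 (λ h d v → h :+ d :+ v := v :+ h :+ d) refl (store κ₁ headᴬ 0 0 * (C + 15)) (d * 22) v ⟩
      v + store κ₁ headᴬ 0 0 * (C + 15) + d * 22          ≤⟨ +-monoˡ-≤ (d * 22) v≤ ⟩
      store κ₂ headᴬ 0 0 * (C + 15) + 22 + d * 22         ≡⟨ +-assoc (store κ₂ headᴬ 0 0 * (C + 15)) 22 (d * 22) ⟩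
      store κ₂ headᴬ 0 0 * (C + 15) + suc d * 22          ∎)
      where
      open ≤-Reasoning
      open +-*-Solver
    conclude : (∃₂ λ κ′ t → Run O levels κ κ′ t × ∃ λ u → u ≤ store κ′ headᴬ 0 0 * (C + 15) + n * 22 × t ≤ u + (3 + n * 15 + 15)) →
      ∃₂ λ κ′ t → Run O levels κ κ′ t × t ≤ store κ′ headᴬ 0 0 * (C + 15) + (n * 37 + 18)
    conclude (κ′ , t , r , u , u≤ , t≤) = κ′ , t , r , ≤-trans t≤ (≤-trans (+-monoˡ-≤ _ u≤) (≤-reflexive
      (solve 2 (λ a n → a :+ n :* con 22 :+ (con 3 :+ n :* con 15 :+ con 15) := a :+ (n :* con 37 :+ con 18)) refl (store κ′ headᴬ 0 0 * (C + 15)) n)))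
      where open +-*-Solver

  search-halts : ∀ κ → store κ 0 0 0 ≡ n → ∃₂ λ κ′ t → Run O search κ κ′ t ×
    t ≤ cost init n + (store κ′ headᴬ 0 0 * (C + 15) + (n * 37 + 18))
  search-halts κ en =
    let κ₁ , t₁ , r₁ , t₁≤ = halts {O} {n} 1≤n init refl refl κ en
        κ₂ , t₂ , r₂ , t₂≤ = levels-halts κ₁ (trans (unchanged r₁ 0 refl 0 0) en)
    in κ₂ , t₁ + t₂ , run-seq r₁ r₂ , +-mono-≤ t₁≤ t₂≤

  scan-halts : ∀ c e S → wellFormed S ≡ true → writes ⌜ S ⌝ 0 ≡ false → writes ⌜ S ⌝ c ≡ false → (c ≡ᵇ 0) ≡ false → ∀ κ → store κ 0 0 0 ≡ n →
    ∃₂ λ κ′ t → Run O (repeat c e ⌜ S ⌝) κ κ′ t × t ≤ eval e (store κ) * (cost S n + 15) + (size e + 15)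
  scan-halts c e S wf w₀ w c≢0 κ en = conclude (loop-total {O} {c} {e} {⌜ S ⌝} w κ (λ i u _ → u ≤ i * cost S n) z≤n step)
    where
    B = eval e (store κ)
    step : ∀ {i κ₁ u} → i < B → store κ₁ c 0 0 ≡ i → Frame (repeat c e ⌜ S ⌝) κ κ₁ → u ≤ i * cost S n →
      ∃₂ λ κ₂ v → Run O ⌜ S ⌝ κ₁ κ₂ v × u + v ≤ suc i * cost S n
    step {i} {κ₁} _ _ f u≤ with halts {O} {n} 1≤n S wf w₀ κ₁ (trans (keep f 0 writes₀ 0 0) en)
      where
      writes₀ : writes (repeat c e ⌜ S ⌝) 0 ≡ false
      writes₀ rewrite c≢0 | w₀ = refl
    ... | κ₂ , v , r , v≤ = κ₂ , v , r , ≤-trans (+-mono-≤ u≤ v≤) (≤-reflexive (+-comm (i * cost S n) (cost S n)))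
    conclude : (∃₂ λ κ′ t → Run O (repeat c e ⌜ S ⌝) κ κ′ t × ∃ λ u → u ≤ B * cost S n × t ≤ u + (size e + B * 15 + 15)) →
      ∃₂ λ κ′ t → Run O (repeat c e ⌜ S ⌝) κ κ′ t × t ≤ B * (cost S n + 15) + (size e + 15)
    conclude (κ′ , t , r , u , u≤ , t≤) = κ′ , t , r , ≤-trans t≤ (≤-trans (+-monoˡ-≤ _ u≤) (≤-reflexive
      (solve 3 (λ b c e → b :* c :+ (e :+ b :* con 15 :+ con 15) := b :* (c :+ con 15) :+ (e :+ con 15)) refl B (cost S n) (size e))))
      where open +-*-Solver

-- Encodings

-- The search reads its group from `tableᴬ`, so the same program serves G and H after the respective
-- copy.
copy : ℕ → Stmt
copy a = each iᴬ (each zᴬ (set tableᴬ (scalar iᴬ) zᴱ (a ⟨ scalar iᴬ , zᴱ ⟩)))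

fullTest save pickBody : Stmt
fullTest = set okᴬ (lit 0) (lit 0) (lit 1) ⨟ each zᴬ (lower (isZero (queueᴬ ⟨ scalar qᴬ , zᴱ ⟩)))
save     = each zᴬ (set savedᴬ (lit 0) zᴱ (queueᴬ ⟨ scalar qᴬ , zᴱ ⟩)) ⨟
           set savedDepthᴬ (lit 0) (lit 0) (depthᴬ ⟨ scalar qᴬ , lit 0 ⟩)
pickBody = fullTest ⨟ when (scalar okᴬ) save

pick : Program
pick = repeat qᴬ (scalar tailᴬ) ⌜ pickBody ⌝

savedDepth : Config → ℕ
savedDepth κ = store κ savedDepthᴬ 0 0

savedRow : ∀ {n} → Config → FSet n
savedRow κ = row (store κ) savedᴬ 0

module _ {n : ℕ} {O : Oracle} {G : FinGroup n} where
  open FinGroup G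

  copy-rule : ∀ {a κ κ′ t} → writes ⌜ copy a ⌝ a ≡ false → writes ⌜ each zᴬ (set tableᴬ (scalar iᴬ) zᴱ (a ⟨ scalar iᴬ , zᴱ ⟩)) ⌝ a ≡ false →
    store κ 0 0 0 ≡ n → (∀ x y → store κ a (toℕ x) (toℕ y) ≡ toℕ (mul x y)) → Run O ⌜ copy a ⌝ κ κ′ t → Loaded G (store κ′)
  copy-rule {a} {κ} {κ′} w w′ en et r = trans (unchanged r 0 refl 0 0) en , λ x y → copiedRows x (toℕ<n x) y
    where
    inner = each zᴬ (set tableᴬ (scalar iᴬ) zᴱ (a ⟨ scalar iᴬ , zᴱ ⟩))
    I : ℕ → Config → Set
    I j κ₁ = ∀ x → toℕ x < j → ∀ y → store κ₁ tableᴬ (toℕ x) (toℕ y) ≡ toℕ (mul x y)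
    step : ∀ {κ₁ κ₂ u} (x : Fin n) → store κ₁ iᴬ 0 0 ≡ toℕ x → Frame ⌜ copy a ⌝ κ κ₁ → Run O ⌜ inner ⌝ κ₁ κ₂ u → I (toℕ x) κ₁ → I (suc (toℕ x)) κ₂
    step {κ₁} {κ₂} x ei f r₁ ih y y< v = Data.Sum.[ (λ lt → trans (proj₂ filled (λ eq → <⇒≢ lt eq) (toℕ v)) (ih y lt v)) , (λ { refl → proj₁ filled v }) ] (below-suc y<)
      where
      filled : row (store κ₂) tableᴬ (toℕ x) ≗ (λ v → toℕ (mul x v)) × (∀ {k} → k ≢ toℕ x → ∀ l → store κ₂ tableᴬ k l ≡ store κ₁ tableᴬ k l)
      filled = fill-set {c = zᴬ} {a = tableᴬ} {i = toℕ x} {e = scalar iᴬ} {f = a ⟨ scalar iᴬ , zᴱ ⟩} (λ v → toℕ (mul x v)) refl refl (trans (keep f 0 refl 0 0) en)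
        (λ {κ₃} v ez g → trans (keep g iᴬ refl 0 0) ei ,
          trans (cong₂ (store κ₃ a) (trans (keep g iᴬ refl 0 0) ei) ez) (trans (keep g a w′ (toℕ x) (toℕ v)) (trans (keep f a w (toℕ x) (toℕ v)) (et x v)))) r₁
    copiedRows : I n κ′
    copiedRows = each-rule {c = iᴬ} {S = inner} {κ = κ} refl en I (λ x ()) step r

  fullTest-rule : ∀ {κ κ′ t} → store κ 0 0 0 ≡ n → Run O ⌜ fullTest ⌝ κ κ′ t →
    (ok κ′ ≢ 0 → Full G (row (store κ) queueᴬ (store κ qᴬ 0 0))) × (Full G (row (store κ) queueᴬ (store κ qᴬ 0 0)) → ok κ′ ≢ 0)
  fullTest-rule {κ} {κ′} en (run-seq {κ′ = κ₁} run-assign r) = proj₂ ∘ proj₁ lowers , proj₂ lowers (λ ())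
    where
    v : FSet n
    v = row (store κ) queueᴬ (store κ qᴬ 0 0)
    test = isZero (queueᴬ ⟨ scalar qᴬ , zᴱ ⟩)
    value : ∀ {κ₂} (x : Fin n) → store κ₂ zᴬ 0 0 ≡ toℕ x → Frame ⌜ each zᴬ (lower test) ⌝ κ₁ κ₂ → store κ₂ queueᴬ (store κ₂ qᴬ 0 0) (store κ₂ zᴬ 0 0) ≡ v x
    value {κ₂} x ez f = trans (cong₂ (store κ₂ queueᴬ) (keep f qᴬ refl 0 0) ez) (keep f queueᴬ refl (store κ qᴬ 0 0) (toℕ x))
    lowers : Lowers (Full G v) (ok κ₁) (ok κ′)
    lowers = each-lowers {c = zᴬ} {S = lower test} {κ = κ₁} {J = λ x → v ∋ x} refl refl en
      (λ {κ₂} x ez f r₁ → lower-rule {e = test}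
        (λ ne → trans (sym (value x ez f)) (isZero⁻ (store κ₂) (queueᴬ ⟨ scalar qᴬ , zᴱ ⟩) ne))
        (λ v≡0 → isZero⁺ (store κ₂) (queueᴬ ⟨ scalar qᴬ , zᴱ ⟩) (trans (value x ez f) v≡0)) r₁) r

  -- Each full row overwrites the one saved before. The last one stays, and any complete series is
  -- good enough.
  pick-rule : ∀ {κ κ′ t} → store κ 0 0 0 ≡ n →
    (∀ {q} → q < store κ tailᴬ 0 0 → Chain G (row (store κ) queueᴬ q) (store κ depthᴬ q 0)) →
    (∃ λ q → q < store κ tailᴬ 0 0 × Full G (row (store κ) queueᴬ q)) →
    Run O pick κ κ′ t → Chain G (savedRow κ′) (savedDepth κ′) × Full G (savedRow κ′)
  pick-rule {κ} {κ′} en chains (q₀ , q₀< , full₀) r = conclude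
      (loop-rule {c = qᴬ} {e = scalar tailᴬ} {P = ⌜ pickBody ⌝} refl κ I (inj₁ λ ()) step r)
    where
    v : ℕ → FSet n
    v q = row (store κ) queueᴬ q
    I : ℕ → Config → Set
    I j κ₁ = (∀ {q} → q < j → ¬ Full G (v q)) ⊎ (Chain G (savedRow κ₁) (savedDepth κ₁) × Full G (savedRow κ₁))
    same : ∀ {κ₁} → Frame pick κ κ₁ → ∀ q → row (store κ₁) queueᴬ q ≗ v q
    same f q x = keep f queueᴬ refl q (toℕ x)
    conclude : I (store κ tailᴬ 0 0) κ′ → Chain G (savedRow κ′) (savedDepth κ′) × Full G (savedRow κ′)
    conclude (inj₁ none)  = contradiction full₀ (none q₀<)
    conclude (inj₂ saved) = saved
    cong-saved : ∀ {κ₁ κ₂} → (∀ x → savedRow κ₂ x ≡ savedRow κ₁ x) → savedDepth κ₂ ≡ savedDepth κ₁ →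
      Chain G (savedRow κ₁) (savedDepth κ₁) × Full G (savedRow κ₁) → Chain G (savedRow κ₂) (savedDepth κ₂) × Full G (savedRow κ₂)
    cong-saved {κ₁} {κ₂} er ed (ch , full) = subst (Chain G (savedRow κ₂)) (sym ed) (chain-cong (λ x → sym (er x)) ch) , λ x e → full x (trans (sym (er x)) e)
    step : ∀ {j κ₁ κ₂ u} → j < store κ tailᴬ 0 0 → store κ₁ qᴬ 0 0 ≡ j → Frame pick κ κ₁ → Run O ⌜ pickBody ⌝ κ₁ κ₂ u → I j κ₁ → I (suc j) κ₂
    step {j} {κ₁} {κ₃} j< refl f (run-seq {κ′ = κ₂} r₁ (run-else eq run-skip)) = Data.Sum.map
      (λ none {q} q< full → Data.Sum.[ (λ lt → none lt full) ,
         (λ { refl → proj₂ tested (λ x e → full x (trans (sym (same f j x)) e)) eq }) ] (m≤n⇒m<n∨m≡n (≤-pred q<)))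
      (cong-saved {κ₁} {κ₂} (λ x → unchanged r₁ savedᴬ refl 0 (toℕ x)) (unchanged r₁ savedDepthᴬ refl 0 0))
      where tested = fullTest-rule (trans (keep f 0 refl 0 0) en) r₁
    step {j} {κ₁} {κ₄} j< refl f (run-seq {κ′ = κ₂} r₁ (run-then ne (run-seq {κ′ = κ₃} r₂ run-assign))) _ =
      inj₂ (subst (Chain G (savedRow κ₃)) (sym depth≡) (chain-cong (λ x → sym (copied x)) (chains j<)) ,
            λ x e → proj₁ tested ne x (trans (same f j x) (trans (sym (copied x)) e)))
      where
      tested = fullTest-rule (trans (keep f 0 refl 0 0) en) r₁
      copied : savedRow κ₃ ≗ v j
      copied = proj₁ (fill-set {c = zᴬ} {a = savedᴬ} {i = 0} {e = lit 0} {f = queueᴬ ⟨ scalar qᴬ , zᴱ ⟩} (v j) refl refl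
        (trans (unchanged r₁ 0 refl 0 0) (trans (keep f 0 refl 0 0) en))
        (λ {κ₅} x ez g → refl , trans (cong₂ (store κ₅ queueᴬ) (trans (keep g qᴬ refl 0 0) (unchanged r₁ qᴬ refl 0 0)) ez)
          (trans (keep g queueᴬ refl j (toℕ x)) (trans (unchanged r₁ queueᴬ refl j (toℕ x)) (same f j x)))) r₂)
      depth≡ : store κ₃ depthᴬ (store κ₃ qᴬ 0 0) 0 ≡ store κ depthᴬ j 0
      depth≡ = trans (cong (λ q → store κ₃ depthᴬ q 0) (trans (unchanged r₂ qᴬ refl 0 0) (unchanged r₁ qᴬ refl 0 0)))
        (trans (unchanged r₂ depthᴬ refl j 0) (trans (unchanged r₁ depthᴬ refl j 0) (keep f depthᴬ refl j 0)))

-- Grows at the end, as the query tape does, whereas the prescribed encoding conses at the front.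
catBelow : (ℕ → List ℕ) → ℕ → List ℕ
catBelow F zero    = []
catBelow F (suc k) = catBelow F k ++ F k

catBelow-cons : ∀ F k → catBelow F (suc k) ≡ F 0 ++ catBelow (F ∘ suc) k
catBelow-cons F zero    = sym (++-identityʳ (F 0))
catBelow-cons F (suc k) = trans (cong (_++ F (suc k)) (catBelow-cons F k)) (++-assoc (F 0) (catBelow (F ∘ suc) k) (F (suc k)))

catBelow-concat : ∀ F k → catBelow F k ≡ concat (tabulate {n = k} (F ∘ toℕ))
catBelow-concat F zero    = refl
catBelow-concat F (suc k) = trans (catBelow-cons F k) (cong (F 0 ++_) (catBelow-concat (F ∘ suc) k))

concat-singletons : ∀ {k} (f : Fin k → ℕ) → concat (tabulate (λ i → [ f i ])) ≡ tabulate f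
concat-singletons {zero}  f = refl
concat-singletons {suc k} f = cong (f fzero ∷_) (concat-singletons (f ∘ fsuc))

matrix : (ℕ → ℕ → ℕ) → ℕ → ℕ → List ℕ
matrix g l k = catBelow (λ i → catBelow (λ j → [ g i j ]) l) k

matrix-flatten : ∀ {n k l} g (M : Fin k → Fin l → ℕ) → (∀ i j → g (toℕ i) (toℕ j) ≡ M i j) → matrix g l k ≡ flatten {n} M
matrix-flatten {n} {k} {l} g M eq = trans (catBelow-concat _ k) (cong concat (tabulate-cong λ i →
  trans (catBelow-concat _ l) (trans (concat-singletons {l} (λ j → g (toℕ i) (toℕ j))) (tabulate-cong (eq i)))))

-- The emitting loop has n rounds, of which those beyond the length m of the series contribute
-- nothing.
catBelow-truncate : ∀ {F R m} k → (∀ {i} → i ≤ m → F i ≡ R i) → (∀ {i} → m < i → F i ≡ []) → m < k → catBelow F k ≡ catBelow R (suc m)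
catBelow-truncate {F} {R} {m} (suc k) small large (s≤s m≤k) with m≤n⇒m<n∨m≡n m≤k
... | inj₁ m<k = trans (cong (catBelow F k ++_) (large m<k)) (trans (++-identityʳ _) (catBelow-truncate k small large m<k))
... | inj₂ refl = cong₂ _++_ (below-cong k (λ i<k → small (<⇒≤ i<k))) (small ≤-refl)
  where
  below-cong : ∀ j → (∀ {i} → i < j → F i ≡ R i) → catBelow F j ≡ catBelow R j
  below-cong zero    eq = refl
  below-cong (suc j) eq = cong₂ _++_ (below-cong j (eq ∘ m≤n⇒m≤1+n)) (eq ≤-refl)

Emits : Config → Config → List ℕ → Set
Emits κ κ′ xs = tape κ′ ≡ tape κ ++ xs

emits-seq : ∀ κ κ₁ κ₂ {xs ys} → Emits κ κ₁ xs → Emits κ₁ κ₂ ys → Emits κ κ₂ (xs ++ ys)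
emits-seq κ κ₁ κ₂ {xs} {ys} p q = trans q (trans (cong (_++ ys) p) (++-assoc (tape κ) xs ys))

each-emits : ∀ {O n c S κ κ′ t} (F : ℕ → List ℕ) → writes ⌜ S ⌝ c ≡ false → store κ 0 0 0 ≡ n →
  (∀ {κ₁ κ₂ u} (x : Fin n) → store κ₁ c 0 0 ≡ toℕ x → Frame ⌜ each c S ⌝ κ κ₁ → Run O ⌜ S ⌝ κ₁ κ₂ u → Emits κ₁ κ₂ (F (toℕ x))) →
  Run O ⌜ each c S ⌝ κ κ′ t → Emits κ κ′ (catBelow F n)
each-emits {c = c} {S} {κ} F w en body r = each-rule {S = S} {κ = κ} w en (λ j κ₁ → Emits κ κ₁ (catBelow F j)) (sym (++-identityʳ _))
  (λ {κ₁} {κ₂} x ct f r₁ i → emits-seq κ κ₁ κ₂ i (body x ct f r₁)) r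

emitTable : ℕ → Stmt
emitTable a = each iᴬ (each zᴬ (out (a ⟨ scalar iᴬ , zᴱ ⟩)))

emitTable-rule : ∀ {O n a κ κ′ t} → writes ⌜ emitTable a ⌝ a ≡ false → writes ⌜ each zᴬ (out (a ⟨ scalar iᴬ , zᴱ ⟩)) ⌝ a ≡ false →
  store κ 0 0 0 ≡ n → Run O ⌜ emitTable a ⌝ κ κ′ t → Emits κ κ′ (matrix (store κ a) n n)
emitTable-rule {O} {n} {a} {κ} w w′ en = each-emits {S = each zᴬ (out (a ⟨ scalar iᴬ , zᴱ ⟩))} {κ = κ} (λ i → catBelow (λ j → [ store κ a i j ]) n) refl en
  λ {κ₁} x ei f → each-emits {S = out (a ⟨ scalar iᴬ , zᴱ ⟩)} {κ = κ₁} (λ j → [ store κ a (toℕ x) j ]) refl (trans (keep f 0 refl 0 0) en)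
    λ {κ₂} y ez g r → inner κ₂ y (trans (keep g iᴬ refl 0 0) ei) ez
      (trans (keep g a w′ (toℕ x) (toℕ y)) (keep f a w (toℕ x) (toℕ y))) r
  where
  inner : ∀ κ₂ {κ₃ u} {x : Fin n} (y : Fin n) → store κ₂ iᴬ 0 0 ≡ toℕ x → store κ₂ zᴬ 0 0 ≡ toℕ y → store κ₂ a (toℕ x) (toℕ y) ≡ store κ a (toℕ x) (toℕ y) →
    Run O ⌜ out (a ⟨ scalar iᴬ , zᴱ ⟩) ⌝ κ₂ κ₃ u → Emits κ₂ κ₃ [ store κ a (toℕ x) (toℕ y) ]
  inner κ₂ y ei ez eq run-emit = cong (λ v → tape κ₂ ++ [ v ]) (trans (cong₂ (store κ₂ a) ei ez) eq)

-- With truncated subtraction, 1 ∸ (v ∸ (i + 1)) is the bit of v ≤ i + 1, that is, of membership in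
-- the i-th term.
emitRow : ℕ → Expr → Stmt
emitRow a r = each zᴬ (out (lit 1 ⊖ ((a ⟨ r , zᴱ ⟩) ⊖ succ (scalar iᴬ))))

emitRows : Expr → ℕ → Expr → Stmt
emitRows D a r = each iᴬ (when (succ D ⊖ scalar iᴬ) (emitRow a r))

-- The depth and the row are given by expressions that keep their values during the emission, which
-- covers both the saved series and the current row of the queue.
emitRows-rule : ∀ {O n D a r m κ κ′ t} (V : ℕ → ℕ) → store κ 0 0 0 ≡ n → m < n →
  (∀ {κ₁} → Frame ⌜ emitRows D a r ⌝ κ κ₁ → eval D (store κ₁) ≡ m) →
  (∀ {κ₁ κ₂} → Frame ⌜ emitRows D a r ⌝ κ κ₁ → Frame ⌜ emitRow a r ⌝ κ₁ κ₂ → ∀ z → store κ₂ a (eval r (store κ₂)) z ≡ V z) →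
  Run O ⌜ emitRows D a r ⌝ κ κ′ t → Emits κ κ′ (matrix (λ i z → 1 ∸ (V z ∸ suc i)) n (suc m))
emitRows-rule {O} {n} {D} {a} {r} {m} {κ} {κ′} V en m<n depth value run =
  subst (Emits κ κ′) (catBelow-truncate {F} {R} n small large m<n) (each-emits {S = when (succ D ⊖ scalar iᴬ) (emitRow a r)} {κ = κ} F refl en step run)
  where
  R F : ℕ → List ℕ
  R i = catBelow (λ z → [ 1 ∸ (V z ∸ suc i) ]) n
  F i = if i ≤ᵇ m then R i else []
  small : ∀ {i} → i ≤ m → F i ≡ R i
  small {i} i≤m with i ≤ᵇ m in eq
  ... | true  = refl
  ... | false = ⊥-elim (subst T eq (≤⇒≤ᵇ i≤m))
  large : ∀ {i} → m < i → F i ≡ []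
  large {i} m<i with i ≤ᵇ m in eq
  ... | false = refl
  ... | true  = contradiction (≤ᵇ⇒≤ i m (subst T (sym eq) _)) (<⇒≱ m<i)
  inner : ∀ κ₂ {κ₃ u i} (y : Fin n) → store κ₂ iᴬ 0 0 ≡ i → store κ₂ zᴬ 0 0 ≡ toℕ y → (∀ z → store κ₂ a (eval r (store κ₂)) z ≡ V z) →
    Run O ⌜ out (lit 1 ⊖ ((a ⟨ r , zᴱ ⟩) ⊖ succ (scalar iᴬ))) ⌝ κ₂ κ₃ u → Emits κ₂ κ₃ [ 1 ∸ (V (toℕ y) ∸ suc i) ]
  inner κ₂ y refl ez ev run-emit = cong (λ v → tape κ₂ ++ [ 1 ∸ (v ∸ suc (store κ₂ iᴬ 0 0)) ])
    (trans (cong (store κ₂ a (eval r (store κ₂))) ez) (ev (toℕ y)))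
  step : ∀ {κ₁ κ₂ u} (x : Fin n) → store κ₁ iᴬ 0 0 ≡ toℕ x → Frame ⌜ emitRows D a r ⌝ κ κ₁ →
    Run O ⌜ when (succ D ⊖ scalar iᴬ) (emitRow a r) ⌝ κ₁ κ₂ u → Emits κ₁ κ₂ (F (toℕ x))
  step {κ₁} {κ₂} x ei f (run-then ne run₁) = subst (Emits κ₁ κ₂) (sym (small x≤m))
    (each-emits {S = out (lit 1 ⊖ ((a ⟨ r , zᴱ ⟩) ⊖ succ (scalar iᴬ)))} {κ = κ₁} (λ z → [ 1 ∸ (V z ∸ suc (toℕ x)) ]) refl (trans (keep f 0 refl 0 0) en)
      (λ {κ₃} y ez g → inner κ₃ y (trans (keep g iᴬ refl 0 0) ei) ez (value f g)) run₁)
    where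
    x≤m : toℕ x ≤ m
    x≤m = ≮⇒≥ λ m<x → ne (trans (cong₂ (λ p q → suc p ∸ q) (depth f) ei) (m≤n⇒m∸n≡0 m<x))
  step {κ₁} x ei f (run-else eq run-skip) = trans (sym (++-identityʳ (tape κ₁))) (cong (tape κ₁ ++_) (sym (large
    (m∸n≡0⇒m≤n (trans (sym (cong₂ (λ p q → suc p ∸ q) (depth f) ei)) eq)))))

bit-eq : ∀ v i → 1 ∸ (v ∸ i) ≡ fromBool (v ≤ᵇ i)
bit-eq zero    i       = cong (1 ∸_) (0∸n≡0 i)
bit-eq (suc v) zero    = 0∸n≡0 v
bit-eq (suc v) (suc i) = trans (bit-eq v i) (cong fromBool (sym (≤ᵇ-suc v i)))
  where
  ≤ᵇ-suc : ∀ v i → (suc v ≤ᵇ suc i) ≡ (v ≤ᵇ i)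
  ≤ᵇ-suc zero    i = refl
  ≤ᵇ-suc (suc v) i = refl

series-encoding : ∀ {n} {G : FinGroup n} {v m} (ch : Chain G v m) (full : Full G v) {V : ℕ → ℕ} → (∀ x → V (toℕ x) ≡ v x) →
  m ∷ matrix (λ i z → 1 ∸ (V z ∸ suc i)) n (suc m) ≡ encodeSeries (compositionSeries ch full)
series-encoding {n} {G} {v} {m} ch full {V} eq = cong (m ∷_) (matrix-flatten {n} (λ i z → 1 ∸ (V z ∸ suc i)) _ λ i x →
  trans (cong (λ a → 1 ∸ (a ∸ suc (toℕ i))) (eq x)) (trans (bit-eq (v x) (suc (toℕ i)))
    (cong fromBool (sym (lookup∘tabulate (λ x → v x ≤ᵇ suc (toℕ i)) x)))))

-- Queries

emitSeries : Expr → ℕ → Expr → Stmt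
emitSeries D a r = out D ⨟ emitRows D a r

-- The test for fullness precedes each query, since the oracle is trusted only on encodings of two
-- composition series.
emitQuery queryBody : Stmt
emitQuery =
  out (scalar 0) ⨟ emitTable 1 ⨟ emitTable 2 ⨟
  emitSeries (scalar savedDepthᴬ) savedᴬ (lit 0) ⨟
  emitSeries (depthᴬ ⟨ scalar qᴬ , lit 0 ⟩) queueᴬ (scalar qᴬ)
queryBody = fullTest ⨟ when (scalar okᴬ)
  (emitQuery ⨟ query answerᴬ ⨟ when (scalar answerᴬ) (set 3 (lit 0) (lit 0) (lit 1)))

queries : Program
queries = repeat qᴬ (scalar tailᴬ) ⌜ queryBody ⌝

fromBool≢0 : ∀ {b} → fromBool b ≢ 0 → b ≡ true
fromBool≢0 {true}  _  = refl
fromBool≢0 {false} ne = contradiction refl ne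

module _ {n : ℕ} {O : Oracle} {G H : FinGroup n} where

  Holds : ℕ → FinGroup n → Store → Set
  Holds a K s = ∀ x y → s a (toℕ x) (toℕ y) ≡ toℕ (FinGroup.mul K x y)

  emitQuery-rule : ∀ {v w m m′ κ κ′ t} (cv : Chain G v m) (fv : Full G v) (cw : Chain H w m′) (fw : Full H w) →
    store κ 0 0 0 ≡ n → Holds 1 G (store κ) → Holds 2 H (store κ) →
    row (store κ) savedᴬ 0 ≗ v → store κ savedDepthᴬ 0 0 ≡ m →
    row (store κ) queueᴬ (store κ qᴬ 0 0) ≗ w → store κ depthᴬ (store κ qᴬ 0 0) 0 ≡ m′ →
    Run O ⌜ emitQuery ⌝ κ κ′ t → Emits κ κ′ (encodeQuery (compositionSeries cv fv) (compositionSeries cw fw))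
  emitQuery-rule {v} {w} {m} {m′} {κ} {κ′} cv fv cw fw en hG hH ev em ew em′
    (run-seq r₁@run-emit (run-seq {κ′ = κ₂} r₂ (run-seq {κ′ = κ₃} r₃ (run-seq {κ′ = κ₅} (run-seq {κ′ = κ₄} run-emit r₅) (run-seq {κ′ = κ₆} run-emit r₇))))) =
    emits-seq κ κ₁ κ′ {[ n ]} (cong (λ a → tape κ ++ [ a ]) en)
      (emits-seq κ₁ κ₂ κ′ (subst (Emits κ₁ κ₂) (matrix-flatten {n} (store κ 1) _ hG) (emitTable-rule {a = 1} {κ = κ₁} refl refl en r₂))
      (emits-seq κ₂ κ₃ κ′ (subst (Emits κ₂ κ₃) (matrix-flatten {n} (store κ₂ 2) _ (λ x y → trans (unchanged r₂ 2 refl (toℕ x) (toℕ y)) (hH x y)))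
                             (emitTable-rule {a = 2} {κ = κ₂} refl refl en₂ r₃))
      (emits-seq κ₃ κ₅ κ′
        (subst (Emits κ₃ κ₅) (series-encoding cv fv {V} ev)
          (emits-seq κ₃ κ₄ κ₅ {[ m ]} (cong (λ a → tape κ₃ ++ [ a ]) savedDepth₃) saved₄))
        (subst (Emits κ₅ κ′) (series-encoding cw fw {W} ew)
          (emits-seq κ₅ κ₆ κ′ {[ m′ ]} (cong (λ a → tape κ₅ ++ [ a ]) depth₅) current₆)))))
    where
    κ₁ = store κ ∥ (tape κ ++ [ store κ 0 0 0 ])
    V W : ℕ → ℕ
    V z = store κ savedᴬ 0 z
    W z = store κ queueᴬ (store κ qᴬ 0 0) z
    en₂ : store κ₂ 0 0 0 ≡ n
    en₂ = trans (unchanged r₂ 0 refl 0 0) en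
    en₃ : store κ₃ 0 0 0 ≡ n
    en₃ = trans (unchanged r₃ 0 refl 0 0) en₂
    en₅ : store κ₅ 0 0 0 ≡ n
    en₅ = trans (unchanged r₅ 0 refl 0 0) en₃
    savedDepth₃ : store κ₃ savedDepthᴬ 0 0 ≡ m
    savedDepth₃ = trans (unchanged r₃ savedDepthᴬ refl 0 0) (trans (unchanged r₂ savedDepthᴬ refl 0 0) em)
    saved₃ : ∀ z → store κ₃ savedᴬ 0 z ≡ V z
    saved₃ z = trans (unchanged r₃ savedᴬ refl 0 z) (unchanged r₂ savedᴬ refl 0 z)
    saved₄ : Emits κ₄ κ₅ (matrix (λ i z → 1 ∸ (V z ∸ suc i)) n (suc m))
    saved₄ = emitRows-rule {D = scalar savedDepthᴬ} {a = savedᴬ} {r = lit 0} {κ = κ₄} V en₃ (Chain.length< cv)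
      (λ f → trans (keep f savedDepthᴬ refl 0 0) savedDepth₃)
      (λ f g z → trans (keep g savedᴬ refl 0 z) (trans (keep f savedᴬ refl 0 z) (saved₃ z))) r₅
    q₅ : store κ₅ qᴬ 0 0 ≡ store κ qᴬ 0 0
    q₅ = trans (unchanged r₅ qᴬ refl 0 0) (trans (unchanged r₃ qᴬ refl 0 0) (unchanged r₂ qᴬ refl 0 0))
    depthAt : ∀ q → store κ₅ depthᴬ q 0 ≡ store κ depthᴬ q 0
    depthAt q = trans (unchanged r₅ depthᴬ refl q 0) (trans (unchanged r₃ depthᴬ refl q 0) (unchanged r₂ depthᴬ refl q 0))
    depth₅ : store κ₅ depthᴬ (store κ₅ qᴬ 0 0) 0 ≡ m′
    depth₅ = trans (cong (λ q → store κ₅ depthᴬ q 0) q₅) (trans (depthAt _) em′)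
    queue₅ : ∀ q z → store κ₅ queueᴬ q z ≡ store κ queueᴬ q z
    queue₅ q z = trans (unchanged r₅ queueᴬ refl q z) (trans (unchanged r₃ queueᴬ refl q z) (unchanged r₂ queueᴬ refl q z))
    current₆ : Emits κ₆ κ′ (matrix (λ i z → 1 ∸ (W z ∸ suc i)) n (suc m′))
    current₆ = emitRows-rule {D = depthᴬ ⟨ scalar qᴬ , lit 0 ⟩} {a = queueᴬ} {r = scalar qᴬ} {κ = κ₆} W en₅ (Chain.length< cw)
      (λ {κ₇} f → trans (cong (λ q → store κ₇ depthᴬ q 0) (keep f qᴬ refl 0 0)) (trans (keep f depthᴬ refl _ 0) depth₅))
      (λ {κ₇} {κ₈} f g z → trans (cong (λ q → store κ₈ queueᴬ q z) (trans (keep g qᴬ refl 0 0) (trans (keep f qᴬ refl 0 0) q₅)))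
        (trans (keep g queueᴬ refl _ z) (trans (keep f queueᴬ refl _ z) (queue₅ _ z)))) r₇

  module _ (decides : DecidesSeriesIsomorphism O G H) {κ : Config} (en : store κ 0 0 0 ≡ n)
    (hG : Holds 1 G (store κ)) (hH : Holds 2 H (store κ))
    {v : FSet n} {m : ℕ} (cv : Chain G v m) (fv : Full G v) (ev : row (store κ) savedᴬ 0 ≗ v) (em : store κ savedDepthᴬ 0 0 ≡ m)
    (chains : ∀ {q} → q < store κ tailᴬ 0 0 → Chain H (row (store κ) queueᴬ q) (store κ depthᴬ q 0)) where

    Matches : ∀ {q} → q < store κ tailᴬ 0 0 → Set
    Matches {q} q< = Σ (Full H (row (store κ) queueᴬ q)) λ fw → SeriesIsomorphic G H (compositionSeries cv fv) (compositionSeries (chains q<) fw)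

    private
      accept : Config → ℕ
      accept κ₁ = store κ₁ 3 0 0

      -- The tape is empty at the start of each round because `ask` erases it, so the submitted
      -- string is exactly what `emitQuery` wrote.
      I : ℕ → Config → Set
      I j κ₁ = tape κ₁ ≡ [] × (accept κ₁ ≡ 1 → Isomorphic G H) × (∀ {q} (q< : q < store κ tailᴬ 0 0) → q < j → Matches q< → accept κ₁ ≡ 1)

      step : ∀ {j κ₁ κ₂ u} → j < store κ tailᴬ 0 0 → store κ₁ qᴬ 0 0 ≡ j → Frame queries κ κ₁ → Run O ⌜ queryBody ⌝ κ₁ κ₂ u → I j κ₁ → I (suc j) κ₂
      step {j} {κ₁} j< refl f (run-seq {κ′ = κ₂} r₁ (run-else eq run-skip)) (et , sound , complete) =
        trans (silent-tape refl r₁) et , sound ∘ trans (sym same) ,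
        λ {q} q< q<1+j match → trans same (Data.Sum.[ (λ lt → complete q< lt match) ,
          (λ { refl → contradiction eq (proj₂ tested (λ x e → proj₁ match x (trans (sym (keep f queueᴬ refl j (toℕ x))) e))) }) ] (m≤n⇒m<n∨m≡n (≤-pred q<1+j)))
        where
        tested = fullTest-rule {G = H} (trans (keep f 0 refl 0 0) en) r₁
        same : accept κ₂ ≡ accept κ₁
        same = unchanged r₁ 3 refl 0 0
      step {j} {κ₁} {κ₄} j< refl f (run-seq {κ′ = κ₂} r₁ (run-then ne (run-seq r₂ (run-seq (run-ask {s = s₃} {q = string}) r₄)))) (et , sound , complete) =
        finish r₄
        where
        tested = fullTest-rule {G = H} (trans (keep f 0 refl 0 0) en) r₁
        at₂ : ∀ b → writes queries b ≡ false → writes ⌜ fullTest ⌝ b ≡ false → ∀ k l → store κ₂ b k l ≡ store κ b k l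
        at₂ b w w′ k l = trans (unchanged r₁ b w′ k l) (keep f b w k l)
        q₂ : store κ₂ qᴬ 0 0 ≡ j
        q₂ = unchanged r₁ qᴬ refl 0 0
        emitted : (fw : Full H (row (store κ) queueᴬ j)) (j<′ : j < store κ tailᴬ 0 0) →
          string ≡ encodeQuery (compositionSeries cv fv) (compositionSeries (chains j<′) fw)
        emitted fw j<′ = trans (emitQuery-rule {κ = κ₂} {κ′ = s₃ ∥ string} cv fv (chains j<′) fw (trans (at₂ 0 refl refl 0 0) en)
          (λ x y → trans (at₂ 1 refl refl (toℕ x) (toℕ y)) (hG x y)) (λ x y → trans (at₂ 2 refl refl (toℕ x) (toℕ y)) (hH x y))
          (λ x → trans (at₂ savedᴬ refl refl 0 (toℕ x)) (ev x)) (trans (at₂ savedDepthᴬ refl refl 0 0) em)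
          (λ x → trans (cong (λ q → store κ₂ queueᴬ q (toℕ x)) q₂) (at₂ queueᴬ refl refl j (toℕ x)))
          (trans (cong (λ q → store κ₂ depthᴬ q 0) q₂) (at₂ depthᴬ refl refl j 0)) r₂)
          (cong (_++ encodeQuery (compositionSeries cv fv) (compositionSeries (chains j<′) fw)) (trans (silent-tape refl r₁) et))
        full : Full H (row (store κ) queueᴬ j)
        full x e = proj₁ tested ne x (trans (keep f queueᴬ refl j (toℕ x)) e)
        same : accept (s₃ ∥ string) ≡ accept κ₁
        same = trans (unchanged r₂ 3 refl 0 0) (unchanged r₁ 3 refl 0 0)
        finish : ∀ {u} → Run O ⌜ when (scalar answerᴬ) (set 3 (lit 0) (lit 0) (lit 1)) ⌝ ((s₃ [ answerᴬ , 0 , 0 ≔ fromBool (O string) ]) ∥ []) κ₄ u → I (suc j) κ₄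
        finish (run-then ne′ run-assign) = refl ,
          (λ _ → let _ , φ , iso , _ = Equivalence.to (decides (compositionSeries cv fv) (compositionSeries (chains j<) full))
                                         (subst (λ a → O a ≡ true) (emitted full j<) (fromBool≢0 ne′)) in φ , iso) ,
          λ _ _ _ → refl
        finish (run-else eq′ run-skip) = refl , sound ∘ trans (sym same) ,
          λ {q} q< q<1+j match → trans same (Data.Sum.[ (λ lt → complete q< lt match) ,
            (λ { refl → contradiction (trans (sym (cong fromBool (trans (cong O (emitted (proj₁ match) q<))
               (Equivalence.from (decides (compositionSeries cv fv) (compositionSeries (chains q<) (proj₁ match))) (proj₂ match))))) eq′) λ () }) ]
            (m≤n⇒m<n∨m≡n (≤-pred q<1+j)))

    queries-rule : ∀ {κ′ t} → tape κ ≡ [] → store κ 3 0 0 ≡ 0 → Run O queries κ κ′ t →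
      (store κ′ 3 0 0 ≡ 1 → Isomorphic G H) × (∀ {q} (q< : q < store κ tailᴬ 0 0) → Matches q< → store κ′ 3 0 0 ≡ 1)
    queries-rule {κ′} et e₀ r = let _ , sound , complete = result in sound , λ q< → complete q< q<
      where
      result : I (store κ tailᴬ 0 0) κ′
      result = loop-rule {c = qᴬ} {e = scalar tailᴬ} {P = ⌜ queryBody ⌝} refl κ I
        (et , (λ e₁ → contradiction (trans (sym e₀) e₁) λ ()) , λ _ ()) step r

-- The algorithm and its running time

algorithm : Program
algorithm = ⌜ copy 1 ⌝ ⨾ search ⨾ pick ⨾ ⌜ copy 2 ⌝ ⨾ search ⨾ queries

-- Never executed: its cost is a common upper bound for the costs of its components.
pieces : Stmt
pieces = copy 1 ⨟ copy 2 ⨟ init ⨟ node ⨟ pickBody ⨟ queryBody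

-- The power n^(270 (C + 1)) absorbs the constant factor 270 (C + 1), where 270 comes from
-- `time-bound`. The next summand is the degree of the cost per row plus 1 for the number of levels,
-- and the last 1 is the exponent in the bound for one level.
coefficient degree exponent : ℕ
coefficient = proj₁ (cost-polynomial pieces)
degree      = proj₁ (proj₂ (cost-polynomial pieces))
exponent    = 270 * suc coefficient + suc degree + 1

tableEntry-toℕ : ∀ {n} (G : FinGroup n) x y → tableEntry G (toℕ x) (toℕ y) ≡ toℕ (FinGroup.mul G x y)
tableEntry-toℕ {n} G x y with toℕ x <? n | toℕ y <? n
... | yes x< | yes y< = cong₂ (λ a b → toℕ (FinGroup.mul G a b)) (fromℕ<-toℕ x x<) (fromℕ<-toℕ y y<)
... | yes _  | no y≮  = contradiction (toℕ<n y) y≮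
... | no x≮  | _      = contradiction (toℕ<n x) x≮

trunc-id : ∀ {n} {G : FinGroup n} {w m} → Chain G w m → trunc w m ≗ w
trunc-id {w = w} {m} ch x = trunc-≤ w m (Chain.bound ch x)

found-full : ∀ {n} {G : FinGroup n} {h Q} → Level G n h Q → ∀ {w m} → Chain G w m → Full G w →
  ∃ λ q → q < Queue.next Q × Queue.rows Q q ≗ w × Queue.depths Q q ≡ m
found-full lv {w} {m} ch full =
  let q , q< , eq , dq , _ = Level.complete lv ch full ≤-refl (<⇒≤ (Chain.length< ch))
  in q , q< , (λ x → trans (eq x) (trunc-id ch x)) , dq

-- The six summands are the running times of the six parts of the algorithm.
time-bound : ∀ {n X M T T′ t₁ t₂ t₃ t₄ t₅ t₆} → 1 ≤ n → 1 ≤ M → T ≤ suc n * M → T′ ≤ suc n * M →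
  t₁ ≤ X → t₂ ≤ X + (T * (X + 15) + (n * 37 + 18)) → t₃ ≤ T * (X + 15) + 18 →
  t₄ ≤ X → t₅ ≤ X + (T′ * (X + 15) + (n * 37 + 18)) → t₆ ≤ T′ * (X + 15) + 18 →
  t₁ + (t₂ + (t₃ + (t₄ + (t₅ + t₆)))) ≤ 270 * (n * suc X * M)
time-bound {n} {X} {M} {T} {T′} {t₁} {t₂} {t₃} {t₄} {t₅} {t₆} 1≤n 1≤M T≤ T′≤ p₁ p₂ p₃ p₄ p₅ p₆ = begin
  t₁ + (t₂ + (t₃ + (t₄ + (t₅ + t₆))))
    ≤⟨ +-mono-≤ p₁ (+-mono-≤ p₂ (+-mono-≤ p₃ (+-mono-≤ p₄ (+-mono-≤ p₅ p₆)))) ⟩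
  X + (X + (T * (X + 15) + (n * 37 + 18)) + (T * (X + 15) + 18 + (X + (X + (T′ * (X + 15) + (n * 37 + 18)) + (T′ * (X + 15) + 18)))))
    ≡⟨ solve 4 (λ x n u v → x :+ (x :+ (u :+ (n :* con 37 :+ con 18)) :+ (u :+ con 18 :+ (x :+ (x :+ (v :+ (n :* con 37 :+ con 18)) :+ (v :+ con 18)))))
         := con 4 :* x :+ con 74 :* n :+ con 72 :+ con 2 :* u :+ con 2 :* v) refl X n (T * (X + 15)) (T′ * (X + 15)) ⟩
  4 * X + 74 * n + 72 + 2 * (T * (X + 15)) + 2 * (T′ * (X + 15))
    ≤⟨ +-mono-≤ (+-mono-≤ (+-mono-≤ (+-mono-≤ (*-monoʳ-≤ 4 X≤W) (*-monoʳ-≤ 74 n≤W)) (*-monoʳ-≤ 72 1≤W)) (*-monoʳ-≤ 2 (scan≤ T≤))) (*-monoʳ-≤ 2 (scan≤ T′≤)) ⟩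
  4 * W + 74 * W + 72 * W + 2 * (30 * W) + 2 * (30 * W)
    ≡⟨ solve 1 (λ w → con 4 :* w :+ con 74 :* w :+ con 72 :* w :+ con 2 :* (con 30 :* w) :+ con 2 :* (con 30 :* w) := con 270 :* w) refl W ⟩
  270 * W ∎
  where
  open ≤-Reasoning
  open +-*-Solver
  W = n * suc X * M
  n≤W : n ≤ W
  n≤W = subst (_≤ W) (trans (*-identityʳ (n * 1)) (*-identityʳ n)) (*-mono-≤ (*-monoʳ-≤ n (s≤s (z≤n {X}))) 1≤M)
  1≤W : 1 ≤ W
  1≤W = ≤-trans 1≤n n≤W
  X≤W : X ≤ W
  X≤W = subst (_≤ W) (trans (*-identityʳ (1 * X)) (*-identityˡ X)) (*-mono-≤ (*-mono-≤ 1≤n (n≤1+n X)) 1≤M)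
  -- The factor 30 is 2 from n + 1 ≤ 2 n times 15 from X + 15 ≤ 15 (X + 1).
  scan≤ : ∀ {T} → T ≤ suc n * M → T * (X + 15) ≤ 30 * W
  scan≤ {T} T≤ = begin
    T * (X + 15)                          ≤⟨ *-mono-≤ T≤ (+-monoˡ-≤ 15 (m≤n*m X 15)) ⟩
    suc n * M * (15 * X + 15)             ≤⟨ *-monoˡ-≤ (15 * X + 15) (*-monoˡ-≤ M (+-monoˡ-≤ n 1≤n)) ⟩
    (n + n) * M * (15 * X + 15)           ≡⟨ solve 3 (λ n m x → (n :+ n) :* m :* (con 15 :* x :+ con 15) := con 30 :* (n :* (con 1 :+ x) :* m)) refl n M X ⟩
    30 * W                                ∎

module _ (n : ℕ) (G H : FinGroup n) (O : Oracle) where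

  copied : ∀ {κ₁ t₁} → Run O ⌜ copy 1 ⌝ (input G H) κ₁ t₁ → Loaded G (store κ₁)
  copied r₁ = copy-rule {G = G} {a = 1} refl refl refl (tableEntry-toℕ G) r₁

  copied′ : ∀ {κ₁ κ₂ κ₃ κ₄ t₁ t₂ t₃ t₄} → Run O ⌜ copy 1 ⌝ (input G H) κ₁ t₁ → Run O search κ₁ κ₂ t₂ → Run O pick κ₂ κ₃ t₃ →
    Run O ⌜ copy 2 ⌝ κ₃ κ₄ t₄ → Loaded H (store κ₄)
  copied′ r₁ r₂ r₃ r₄ = copy-rule {G = H} {a = 2} refl refl
    (trans (unchanged r₃ 0 refl 0 0) (trans (unchanged r₂ 0 refl 0 0) (unchanged r₁ 0 refl 0 0)))
    (λ x y → trans (unchanged r₃ 2 refl (toℕ x) (toℕ y)) (trans (unchanged r₂ 2 refl (toℕ x) (toℕ y))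
      (trans (unchanged r₁ 2 refl (toℕ x) (toℕ y)) (tableEntry-toℕ H x y)))) r₄

  -- An isomorphism carries the saved series to a full chain of H, which the second search has
  -- listed with the same code, so one of the queries is answered positively. Conversely, a positive
  -- answer comes with an isomorphism of the groups.
  correct : DecidesSeriesIsomorphism O G H → 1 ≤ n → ∀ {κ₁ κ₂ κ₃ κ₄ κ₅ κ₆ t₁ t₂ t₃ t₄ t₅ t₆} →
    Run O ⌜ copy 1 ⌝ (input G H) κ₁ t₁ → Run O search κ₁ κ₂ t₂ → Run O pick κ₂ κ₃ t₃ →
    Run O ⌜ copy 2 ⌝ κ₃ κ₄ t₄ → Run O search κ₄ κ₅ t₅ → Run O queries κ₅ κ₆ t₆ → Accepting κ₆ ⇔ Isomorphic G H
  correct decides 1≤n {κ₁} {κ₂} {κ₃} {κ₄} {κ₅} {κ₆} r₁ r₂ r₃ r₄ r₅ r₆ = mk⇔ (proj₁ result) complete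
    where
    levelG : Level G n (store κ₂ headᴬ 0 0) (queueOf κ₂)
    levelG = search-rule 1≤n (copied r₁) r₂
    levelH : Level H n (store κ₅ headᴬ 0 0) (queueOf κ₅)
    levelH = search-rule 1≤n (copied′ r₁ r₂ r₃ r₄) r₅
    fullG : ∃ λ q → q < store κ₂ tailᴬ 0 0 × Full G (row (store κ₂) queueᴬ q)
    fullG = let w , m , ch , full = full-chain-exists G
                q , q< , eq , _ = found-full levelG ch full
            in q , q< , λ x e → full x (trans (sym (eq x)) e)
    picked : Chain G (savedRow κ₃) (savedDepth κ₃) × Full G (savedRow κ₃)
    picked = pick-rule (trans (unchanged r₂ 0 refl 0 0) (unchanged r₁ 0 refl 0 0)) (Level.chains levelG) fullG r₃
    v : FSet n
    v = savedRow κ₃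
    back₅ : ∀ b → writes search b ≡ false → writes ⌜ copy 2 ⌝ b ≡ false → ∀ k l → store κ₅ b k l ≡ store κ₃ b k l
    back₅ b w w′ k l = trans (unchanged r₅ b w k l) (unchanged r₄ b w′ k l)
    back₀ : ∀ b → writes search b ≡ false → writes ⌜ copy 2 ⌝ b ≡ false → writes pick b ≡ false → writes ⌜ copy 1 ⌝ b ≡ false →
      ∀ k l → store κ₅ b k l ≡ store (input G H) b k l
    back₀ b w w′ w″ w‴ k l = trans (back₅ b w w′ k l) (trans (unchanged r₃ b w″ k l) (trans (unchanged r₂ b w k l) (unchanged r₁ b w‴ k l)))
    result : (store κ₆ 3 0 0 ≡ 1 → Isomorphic G H) ×
      (∀ {q} (q< : q < store κ₅ tailᴬ 0 0) → Σ (Full H (row (store κ₅) queueᴬ q)) (λ fw →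
        SeriesIsomorphic G H (compositionSeries (proj₁ picked) (proj₂ picked)) (compositionSeries (Level.chains levelH q<) fw)) → store κ₆ 3 0 0 ≡ 1)
    result = queries-rule decides {κ = κ₅} (back₀ 0 refl refl refl refl 0 0)
      (λ x y → trans (back₀ 1 refl refl refl refl (toℕ x) (toℕ y)) (tableEntry-toℕ G x y))
      (λ x y → trans (back₀ 2 refl refl refl refl (toℕ x) (toℕ y)) (tableEntry-toℕ H x y))
      (proj₁ picked) (proj₂ picked) (λ x → back₅ savedᴬ refl refl 0 (toℕ x)) (back₅ savedDepthᴬ refl refl 0 0)
      (Level.chains levelH)
      (trans (silent-tape refl r₅) (trans (silent-tape refl r₄) (trans (silent-tape refl r₃) (trans (silent-tape refl r₂) (silent-tape refl r₁)))))
      (back₀ 3 refl refl refl refl 0 0) r₆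
    complete : Isomorphic G H → store κ₆ 3 0 0 ≡ 1
    complete (φ , iso) =
      let full′ : Full H (v ∘ preimage {G = G} {H} iso)
          full′ = λ x → proj₂ picked (preimage {G = G} {H} iso x)
          q , q< , eq , dq = found-full levelH (chain-transport iso (proj₁ picked)) full′
          fw = λ x e → full′ x (trans (sym (eq x)) e)
      in proj₂ result q< (fw , series-isomorphic iso (proj₁ picked) (proj₂ picked) (Level.chains levelH q<) fw (sym dq) eq)

  timed : 1 ≤ n → ∀ {κ₁ κ₂ κ₃ κ₄ κ₅ t₁ t₂ t₃ t₄ t₅ t₆} →
    Run O ⌜ copy 1 ⌝ (input G H) κ₁ t₁ → Run O search κ₁ κ₂ t₂ → Run O pick κ₂ κ₃ t₃ →
    Run O ⌜ copy 2 ⌝ κ₃ κ₄ t₄ → Run O search κ₄ κ₅ t₅ →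
    t₁ ≤ cost (copy 1) n → t₂ ≤ cost init n + (store κ₂ headᴬ 0 0 * (cost node n + 15) + (n * 37 + 18)) →
    t₃ ≤ store κ₂ tailᴬ 0 0 * (cost pickBody n + 15) + 18 →
    t₄ ≤ cost (copy 2) n → t₅ ≤ cost init n + (store κ₅ headᴬ 0 0 * (cost node n + 15) + (n * 37 + 18)) →
    t₆ ≤ store κ₅ tailᴬ 0 0 * (cost queryBody n + 15) + 18 →
    ∀ p → IsSmallestPrimeDivisor p n → WithinBound p n exponent (t₁ + (t₂ + (t₃ + (t₄ + (t₅ + t₆)))))
  timed 1≤n {κ₁} {κ₂} {κ₃} {κ₄} {κ₅} r₁ r₂ r₃ r₄ r₅ p₁ p₂ p₃ p₄ p₅ p₆ p sp =
    within-bound-scale {p} {n} {270 * suc (coefficient) + suc (degree)} {1} {M}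
      (≤-trans (time-bound 1≤n 1≤M T≤ T′≤ (≤-trans p₁ c₁) (≤-trans p₂ (+-mono-≤ c₃ (+-monoˡ-≤ _ (*-mono-≤ (Level.h≤ levelG) (+-monoˡ-≤ 15 c₄)))))
          (≤-trans p₃ (+-monoˡ-≤ 18 (*-monoʳ-≤ (store κ₂ tailᴬ 0 0) (+-monoˡ-≤ 15 c₅)))) (≤-trans p₄ c₂)
          (≤-trans p₅ (+-mono-≤ c₃ (+-monoˡ-≤ _ (*-mono-≤ (Level.h≤ levelH) (+-monoˡ-≤ 15 c₄)))))
          (≤-trans p₆ (+-monoˡ-≤ 18 (*-monoʳ-≤ (store κ₅ tailᴬ 0 0) (+-monoˡ-≤ 15 c₆)))))
        (poly-bound {coefficient} {degree} (proj₂ (proj₂ (cost-polynomial pieces)) n)))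
      (within-bound-⊔ {p} {n} {1} {MG ⊔ MH} {1} (within-bound-⊔ {p} {n} {1} {MG} {MH} (proj₁ (proj₂ totalG)) (proj₁ (proj₂ totalH)))
        (λ a b _ _ → ≤-trans (≤-reflexive (^-zeroˡ (2 * b))) (m^n>0 n {{>-nonZero 1≤n}} (a + 2 * b * 1))))
    where
    levelG : Level G n (store κ₂ headᴬ 0 0) (queueOf κ₂)
    levelG = search-rule 1≤n (copied r₁) r₂
    levelH : Level H n (store κ₅ headᴬ 0 0) (queueOf κ₅)
    levelH = search-rule 1≤n (copied′ r₁ r₂ r₃ r₄) r₅
    totalG = Level.total levelG sp
    totalH = Level.total levelH sp
    MG = proj₁ totalG
    MH = proj₁ totalH
    -- The 1 keeps M positive, so that costs independent of the queue are also bounded by a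
    -- polynomial times M.
    M = MG ⊔ MH ⊔ 1
    X = cost pieces n
    1≤M : 1 ≤ M
    1≤M = m≤n⊔m (MG ⊔ MH) 1
    T≤ : store κ₂ tailᴬ 0 0 ≤ suc n * M
    T≤ = ≤-trans (proj₂ (proj₂ totalG)) (*-monoʳ-≤ (suc n) (≤-trans (m≤m⊔n MG MH) (m≤m⊔n (MG ⊔ MH) 1)))
    T′≤ : store κ₅ tailᴬ 0 0 ≤ suc n * M
    T′≤ = ≤-trans (proj₂ (proj₂ totalH)) (*-monoʳ-≤ (suc n) (≤-trans (m≤n⊔m MG MH) (m≤m⊔n (MG ⊔ MH) 1)))
    s₅ = pickBody ⨟ queryBody
    s₄ = node ⨟ s₅
    s₃ = init ⨟ s₄
    s₂ = copy 2 ⨟ s₃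
    u₂ : cost s₂ n ≤ X
    u₂ = cost-≤ʳ 1≤n (copy 1) s₂
    u₃ : cost s₃ n ≤ X
    u₃ = ≤-trans (cost-≤ʳ 1≤n (copy 2) s₃) u₂
    u₄ : cost s₄ n ≤ X
    u₄ = ≤-trans (cost-≤ʳ 1≤n init s₄) u₃
    u₅ : cost s₅ n ≤ X
    u₅ = ≤-trans (cost-≤ʳ 1≤n node s₅) u₄
    c₁ : cost (copy 1) n ≤ X
    c₁ = cost-≤ˡ 1≤n (copy 1) s₂
    c₂ : cost (copy 2) n ≤ X
    c₂ = ≤-trans (cost-≤ˡ 1≤n (copy 2) s₃) u₂
    c₃ : cost init n ≤ X
    c₃ = ≤-trans (cost-≤ˡ 1≤n init s₄) u₃
    c₄ : cost node n ≤ X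
    c₄ = ≤-trans (cost-≤ˡ 1≤n node s₅) u₄
    c₅ : cost pickBody n ≤ X
    c₅ = ≤-trans (cost-≤ˡ 1≤n pickBody queryBody) u₅
    c₆ : cost queryBody n ≤ X
    c₆ = ≤-trans (cost-≤ʳ 1≤n pickBody queryBody) u₅
    -- A prime divisor of n forces n ≥ 2, which permits a constant factor to be absorbed by a power
    -- of n.
    2≤n : 2 ≤ n
    2≤n = ≤-trans (nonTrivial⇒n>1 p {{prime⇒nonTrivial (proj₁ sp)}}) (∣⇒≤ {{>-nonZero 1≤n}} (proj₁ (proj₂ sp)))
    poly-bound : ∀ {C d Y} → Y ≤ C * n ^ d → 270 * (n * suc Y * M) ≤ n ^ (270 * suc C + suc d) * M
    poly-bound {C} {d} {Y} Y≤ = begin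
      270 * (n * suc Y * M)                    ≤⟨ *-monoʳ-≤ 270 (*-monoˡ-≤ M (*-monoʳ-≤ n (+-mono-≤ (m^n>0 n {{>-nonZero 1≤n}} d) Y≤))) ⟩
      270 * (n * (suc C * n ^ d) * M)          ≡⟨ solve 5 (λ k n c e m → k :* (n :* (c :* e) :* m) := k :* c :* (n :* e) :* m) refl 270 n (suc C) (n ^ d) M ⟩
      270 * suc C * n ^ suc d * M              ≤⟨ *-monoˡ-≤ M (*-monoˡ-≤ (n ^ suc d) (n≤m^n (270 * suc C) 2≤n)) ⟩
      n ^ (270 * suc C) * n ^ suc d * M        ≡⟨ cong (_* M) (^-distribˡ-+-* n (270 * suc C) (suc d)) ⟨
      n ^ (270 * suc C + suc d) * M            ∎
      where
      open ≤-Reasoning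
      open +-*-Solver

theorem1p2 : Σ Program λ A → Σ ℕ λ c →
    ∀ (n : ℕ) (G H : FinGroup n) (O : Oracle) → DecidesSeriesIsomorphism O G H →
    Σ Config λ κ → Σ ℕ λ t →
    Run O A (input G H) κ t ×
    (Accepting κ ⇔ Isomorphic G H) ×
    (∀ p → IsSmallestPrimeDivisor p n → WithinBound p n c t)
theorem1p2 = algorithm , exponent , λ n G H O decides →
  let 1≤n = ≤-trans z<s (toℕ<n (FinGroup.unit G)) in
  case halts {O} {n} 1≤n (copy 1) refl refl (input G H) refl of λ where
    (κ₁ , t₁ , r₁ , p₁) → let e₁ = unchanged r₁ 0 refl 0 0 in
      case search-halts {O} 1≤n κ₁ e₁ of λ where
        (κ₂ , t₂ , r₂ , p₂) → let e₂ = trans (unchanged r₂ 0 refl 0 0) e₁ in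
          case scan-halts {O} 1≤n qᴬ (scalar tailᴬ) pickBody refl refl refl refl κ₂ e₂ of λ where
            (κ₃ , t₃ , r₃ , p₃) → let e₃ = trans (unchanged r₃ 0 refl 0 0) e₂ in
              case halts {O} {n} 1≤n (copy 2) refl refl κ₃ e₃ of λ where
                (κ₄ , t₄ , r₄ , p₄) → let e₄ = trans (unchanged r₄ 0 refl 0 0) e₃ in
                  case search-halts {O} 1≤n κ₄ e₄ of λ where
                    (κ₅ , t₅ , r₅ , p₅) → let e₅ = trans (unchanged r₅ 0 refl 0 0) e₄ in
                      case scan-halts {O} 1≤n qᴬ (scalar tailᴬ) queryBody refl refl refl refl κ₅ e₅ of λ where
                        (κ₆ , t₆ , r₆ , p₆) →
                          κ₆ , t₁ + (t₂ + (t₃ + (t₄ + (t₅ + t₆)))) ,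
                          run-seq r₁ (run-seq r₂ (run-seq r₃ (run-seq r₄ (run-seq r₅ r₆)))) ,
                          correct n G H O decides 1≤n r₁ r₂ r₃ r₄ r₅ r₆ ,
                          timed n G H O 1≤n r₁ r₂ r₃ r₄ r₅ p₁ p₂ p₃ p₄ p₅ p₆
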